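{- Let $n$ be a positive odd integer. Then \[ \sum_{k=0}^{n-1}[4k+1]\frac{(q;q^2)_k^6}{(q^2;q^2)_k^6}\, q^k \equiv [n]\,q^{(1-n)/2} \sum_{k=0}^{(n-1)/2} \frac{(q;q^2)_k^4}{(q^2;q^2)_k^4}\, q^{2k} \pmod{[n]\Phi_n(q)^2}, \] and \[ \sum_{k=0}^{(n-1)/2}[4k+1]\frac{(q;q^2)_k^6}{(q^2;q^2)_k^6}\, q^k \equiv [n]\,q^{(1-n)/2} \sum_{k=0}^{(n-1)/2} \frac{(q;q^2)_k^4}{(q^2;q^2)_k^4}\, q^{2k} \pmod{[n]\Phi_n(q)^2}. \]
   Context: Here $q$ is an indeterminate. For $x$ and a base $p$ (a power of $q$), $(x;p)_k=\prod_{j=0}^{k-1}(1-xp^j)$ for integers $k\ge 0$. The $q$-integer is $[n]=1+q+\cdots+q^{n-1}$, and $\Phi_n(q)$ is the $n$-th cyclotomic polynomial. For rational functions $A(q),B(q)$ and a polynomial $P(q)$, $A(q)\equiv B(q)\pmod{P(q)}$ means that the numerator of the reduced form of $A(q)-B(q)$ is divisible by $P(q)$ in $\mathbb{Z}[q]$. -}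

module Defs where

open import Data.Nat as ℕ using (ℕ; zero; suc; _∸_)
open import Data.Nat.Divisibility using (_∣?_)
open import Data.Integer as ℤ using (ℤ; +_; 0ℤ; 1ℤ; -1ℤ)
open import Data.List using (List; []; _∷_; _++_; [_]; foldr; reverse; length; replicate; upTo; map)
open import Data.Product using (Σ; _×_; _,_; proj₁; proj₂)
open import Relation.Binary.PropositionalEquality using (_≡_)
open import Relation.Nullary using (¬_; does)
open import Data.Bool using (if_then_else_)

-- Polynomials in ℤ[q], as coefficient lists (lowest degree first).
-- Lists may carry trailing zeros; equality is coefficientwise.

Poly : Set
Poly = List ℤ

coeff : Poly → ℕ → ℤ
coeff []       _       = 0ℤ
coeff (a ∷ _)  zero    = a
coeff (_ ∷ as) (suc i) = coeff as i

infix 4 _≈ₚ_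
_≈ₚ_ : Poly → Poly → Set
f ≈ₚ g = ∀ i → coeff f i ≡ coeff g i

infixl 6 _+ₚ_ _-ₚ_
infixl 7 _*ₚ_ _·ₚ_

_+ₚ_ : Poly → Poly → Poly
[]       +ₚ g        = g
(a ∷ f)  +ₚ []       = a ∷ f
(a ∷ f)  +ₚ (b ∷ g)  = (a ℤ.+ b) ∷ (f +ₚ g)

_·ₚ_ : ℤ → Poly → Poly
c ·ₚ f = map (c ℤ.*_) f

-ₚ_ : Poly → Poly
-ₚ f = -1ℤ ·ₚ f

_-ₚ_ : Poly → Poly → Poly
f -ₚ g = f +ₚ (-ₚ g)

_*ₚ_ : Poly → Poly → Poly
[]      *ₚ g = []
(a ∷ f) *ₚ g = (a ·ₚ g) +ₚ (0ℤ ∷ (f *ₚ g))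

0ₚ 1ₚ : Poly
0ₚ = []
1ₚ = 1ℤ ∷ []

qpow : ℕ → Poly
qpow m = replicate m 0ℤ ++ (1ℤ ∷ [])

_^ₚ_ : Poly → ℕ → Poly
f ^ₚ zero  = 1ₚ
f ^ₚ suc k = f *ₚ (f ^ₚ k)

infix 4 _∣ₚ_
_∣ₚ_ : Poly → Poly → Set
f ∣ₚ g = Σ Poly λ c → g ≈ₚ f *ₚ c

IsUnitₚ : Poly → Set
IsUnitₚ f = f ∣ₚ 1ₚ

Coprimeₚ : Poly → Poly → Set
Coprimeₚ f g = ∀ h → h ∣ₚ f → h ∣ₚ g → IsUnitₚ h

qint : ℕ → Poly
qint m = replicate m 1ℤ

qpoch : ℕ → ℕ → ℕ → Poly
qpoch a b zero    = 1ₚ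
qpoch a b (suc k) = qpoch a b k *ₚ (1ₚ -ₚ qpow (a ℕ.+ b ℕ.* k))

-- Cyclotomic polynomials, via  q^n - 1 = ∏_{d ∣ n} Φ_d(q).

normalize : Poly → Poly
normalize f = reverse (dropZ (reverse f))
  where
  dropZ : List ℤ → List ℤ
  dropZ [] = []
  dropZ (a ∷ as) with does (a ℤ.≟ 0ℤ)
  ... | Data.Bool.true  = dropZ as
  ... | Data.Bool.false = a ∷ as

leadCoeff : Poly → ℤ
leadCoeff f with reverse (normalize f)
... | []    = 0ℤ
... | a ∷ _ = a

divMonicFuel : ℕ → Poly → Poly → Poly
divMonicFuel zero     f d = []
divMonicFuel (suc fu) f d with length (normalize f) ℕ.<? length (normalize d)
  where open import Data.Nat using (_<?_)
... | Relation.Nullary.yes _ = []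
... | Relation.Nullary.no  _ =
  let s = length (normalize f) ∸ length (normalize d)
      t = leadCoeff f ·ₚ qpow s
  in t +ₚ divMonicFuel fu (normalize (f -ₚ t *ₚ d)) d

divMonic : Poly → Poly → Poly
divMonic f d = divMonicFuel (suc (length f)) f d

prodDivs : ℕ → List Poly → Poly
prodDivs N tbl = go 1 tbl
  where
  go : ℕ → List Poly → Poly
  go d []       = 1ₚ
  go d (p ∷ ps) = (if does (d ∣? N) then p else 1ₚ) *ₚ go (suc d) ps

cycTable : ℕ → List Poly
cycTable zero    = []
cycTable (suc m) =
  cycTable m ++ [ divMonic (qpow (suc m) -ₚ 1ₚ) (prodDivs (suc m) (cycTable m)) ]

-- Φ_n(q) for n ≥ 1 (Φ_0 is set to 1 by convention; unused)
cyclo : ℕ → Poly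
cyclo n with reverse (cycTable n)
... | []    = 1ₚ
... | p ∷ _ = p

-- Rational functions as (numerator , denominator) pairs, not reduced.

Frac : Set
Frac = Poly × Poly

infixl 6 _+f_ _-f_
infixl 7 _*f_

_+f_ : Frac → Frac → Frac
(a , b) +f (c , d) = (a *ₚ d +ₚ c *ₚ b , b *ₚ d)

_*f_ : Frac → Frac → Frac
(a , b) *f (c , d) = (a *ₚ c , b *ₚ d)

_-f_ : Frac → Frac → Frac
A -f B = A +f ((-ₚ 1ₚ) , 1ₚ) *f B

0f : Frac
0f = (0ₚ , 1ₚ)

poly : Poly → Frac
poly f = (f , 1ₚ)

sumF : ℕ → (ℕ → Frac) → Frac
sumF m F = foldr (λ k acc → F k +f acc) 0f (upTo m)

-- A ≡ B (mod P): the numerator N of the reduced form N/D of A - B is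
-- divisible by P.  "N/D is the reduced form of A - B" means D ≠ 0,
-- N and D coprime in ℤ[q], and A - B = N/D.
ReducedFormOf : Poly → Poly → Frac → Set
ReducedFormOf N D (a , b) =
  (¬ (D ≈ₚ 0ₚ)) × Coprimeₚ N D × (a *ₚ D ≈ₚ N *ₚ b)

infix 4 _≡_[mod_]
_≡_[mod_] : Frac → Frac → Poly → Set
A ≡ B [mod P ] =
  ∀ N D → ReducedFormOf N D (A -f B) → P ∣ₚ N

{-# OPTIONS --safe #-}

-- Let τₖ = (q;q²)ₖ / (q²;q²)ₖ and n = 2N + 1.  The q-Pfaff–Saalschütz sum expands τₖ² qᵏ as ∑ⱼ cⱼ S(k,j) with
-- S(k,j) = (q^(-2k); q²)ⱼ (q^(2k+1); q²)ⱼ.  After exchanging the summations, the inner sums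
-- Vⱼ = ∑_{k ≤ N} [4k+1] τₖ⁴ S(k,j) satisfy a first-order recurrence in j by Gosper's telescoping: its boundary
-- term at k = N contains (1 - qⁿ)³ and so vanishes modulo Φₙ³.  As V_N is a single product, all Vⱼ are known
-- modulo Φₙ³, which is the congruence for the sum up to N.  The terms with N < k < n contain Φₙ⁶.
--
-- For a divisor d of n with 1 < d < n, one has τ_{ld+r} ≡ τ_{ld} τᵣ modulo Φ_d, so the left side splits into blocks
-- proportional to the sums for d, which vanish modulo Φ_d by the first part; so does the right side, as Φ_d ∣ [n].
-- To make sense of τₖ modulo Φ_d it is written as a central q-binomial coefficient over (-q;q)ₖ², whose factors
-- are units modulo Φ_d because d is odd.
--
-- Finally [n] Φₙ² is the product of Φₙ³ and the Φ_d with 1 < d < n, d ∣ n, and these are coprime in pairs.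

module Submission where

open import Algebra.Bundles using (CommutativeMonoid; CommutativeRing)
open import Algebra.Solver.Ring.AlmostCommutativeRing using (_-Raw-AlmostCommutative⟶_; fromCommutativeRing)
open import Data.Bool.Base using (if_then_else_)
open import Data.Empty using (⊥-elim)
open import Data.Integer.Base as ℤ using (ℤ; +_; -[1+_]; +[1+_]; 0ℤ; 1ℤ; -1ℤ; _⊖_)
import Data.Integer.Properties as ℤ
open import Data.Integer.Tactic.RingSolver using (solve-∀)
open import Data.List.Base as List using (List; []; _∷_; _∷ʳ_; applyUpTo; foldr; length; reverse)
import Data.List.Properties as List
import Data.Maybe.Base as Maybe
open import Data.Nat as ℕ using (ℕ; zero; suc; _<_; _≤_; z≤n; s≤s; _∸_)
import Data.Nat.DivMod as ℕ
open import Data.Nat.Divisibility as ℕ using (divides)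
open import Data.Nat.GCD as ℕ using (module Bézout; gcd)
open import Data.Nat.Induction using (<-rec)
import Data.Nat.Properties as ℕ
open import Data.Nat.Solver using (module +-*-Solver)
open import Data.Product using (Σ; ∃; _×_; _,_; proj₁; proj₂)
open import Data.Sum using (_⊎_; inj₁; inj₂)
open import Function.Base using (_∘_)
open import Level using (0ℓ; _⊔_)
open import Relation.Binary.Bundles using (Setoid)
open import Relation.Binary.Definitions using (tri<; tri≈; tri>)
open import Relation.Binary.PropositionalEquality as ≡ using (_≡_; _≢_)
open import Relation.Nullary using (Dec; yes; no; does; ¬_)
open import Relation.Nullary.Decidable using (dec⇒maybe)
open import Defs

-- In ℤ[q] coprimality does not give inverses: for a prime n, 1 - q divides n modulo Φₙ and is no
-- unit there. Coprimality is therefore replaced by regularity, that is, being no zero divisor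
-- modulo P. A congruence of rational functions becomes an equation in the ring of fractions with
-- regular denominators, taken modulo P, and there the regular factors are units. The q-series
-- argument needs only such units and (1 - qⁿ)³ = 0, so it is carried out once in an arbitrary
-- commutative ring and applied with P = Φₙ³ and with P = Φ_d. With P = 0 the same construction
-- gives the rational functions. It identifies the summands as stated with their rewriting by
-- q-binomial coefficients, and so carries divisibility over to the numerator of every reduced form.
-- The cyclotomic polynomials are given by an algorithm. That its divisions are exact and that
-- distinct Φ_d are coprime is proved in one strong induction. The case n = 1 is separate, because
-- the argument divides by 1 - q; there both sides are equal.

module ℕS = +-*-Solver

-- Integer coefficients for the ring solver over any commutative ring

module IntegerRingSolver {c ℓ} (R : CommutativeRing c ℓ) where
  open CommutativeRing R
  open import Algebra.Properties.Semiring.Mult.TCOptimised semiring using (×-homo-+; 1+×) renaming (_×_ to _⋆_)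
  open import Algebra.Properties.Ring ring
  open import Algebra.Properties.AbelianGroup +-abelianGroup using (⁻¹-∙-comm)
  open import Relation.Binary.Reasoning.Setoid setoid

  fromℤ : ℤ → Carrier
  fromℤ (+ n)    = n ⋆ 1#
  fromℤ -[1+ n ] = - (suc n ⋆ 1#)

  fromℤ-⊖ : ∀ m n → fromℤ (m ⊖ n) ≈ m ⋆ 1# - n ⋆ 1#
  fromℤ-⊖ zero zero = sym (-‿inverseʳ _)
  fromℤ-⊖ zero (suc n) = sym (+-identityˡ _)
  fromℤ-⊖ (suc m) zero = sym (trans (+-congˡ -0#≈0#) (+-identityʳ _))
  fromℤ-⊖ (suc m) (suc n) = begin
    fromℤ (suc m ⊖ suc n) ≡⟨ ≡.cong fromℤ (ℤ.[1+m]⊖[1+n]≡m⊖n m n) ⟩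
    fromℤ (m ⊖ n) ≈⟨ fromℤ-⊖ m n ⟩
    m ⋆ 1# - n ⋆ 1# ≈⟨ +-congʳ (+-identityˡ _) ⟨
    (0# + m ⋆ 1#) - n ⋆ 1# ≈⟨ +-congʳ (+-congʳ (-‿inverseʳ 1#)) ⟨
    (1# - 1# + m ⋆ 1#) - n ⋆ 1# ≈⟨ +-congʳ (+-assoc _ _ _) ⟩
    (1# + (- 1# + m ⋆ 1#)) - n ⋆ 1# ≈⟨ +-congʳ (+-congˡ (+-comm _ _)) ⟩
    (1# + (m ⋆ 1# + - 1#)) - n ⋆ 1# ≈⟨ +-congʳ (+-assoc _ _ _) ⟨
    ((1# + m ⋆ 1#) + - 1#) - n ⋆ 1# ≈⟨ +-assoc _ _ _ ⟩
    (1# + m ⋆ 1#) + (- 1# - n ⋆ 1#) ≈⟨ +-congˡ (⁻¹-∙-comm _ _) ⟩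
    (1# + m ⋆ 1#) - (1# + n ⋆ 1#) ≈⟨ +-cong (1+× m 1#) (-‿cong (1+× n 1#)) ⟨
    suc m ⋆ 1# - suc n ⋆ 1# ∎

  fromℤ-+ : ∀ i j → fromℤ (i ℤ.+ j) ≈ fromℤ i + fromℤ j
  fromℤ-+ (+ m) (+ n) = ×-homo-+ 1# m n
  fromℤ-+ (+ m) -[1+ n ] = fromℤ-⊖ m (suc n)
  fromℤ-+ -[1+ m ] (+ n) = trans (fromℤ-⊖ n (suc m)) (+-comm _ _)
  fromℤ-+ -[1+ m ] -[1+ n ] = begin
    - (suc (suc (m ℕ.+ n)) ⋆ 1#) ≡⟨ ≡.cong (λ k → - (suc k ⋆ 1#)) (≡.sym (ℕ.+-suc m n)) ⟩
    - ((suc m ℕ.+ suc n) ⋆ 1#) ≈⟨ -‿cong (×-homo-+ 1# (suc m) (suc n)) ⟩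
    - (suc m ⋆ 1# + suc n ⋆ 1#) ≈⟨ ⁻¹-∙-comm _ _ ⟨
    - (suc m ⋆ 1#) - suc n ⋆ 1# ∎
    where import Data.Nat.Properties as ℕ

  fromℤ-neg : ∀ i → fromℤ (ℤ.- i) ≈ - fromℤ i
  fromℤ-neg (+ zero) = sym -0#≈0#
  fromℤ-neg (+ suc n) = refl
  fromℤ-neg -[1+ n ] = sym (-‿involutive _)

  fromℤ-+* : ∀ m j → fromℤ ((+ m) ℤ.* j) ≈ m ⋆ 1# * fromℤ j
  fromℤ-+* zero j = trans (reflexive (≡.cong fromℤ (ℤ.*-zeroˡ j))) (sym (zeroˡ _))
  fromℤ-+* (suc m) j = begin
    fromℤ ((+ suc m) ℤ.* j) ≡⟨ ≡.cong fromℤ (ℤ.suc-* (+ m) j) ⟩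
    fromℤ (j ℤ.+ (+ m) ℤ.* j) ≈⟨ fromℤ-+ j _ ⟩
    fromℤ j + fromℤ ((+ m) ℤ.* j) ≈⟨ +-cong (*-identityˡ _) (sym (fromℤ-+* m j)) ⟨
    1# * fromℤ j + m ⋆ 1# * fromℤ j ≈⟨ distribʳ _ _ _ ⟨
    (1# + m ⋆ 1#) * fromℤ j ≈⟨ *-congʳ (1+× m 1#) ⟨
    suc m ⋆ 1# * fromℤ j ∎

  fromℤ-* : ∀ i j → fromℤ (i ℤ.* j) ≈ fromℤ i * fromℤ j
  fromℤ-* (+ m) j = fromℤ-+* m j
  fromℤ-* -[1+ m ] j = begin
    fromℤ (-[1+ m ] ℤ.* j) ≡⟨ ≡.cong fromℤ (ℤ.neg-distribˡ-* (+ suc m) j) ⟨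
    fromℤ (ℤ.- ((+ suc m) ℤ.* j)) ≈⟨ fromℤ-neg ((+ suc m) ℤ.* j) ⟩
    - fromℤ ((+ suc m) ℤ.* j) ≈⟨ -‿cong (fromℤ-+* (suc m) j) ⟩
    - (suc m ⋆ 1# * fromℤ j) ≈⟨ -‿distribˡ-* _ _ ⟩
    - (suc m ⋆ 1#) * fromℤ j ∎

  ℤ⟶R : ℤ.+-*-rawRing -Raw-AlmostCommutative⟶ fromCommutativeRing R
  ℤ⟶R = record
    { ⟦_⟧ = fromℤ ; +-homo = fromℤ-+ ; *-homo = fromℤ-* ; -‿homo = fromℤ-neg
    ; 0-homo = refl ; 1-homo = refl }

  open import Algebra.Solver.Ring ℤ.+-*-rawRing (fromCommutativeRing R) ℤ⟶R
    (λ i j → Maybe.map (λ i≡j → reflexive (≡.cong fromℤ i≡j)) (dec⇒maybe (i ℤ.≟ j))) public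
    using (Polynomial; con; _:^_; :-_; _:+_; _:*_; _:-_; _:=_; solve)

  𝟙 : ∀ {n} → Polynomial n
  𝟙 = con (+ 1)

-- Finite sums, finite products and units

module Range {c ℓ} (M : CommutativeMonoid c ℓ) where
  open CommutativeMonoid M
  open import Relation.Binary.Reasoning.Setoid setoid
  open import Algebra.Properties.CommutativeSemigroup commutativeSemigroup using (interchange)

  ⨁ : ℕ → (ℕ → Carrier) → Carrier
  ⨁ zero    f = ε
  ⨁ (suc n) f = ⨁ n f ∙ f n

  ⨁-cong : ∀ n {f g} → (∀ i → i < n → f i ≈ g i) → ⨁ n f ≈ ⨁ n g
  ⨁-cong zero    f≈g = refl
  ⨁-cong (suc n) f≈g = ∙-cong (⨁-cong n λ i i<n → f≈g i (ℕ.m<n⇒m<1+n i<n)) (f≈g n ℕ.≤-refl)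

  ⨁-front : ∀ n f → ⨁ (suc n) f ≈ f 0 ∙ ⨁ n (f ∘ suc)
  ⨁-front zero    f = comm _ _
  ⨁-front (suc n) f = trans (∙-congʳ (⨁-front n f)) (assoc _ _ _)

  ⨁-ε : ∀ n {f} → (∀ i → i < n → f i ≈ ε) → ⨁ n f ≈ ε
  ⨁-ε zero    f≈ε = refl
  ⨁-ε (suc n) f≈ε =
    trans (∙-cong (⨁-ε n λ i i<n → f≈ε i (ℕ.m<n⇒m<1+n i<n)) (f≈ε n ℕ.≤-refl)) (identityˡ ε)

  ⨁-∙ : ∀ n f g → ⨁ n (λ i → f i ∙ g i) ≈ ⨁ n f ∙ ⨁ n g
  ⨁-∙ zero    f g = sym (identityˡ ε)
  ⨁-∙ (suc n) f g = trans (∙-congʳ (⨁-∙ n f g)) (interchange _ _ _ _)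

  ⨁-swap : ∀ m n (f : ℕ → ℕ → Carrier) → ⨁ m (λ i → ⨁ n (f i)) ≈ ⨁ n (λ j → ⨁ m (λ i → f i j))
  ⨁-swap zero    n f = sym (⨁-ε n λ _ _ → refl)
  ⨁-swap (suc m) n f = trans (∙-congʳ (⨁-swap m n f)) (sym (⨁-∙ n _ (f m)))

  ⨁-+ : ∀ m n f → ⨁ (n ℕ.+ m) f ≈ ⨁ m f ∙ ⨁ n (λ i → f (i ℕ.+ m))
  ⨁-+ m zero    f = sym (identityʳ _)
  ⨁-+ m (suc n) f = trans (∙-congʳ (⨁-+ m n f)) (assoc _ _ _)

  ⨁-reverse : ∀ n f → ⨁ n f ≈ ⨁ n (λ i → f (n ∸ suc i))
  ⨁-reverse zero    f = refl
  ⨁-reverse (suc n) f = begin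
    ⨁ n f ∙ f n                            ≈⟨ comm _ _ ⟩
    f n ∙ ⨁ n f                            ≈⟨ ∙-congˡ (⨁-reverse n f) ⟩
    f n ∙ ⨁ n (λ i → f (n ∸ suc i))        ≈⟨ ⨁-front n (λ i → f (n ∸ i)) ⟨
    ⨁ (suc n) (λ i → f (n ∸ i))            ∎

module RingExtra {c ℓ} (R : CommutativeRing c ℓ) where
  open CommutativeRing R
  open import Relation.Binary.Reasoning.Setoid setoid
  open IntegerRingSolver R
  open import Algebra.Properties.Semiring.Exp semiring
  open import Algebra.Properties.AbelianGroup +-abelianGroup using (∙-cancelʳ)
  open Range +-commutativeMonoid public
    renaming (⨁ to ∑; ⨁-cong to ∑-cong; ⨁-front to ∑-front; ⨁-ε to ∑-0; ⨁-∙ to ∑-+; ⨁-swap to ∑-swap; ⨁-+ to ∑-split)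
  open Range *-commutativeMonoid public
    renaming (⨁ to ∏; ⨁-cong to ∏-cong; ⨁-front to ∏-front; ⨁-∙ to ∏-*; ⨁-+ to ∏-split; ⨁-reverse to ∏-reverse)

  *-distribˡ-∑ : ∀ n a f → a * ∑ n f ≈ ∑ n (λ i → a * f i)
  *-distribˡ-∑ zero    a f = zeroʳ a
  *-distribˡ-∑ (suc n) a f = trans (distribˡ a _ _) (+-congʳ (*-distribˡ-∑ n a f))

  *-distribʳ-∑ : ∀ n a f → ∑ n f * a ≈ ∑ n (λ i → f i * a)
  *-distribʳ-∑ zero    a f = zeroˡ a
  *-distribʳ-∑ (suc n) a f = trans (distribʳ a _ _) (+-congʳ (*-distribʳ-∑ n a f))

  -- For b chosen as a combination of right-hand sides of known equations (and a of the left-hand sides),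
  -- the second premise is a ring identity.
  modulo : ∀ {a b lhs rhs} → a ≈ b → lhs + b ≈ rhs + a → lhs ≈ rhs
  modulo a≈b eq = ∙-cancelʳ _ _ _ (trans eq (+-congˡ a≈b))

  Unit : Carrier → Set _
  Unit u = ∃ λ v → u * v ≈ 1#

  unit-cancelˡ : ∀ {u x y} → Unit u → u * x ≈ u * y → x ≈ y
  unit-cancelˡ {u} {x} {y} (v , uv≈1) ux≈uy = begin
    x             ≈⟨ *-identityˡ x ⟨
    1# * x        ≈⟨ *-congʳ uv≈1 ⟨
    u * v * x     ≈⟨ solve 3 (λ u v x → u :* v :* x := v :* (u :* x)) refl u v x ⟩
    v * (u * x)   ≈⟨ *-congˡ ux≈uy ⟩
    v * (u * y)   ≈⟨ solve 3 (λ u v x → v :* (u :* x) := u :* v :* x) refl u v y ⟩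
    u * v * y     ≈⟨ *-congʳ uv≈1 ⟩
    1# * y        ≈⟨ *-identityˡ y ⟩
    y             ∎

  unit-* : ∀ {u v} → Unit u → Unit v → Unit (u * v)
  unit-* {u} {v} (u⁻ , uu⁻≈1) (v⁻ , vv⁻≈1) = u⁻ * v⁻ , (begin
    u * v * (u⁻ * v⁻)     ≈⟨ solve 4 (λ u v u⁻ v⁻ → u :* v :* (u⁻ :* v⁻) := u :* u⁻ :* (v :* v⁻)) refl u v u⁻ v⁻ ⟩
    u * u⁻ * (v * v⁻)     ≈⟨ *-cong uu⁻≈1 vv⁻≈1 ⟩
    1# * 1#               ≈⟨ *-identityˡ 1# ⟩
    1#                    ∎)

  unit-1 : Unit 1#
  unit-1 = 1# , *-identityˡ 1#

  unit-resp : ∀ {u v} → u ≈ v → Unit u → Unit v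
  unit-resp u≈v (w , uw≈1) = w , trans (*-congʳ (sym u≈v)) uw≈1

  unit-∏ : ∀ n {f} → (∀ i → i < n → Unit (f i)) → Unit (∏ n f)
  unit-∏ zero    h = unit-1
  unit-∏ (suc n) h = unit-* (unit-∏ n λ i i<n → h i (ℕ.m<n⇒m<1+n i<n)) (h n ℕ.≤-refl)

  ^-inverse : ∀ {x y} → x * y ≈ 1# → ∀ k → x ^ k * y ^ k ≈ 1#
  ^-inverse xy≈1 zero = *-identityˡ 1#
  ^-inverse {x} {y} xy≈1 (suc k) = begin
    x * x ^ k * (y * y ^ k)   ≈⟨ solve 4 (λ x y a b → x :* a :* (y :* b) := x :* y :* (a :* b)) refl x y (x ^ k) (y ^ k) ⟩
    x * y * (x ^ k * y ^ k)   ≈⟨ *-cong xy≈1 (^-inverse xy≈1 k) ⟩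
    1# * 1#                   ≈⟨ *-identityˡ 1# ⟩
    1#                        ∎

-- The transformation of the sum over an abstract ring

module Kernel {c ℓ} (R : CommutativeRing c ℓ) (q q⁻ : CommutativeRing.Carrier R)
  (qq⁻≈1 : CommutativeRing._≈_ R (CommutativeRing._*_ R q q⁻) (CommutativeRing.1# R)) where
  open CommutativeRing R
  open import Relation.Binary.Reasoning.Setoid setoid
  open import Algebra.Properties.Semiring.Exp semiring
  open import Algebra.Properties.CommutativeSemiring.Exp commutativeSemiring using (^-distrib-*)
  open IntegerRingSolver R
  open RingExtra R

  p p⁻ : Carrier
  p  = q * q
  p⁻ = q⁻ * q⁻

  pp⁻≈1 : p * p⁻ ≈ 1#
  pp⁻≈1 = begin
    p * p⁻                  ≈⟨ solve 2 (λ q q⁻ → q :* q :* (q⁻ :* q⁻) := q :* q⁻ :* (q :* q⁻)) refl q q⁻ ⟩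
    q * q⁻ * (q * q⁻)       ≈⟨ *-cong qq⁻≈1 qq⁻≈1 ⟩
    1# * 1#                 ≈⟨ *-identityˡ 1# ⟩
    1#                      ∎

  p^k*p⁻^k≈1 : ∀ k → p ^ k * p⁻ ^ k ≈ 1#
  p^k*p⁻^k≈1 = ^-inverse pp⁻≈1

  -- S k j = (q^(-2k); q²)ⱼ (q^(2k+1); q²)ⱼ, and H k j is the common part of S k (j+1) and S (k+1) (j+1).
  S H : ℕ → ℕ → Carrier
  S k j = ∏ j λ i → (1# - p⁻ ^ k * p ^ i) * (1# - q * p ^ k * p ^ i)
  H k j = ∏ j λ i → (1# - p⁻ ^ k * p ^ i) * (1# - q * p ^ k * (p * p ^ i))

  -- Of the two families of factors of `S k (suc j)`, `H k j` omits the last of the first and the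
  -- first of the second. Passing from k to k + 1 shifts the families in opposite directions, so
  -- `S-suc-suc` meets the same `H k j` and the two values can be compared without division.
  S-suc : ∀ k j → S k (suc j) ≈ H k j * ((1# - q * p ^ k) * (1# - p⁻ ^ k * p ^ j))
  S-suc k zero = solve 3 (λ q x x⁻ →
      𝟙 :* ((𝟙 :- x⁻ :* 𝟙) :* (𝟙 :- q :* x :* 𝟙)) := 𝟙 :* ((𝟙 :- q :* x) :* (𝟙 :- x⁻ :* 𝟙)))
    refl q (p ^ k) (p⁻ ^ k)
  S-suc k (suc j) = begin
    S k (suc j) * ((1# - p⁻ ^ k * p ^ suc j) * (1# - q * p ^ k * p ^ suc j))
      ≈⟨ *-congʳ (S-suc k j) ⟩
    H k j * ((1# - q * p ^ k) * (1# - p⁻ ^ k * p ^ j)) * ((1# - p⁻ ^ k * p ^ suc j) * (1# - q * p ^ k * p ^ suc j))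
      ≈⟨ solve 5 (λ h a b c d → h :* (a :* b) :* (c :* d) := h :* (b :* d) :* (a :* c)) refl
           (H k j) (1# - q * p ^ k) (1# - p⁻ ^ k * p ^ j) (1# - p⁻ ^ k * p ^ suc j) (1# - q * p ^ k * p ^ suc j) ⟩
    H k (suc j) * ((1# - q * p ^ k) * (1# - p⁻ ^ k * p ^ suc j)) ∎

  S-suc-suc : ∀ k j → S (suc k) (suc j) ≈ H k j * ((1# - p⁻ ^ suc k) * (1# - q * p ^ suc k * p ^ j))
  S-suc-suc k zero = solve 3 (λ q x x⁻ →
      𝟙 :* ((𝟙 :- x⁻ :* 𝟙) :* (𝟙 :- q :* x :* 𝟙)) := 𝟙 :* ((𝟙 :- x⁻) :* (𝟙 :- q :* x :* 𝟙)))
    refl q (p ^ suc k) (p⁻ ^ suc k)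
  S-suc-suc k (suc j) = begin
    S (suc k) (suc j) * ((1# - p⁻ ^ suc k * p ^ suc j) * (1# - q * p ^ suc k * p ^ suc j))
      ≈⟨ *-cong (S-suc-suc k j) (*-congʳ (+-congˡ (-‿cong shift))) ⟩
    H k j * ((1# - p⁻ ^ suc k) * (1# - q * p ^ suc k * p ^ j)) * ((1# - p⁻ ^ k * p ^ j) * (1# - q * p ^ suc k * p ^ suc j))
      ≈⟨ solve 8 (λ h a b c q x y z → h :* (a :* (𝟙 :- q :* (y :* x) :* z)) :* (b :* c)
            := h :* (b :* (𝟙 :- q :* x :* (y :* z))) :* (a :* c)) refl
           (H k j) (1# - p⁻ ^ suc k) (1# - p⁻ ^ k * p ^ j) (1# - q * p ^ suc k * p ^ suc j) q (p ^ k) p (p ^ j) ⟩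
    H k (suc j) * ((1# - p⁻ ^ suc k) * (1# - q * p ^ suc k * p ^ suc j)) ∎
    where
    shift : p⁻ ^ suc k * p ^ suc j ≈ p⁻ ^ k * p ^ j
    shift = begin
      p⁻ * p⁻ ^ k * (p * p ^ j)    ≈⟨ solve 4 (λ a b c d → a :* b :* (c :* d) := c :* a :* (b :* d)) refl p⁻ (p⁻ ^ k) p (p ^ j) ⟩
      p * p⁻ * (p⁻ ^ k * p ^ j)    ≈⟨ *-congʳ pp⁻≈1 ⟩
      1# * (p⁻ ^ k * p ^ j)        ≈⟨ *-identityˡ _ ⟩
      p⁻ ^ k * p ^ j               ∎

  ∏-has-0 : ∀ n {f} i → i < n → f i ≈ 0# → ∏ n f ≈ 0#
  ∏-has-0 (suc n) i i<1+n fi≈0 with ℕ.m≤n⇒m<n∨m≡n (ℕ.≤-pred i<1+n)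
  ... | inj₁ i<n    = trans (*-congʳ (∏-has-0 n i i<n fi≈0)) (zeroˡ _)
  ... | inj₂ ≡.refl = trans (*-congˡ fi≈0) (zeroʳ _)

  1-p⁻ᵏpᵏ≈0 : ∀ k → 1# - p⁻ ^ k * p ^ k ≈ 0#
  1-p⁻ᵏpᵏ≈0 k = trans (+-congˡ (-‿cong (trans (*-comm _ _) (p^k*p⁻^k≈1 k)))) (-‿inverseʳ 1#)

  k<j⇒S≈0 : ∀ {k j} → k < j → S k j ≈ 0#
  k<j⇒S≈0 {k} {j} k<j = ∏-has-0 j k k<j (trans (*-congʳ (1-p⁻ᵏpᵏ≈0 k)) (zeroˡ _))

  k<j⇒H≈0 : ∀ {k j} → k < j → H k j ≈ 0#
  k<j⇒H≈0 {k} {j} k<j = ∏-has-0 j k k<j (trans (*-congʳ (1-p⁻ᵏpᵏ≈0 k)) (zeroˡ _))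

  -- Multiplication by p^k turns expressions in p⁻^k into polynomials in x = p^k, which the solver
  -- can compare. The later cancellations of p^k serve this purpose.
  x-z≈x[1-x⁻z] : ∀ k z → p ^ k - z ≈ p ^ k * (1# - p⁻ ^ k * z)
  x-z≈x[1-x⁻z] k z = begin
    p ^ k - z                      ≈⟨ +-congˡ (-‿cong (*-identityˡ z)) ⟨
    p ^ k - 1# * z                 ≈⟨ +-congˡ (-‿cong (*-congʳ (p^k*p⁻^k≈1 k))) ⟨
    p ^ k - p ^ k * p⁻ ^ k * z     ≈⟨ solve 3 (λ x y z → x :- x :* y :* z := x :* (𝟙 :- y :* z)) refl (p ^ k) (p⁻ ^ k) z ⟩
    p ^ k * (1# - p⁻ ^ k * z)      ∎

  x-1≈x[1-x⁻] : ∀ k → p ^ k - 1# ≈ p ^ k * (1# - p⁻ ^ k)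
  x-1≈x[1-x⁻] k = trans (x-z≈x[1-x⁻z] k 1#) (*-congˡ (+-congˡ (-‿cong (*-identityʳ _))))

  -- The term ratio of `S` in k with its denominators cleared, in the form in which `V-boundary`
  -- shifts the certificate.
  S-step : ∀ k j → (p ^ suc k - p ^ j) * (1# - q * p ^ k) * S (suc k) j
                   ≈ S k j * ((p ^ suc k - 1#) * (1# - q * p ^ k * p ^ j))
  S-step k zero = solve 2 (λ a b → (a :- 𝟙) :* (𝟙 :- b) :* 𝟙 := 𝟙 :* ((a :- 𝟙) :* (𝟙 :- b :* 𝟙)))
    refl (p ^ suc k) (q * p ^ k)
  S-step k (suc j) = begin
    (p ^ suc k - p ^ suc j) * (1# - q * x) * S (suc k) (suc j)
      ≈⟨ *-congˡ (S-suc-suc k j) ⟩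
    (p * x - p * z) * (1# - q * x) * (h * (α * (1# - q * (p * x) * z)))
      ≈⟨ solve 6 (λ h q p x z α →
           (p :* x :- p :* z) :* (𝟙 :- q :* x) :* (h :* (α :* (𝟙 :- q :* (p :* x) :* z)))
           := (x :- z) :* (p :* (𝟙 :- q :* x) :* (h :* (α :* (𝟙 :- q :* (p :* x) :* z)))))
         refl h q p x z α ⟩
    (x - z) * (p * (1# - q * x) * (h * (α * (1# - q * (p * x) * z))))
      ≈⟨ *-congʳ (x-z≈x[1-x⁻z] k z) ⟩
    x * β * (p * (1# - q * x) * (h * (α * (1# - q * (p * x) * z))))
      ≈⟨ solve 7 (λ h q p x z α β →
           x :* β :* (p :* (𝟙 :- q :* x) :* (h :* (α :* (𝟙 :- q :* (p :* x) :* z))))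
           := h :* ((𝟙 :- q :* x) :* β) :* ((p :* x :* α) :* (𝟙 :- q :* x :* (p :* z))))
         refl h q p x z α β ⟩
    h * ((1# - q * x) * β) * ((p * x * α) * (1# - q * x * (p * z)))
      ≈⟨ *-cong (S-suc k j) (*-congʳ (x-1≈x[1-x⁻] (suc k))) ⟨
    S k (suc j) * ((p ^ suc k - 1#) * (1# - q * x * p ^ suc j)) ∎
    where
    h = H k j ; x = p ^ k ; z = p ^ j
    α = 1# - p⁻ ^ suc k
    β = 1# - p⁻ ^ k * z

  -- Here q p^N is q^n with n = 2N + 1. The bound k < N keeps the nilpotent 1 - q^n out of the unit
  -- hypotheses, so division by 1 - q p^j is possible only for j < N. This decides the direction of
  -- the induction in `VE≈O³`.
  module Transformation (N : ℕ)
    (even-unit : ∀ k → k < N → Unit (1# - p ^ suc k))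
    (odd-unit : ∀ k → k < N → Unit (1# - q * p ^ k))
    (1-q-unit : Unit (1# - q))
    (nilpotent : (1# - q * p ^ N) ^ 3 ≈ 0#)
    (τ : ℕ → Carrier) (τ-zero : τ 0 ≈ 1#)
    (τ-suc : ∀ k → k < N → τ (suc k) * (1# - p ^ suc k) ≈ τ k * (1# - q * p ^ k))
    (⟦4_+1⟧ : ℕ → Carrier) (⟦4k+1⟧[1-q] : ∀ k → ⟦4 k +1⟧ * (1# - q) ≈ 1# - q * (p ^ k * p ^ k))
    (⟦n⟧ : Carrier) (⟦n⟧[1-q] : ⟦n⟧ * (1# - q) ≈ 1# - q * p ^ N)
    where

    -- The value for k ≥ N is junk.
    even-inverse : ℕ → Carrier
    even-inverse k with k ℕ.<? N
    ... | yes k<N = proj₁ (even-unit k k<N)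
    ... | no  _   = 0#

    even-inverseʳ : ∀ k → k < N → (1# - p ^ suc k) * even-inverse k ≈ 1#
    even-inverseʳ k k<N with k ℕ.<? N
    ... | yes k<N′ = proj₂ (even-unit k k<N′)
    ... | no  k≮N  = ⊥-elim (k≮N k<N)

    -- These are (q²;q²)ⱼ, (q;q²)ⱼ and (q;q²)ⱼ / (q²;q²)ⱼ³. The last comes from the Saalschütz sum
    -- in base q² with upper parameters q^(-2k), q^(2k+1), q and lower parameters q², q²; the third
    -- (q²;q²)ⱼ is the one present in every basic hypergeometric series.
    E O e : ℕ → Carrier
    E j = ∏ j λ i → 1# - p ^ suc i
    O j = ∏ j λ i → 1# - q * p ^ i
    e j = ∏ j λ i → (1# - q * p ^ i) * even-inverse i ^ 3

    E-unit : ∀ j → j ≤ N → Unit (E j)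
    E-unit j j≤N = unit-∏ j λ i i<j → even-unit i (ℕ.<-≤-trans i<j j≤N)

    e-suc : ∀ j → j < N → e (suc j) * (1# - p ^ suc j) ^ 3 ≈ e j * (1# - q * p ^ j)
    e-suc j j<N = begin
      e j * (a * v ^ 3) * u ^ 3        ≈⟨ solve 4 (λ e a u v → e :* (a :* v :^ 3) :* u :^ 3 := e :* a :* (u :* v) :^ 3) refl (e j) a u v ⟩
      e j * a * (u * v) ^ 3            ≈⟨ *-congˡ (^-congˡ 3 (even-inverseʳ j j<N)) ⟩
      e j * a * 1# ^ 3                 ≈⟨ solve 1 (λ a → a :* 𝟙 :^ 3 := a) refl (e j * a) ⟩
      e j * a                          ∎
      where u = 1# - p ^ suc j ; v = even-inverse j ; a = 1# - q * p ^ j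

    eE³≈O : ∀ j → j ≤ N → e j * E j ^ 3 ≈ O j
    eE³≈O zero _ = solve 0 (𝟙 :* 𝟙 :^ 3 := 𝟙) refl
    eE³≈O (suc j) j<N = begin
      e (suc j) * (E j * u) ^ 3           ≈⟨ solve 3 (λ e E u → e :* (E :* u) :^ 3 := e :* u :^ 3 :* E :^ 3) refl (e (suc j)) (E j) u ⟩
      e (suc j) * u ^ 3 * E j ^ 3         ≈⟨ *-congʳ (e-suc j j<N) ⟩
      e j * a * E j ^ 3                   ≈⟨ solve 3 (λ e E a → e :* a :* E :^ 3 := e :* E :^ 3 :* a) refl (e j) (E j) a ⟩
      e j * E j ^ 3 * a                   ≈⟨ *-congʳ (eE³≈O j (ℕ.<⇒≤ j<N)) ⟩
      O (suc j)                           ∎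
      where u = 1# - p ^ suc j ; a = 1# - q * p ^ j

    τE≈O : ∀ j → j ≤ N → τ j * E j ≈ O j
    τE≈O zero _ = trans (*-identityʳ _) τ-zero
    τE≈O (suc j) j<N = begin
      τ (suc j) * (E j * u)       ≈⟨ solve 3 (λ t E u → t :* (E :* u) := t :* u :* E) refl (τ (suc j)) (E j) u ⟩
      τ (suc j) * u * E j         ≈⟨ *-congʳ (τ-suc j j<N) ⟩
      τ j * a * E j               ≈⟨ solve 3 (λ t E a → t :* a :* E := t :* E :* a) refl (τ j) (E j) a ⟩
      τ j * E j * a               ≈⟨ *-congʳ (τE≈O j (ℕ.<⇒≤ j<N)) ⟩
      O (suc j)                   ∎
      where u = 1# - p ^ suc j ; a = 1# - q * p ^ j

    -- τ k ² q^k = ∑ⱼ c′ j (S k j) is a terminating q-Pfaff–Saalschütz sum, proved by induction on k: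
    -- the recurrence of τ, applied to the sum, telescopes in j.
    c′ : ℕ → Carrier
    c′ j = p ^ j * e j

    c-summand : ℕ → ℕ → Carrier
    c-summand k j = (1# - p ^ suc k) ^ 2 * (c′ j * S (suc k) j) - q * (1# - q * p ^ k) ^ 2 * (c′ j * S k j)

    -- The right side is an antidifference of the summand in j, as Zeilberger's method finds it for
    -- a first-order recurrence in k. Its factor `H k J` is 0 for k < J, so the complete sum
    -- vanishes.
    c-telescope : ∀ k J → J ≤ N → ∑ (suc J) (c-summand k)
                  ≈ e J * (1# - q * p ^ J) * (1# - q * p * (p ^ k * p ^ k)) * H k J
    c-telescope k zero _ = solve 2 (λ q x → let p = q :* q in
        con (+ 0) :+ ((𝟙 :- p :* x) :^ 2 :* (𝟙 :* 𝟙 :* 𝟙) :- q :* (𝟙 :- q :* x) :^ 2 :* (𝟙 :* 𝟙 :* 𝟙))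
        := 𝟙 :* (𝟙 :- q :* 𝟙) :* (𝟙 :- q :* p :* (x :* x)) :* 𝟙)
      refl q (p ^ k)
    c-telescope k (suc J) J<N = unit-cancelˡ (p⁻ ^ k , p^k*p⁻^k≈1 k) (begin
      x * (∑ (suc J) (c-summand k) + c-summand k (suc J))
        ≈⟨ *-congˡ (+-cong
             (trans (c-telescope k J (ℕ.<⇒≤ J<N)) (*-congʳ (*-congʳ (sym (e-suc J J<N)))))
             (+-cong (*-congˡ (*-congˡ (S-suc-suc k J))) (-‿cong (*-congˡ (*-congˡ (S-suc k J)))))) ⟩
      x * (e′ * (1# - p * z) ^ 3 * g * h
           + ((1# - p * x) ^ 2 * (p * z * e′ * (h * (α * (1# - q * (p * x) * z))))
              - q * (1# - q * x) ^ 2 * (p * z * e′ * (h * ((1# - q * x) * β)))))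
        ≈⟨ solve 9 (λ q p x z e′ h α β g →
             x :* (e′ :* (𝟙 :- p :* z) :^ 3 :* g :* h
               :+ ((𝟙 :- p :* x) :^ 2 :* (p :* z :* e′ :* (h :* (α :* (𝟙 :- q :* (p :* x) :* z))))
                 :- q :* (𝟙 :- q :* x) :^ 2 :* (p :* z :* e′ :* (h :* ((𝟙 :- q :* x) :* β)))))
             := e′ :* h :* (x :* (𝟙 :- p :* z) :^ 3 :* g
                 :+ z :* ((𝟙 :- p :* x) :^ 2 :* (p :* x :* α) :* (𝟙 :- q :* (p :* x) :* z)
                   :- q :* p :* (𝟙 :- q :* x) :^ 3 :* (x :* β))))
           refl q p x z e′ h α β g ⟩
      -- With the common factor e′ h taken out, α and β occur only in the products p x α and x β.
      -- Both are polynomials in x and z, and what remains is a polynomial identity in q, x, z.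
      e′ * h * (x * (1# - p * z) ^ 3 * g
                + z * ((1# - p * x) ^ 2 * (p * x * α) * (1# - q * (p * x) * z)
                       - q * p * (1# - q * x) ^ 3 * (x * β)))
        ≈⟨ *-congˡ (+-congˡ (*-congˡ (+-cong (*-congʳ (*-congˡ (x-1≈x[1-x⁻] (suc k)))) (-‿cong (*-congˡ (x-z≈x[1-x⁻z] k z)))))) ⟨
      e′ * h * (x * (1# - p * z) ^ 3 * g
                + z * ((1# - p * x) ^ 2 * (p * x - 1#) * (1# - q * (p * x) * z)
                       - q * p * (1# - q * x) ^ 3 * (x - z)))
        ≈⟨ *-congˡ (solve 3 (λ q x z → let p = q :* q ; g = 𝟙 :- q :* p :* (x :* x) in
             x :* (𝟙 :- p :* z) :^ 3 :* g
               :+ z :* ((𝟙 :- p :* x) :^ 2 :* (p :* x :- 𝟙) :* (𝟙 :- q :* (p :* x) :* z)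
                   :- q :* p :* (𝟙 :- q :* x) :^ 3 :* (x :- z))
             := (𝟙 :- q :* (p :* z)) :* g :* (x :- z) :* (𝟙 :- q :* x :* (p :* z)))
           refl q x z) ⟩
      e′ * h * ((1# - q * (p * z)) * g * (x - z) * (1# - q * x * (p * z)))
        ≈⟨ *-congˡ (*-congʳ (*-congˡ (x-z≈x[1-x⁻z] k z))) ⟩
      e′ * h * ((1# - q * (p * z)) * g * (x * β) * (1# - q * x * (p * z)))
        ≈⟨ solve 7 (λ e h a g x β b → e :* h :* (a :* g :* (x :* β) :* b) := x :* (e :* a :* g :* (h :* (β :* b))))
             refl e′ h (1# - q * (p * z)) g x β (1# - q * x * (p * z)) ⟩
      x * (e′ * (1# - q * (p * z)) * g * (h * (β * (1# - q * x * (p * z))))) ∎)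
      where
      h = H k J ; x = p ^ k ; z = p ^ J ; e′ = e (suc J)
      α = 1# - p⁻ ^ suc k
      β = 1# - p⁻ ^ k * z
      g = 1# - q * p * (p ^ k * p ^ k)

    τ²-expansion : ∀ k → k ≤ N → ∑ (suc N) (λ j → c′ j * S k j) ≈ τ k ^ 2 * q ^ k
    τ²-expansion zero _ = begin
      ∑ (suc N) (λ j → c′ j * S 0 j)
        ≈⟨ ∑-front N _ ⟩
      1# * 1# * 1# + ∑ N (λ j → c′ (suc j) * S 0 (suc j))
        ≈⟨ +-congˡ (∑-0 N λ j _ → trans (*-congˡ (k<j⇒S≈0 {0} {suc j} (s≤s z≤n))) (zeroʳ _)) ⟩
      1# * 1# * 1# + 0#
        ≈⟨ solve 0 (𝟙 :* 𝟙 :* 𝟙 :+ con (+ 0) := 𝟙 :^ 2 :* 𝟙) refl ⟩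
      1# ^ 2 * 1#
        ≈⟨ *-congʳ (^-congˡ 2 τ-zero) ⟨
      τ 0 ^ 2 * 1# ∎
    τ²-expansion (suc k) k<N = unit-cancelˡ (unit-* (even-unit k k<N) (unit-* (even-unit k k<N) unit-1)) (begin
      u ^ 2 * ∑ (suc N) (λ j → c′ j * S (suc k) j)
        ≈⟨ *-distribˡ-∑ (suc N) _ _ ⟩
      ∑ (suc N) (λ j → u ^ 2 * (c′ j * S (suc k) j))
        ≈⟨ ∑-cong (suc N) (λ j _ → solve 2 (λ a b → a := (a :- b) :+ b) refl _ (q * a ^ 2 * (c′ j * S k j))) ⟩
      ∑ (suc N) (λ j → c-summand k j + q * a ^ 2 * (c′ j * S k j))
        ≈⟨ ∑-+ (suc N) _ _ ⟩
      ∑ (suc N) (c-summand k) + ∑ (suc N) (λ j → q * a ^ 2 * (c′ j * S k j))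
        ≈⟨ +-cong (trans (c-telescope k N ℕ.≤-refl) (trans (*-congˡ (k<j⇒H≈0 k<N)) (zeroʳ _))) (sym (*-distribˡ-∑ (suc N) _ _)) ⟩
      0# + q * a ^ 2 * ∑ (suc N) (λ j → c′ j * S k j)
        ≈⟨ trans (+-identityˡ _) (*-congˡ (τ²-expansion k (ℕ.<⇒≤ k<N))) ⟩
      q * a ^ 2 * (τ k ^ 2 * q ^ k)
        ≈⟨ solve 4 (λ q a t y → q :* a :^ 2 :* (t :^ 2 :* y) := (t :* a) :^ 2 :* (q :* y)) refl q a (τ k) (q ^ k) ⟩
      (τ k * a) ^ 2 * (q * q ^ k)
        ≈⟨ *-congʳ (^-congˡ 2 (τ-suc k k<N)) ⟨
      (τ (suc k) * u) ^ 2 * (q * q ^ k)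
        ≈⟨ solve 3 (λ u t y → (t :* u) :^ 2 :* y := u :^ 2 :* (t :^ 2 :* y)) refl u (τ (suc k)) (q * q ^ k) ⟩
      u ^ 2 * (τ (suc k) ^ 2 * q ^ suc k) ∎)
      where u = 1# - p ^ suc k ; a = 1# - q * p ^ k

    w : ℕ → Carrier
    w k = ⟦4 k +1⟧ * τ k ^ 4

    V : ℕ → Carrier
    V j = ∑ (suc N) λ k → w k * S k j

    -- The difference of the two sides of the recurrence for `V` has k-th term `w k * S k j` times
    -- this factor.
    V-factor : ℕ → ℕ → Carrier
    V-factor j k = (1# - p ^ suc j) * ((1# - p⁻ ^ k * p ^ j) * (1# - q * p ^ k * p ^ j)) - (1# - q * p ^ j) ^ 3

    -- Gosper's certificate for the recurrence of V in j.  Its value at k = N contains (1 - q^n)³.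
    V-certificate : ℕ → ℕ → Carrier
    V-certificate j k =
      - (p ^ j * p⁻ ^ k * (τ k ^ 4 * S k j * ((1# - q * p ^ k) ^ 3 * (1# - q * p ^ k * p ^ j))))

    -- The factor 1 - q turns [4k+1] into 1 - q x² with x = p^k, after which this is an identity of
    -- polynomials. The subtracted expression is the certificate at k - 1, written so that it also
    -- makes sense at k = 0, where (1 - x)³ = 0 starts the telescoping.
    V-summand : ∀ j k → (1# - q) * (w k * S k j * V-factor j k)
      ≈ V-certificate j k - p ^ j * p⁻ ^ k * p * (τ k ^ 4 * ((1# - p ^ k) ^ 3 * ((p ^ k - p ^ j) * S k j)))
    V-summand j k = unit-cancelˡ (p⁻ ^ k , p^k*p⁻^k≈1 k) (begin
      x * ((1# - q) * (b * t ^ 4 * s * ((1# - p * z) * (β * (1# - q * x * z)) - (1# - q * z) ^ 3)))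
        ≈⟨ solve 7 (λ q x z b t s β → let p = q :* q in
             x :* ((𝟙 :- q) :* (b :* t :^ 4 :* s :* ((𝟙 :- p :* z) :* (β :* (𝟙 :- q :* x :* z)) :- (𝟙 :- q :* z) :^ 3)))
             := t :^ 4 :* s :* (b :* (𝟙 :- q) :* ((𝟙 :- p :* z) :* (x :* β) :* (𝟙 :- q :* x :* z) :- x :* (𝟙 :- q :* z) :^ 3)))
           refl q x z b t s β ⟩
      t ^ 4 * s * (b * (1# - q) * ((1# - p * z) * (x * β) * (1# - q * x * z) - x * (1# - q * z) ^ 3))
        ≈⟨ *-congˡ (*-cong (⟦4k+1⟧[1-q] k) (+-congʳ (*-congʳ (*-congˡ (sym (x-z≈x[1-x⁻z] k z)))))) ⟩
      t ^ 4 * s * ((1# - q * (x * x)) * ((1# - p * z) * (x - z) * (1# - q * x * z) - x * (1# - q * z) ^ 3))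
        ≈⟨ solve 5 (λ q x z t s → let p = q :* q in
             t :^ 4 :* s :* ((𝟙 :- q :* (x :* x)) :* ((𝟙 :- p :* z) :* (x :- z) :* (𝟙 :- q :* x :* z) :- x :* (𝟙 :- q :* z) :^ 3))
             := (:- (z :* (t :^ 4 :* s :* ((𝟙 :- q :* x) :^ 3 :* (𝟙 :- q :* x :* z))))
                 :- z :* p :* (t :^ 4 :* ((𝟙 :- x) :^ 3 :* ((x :- z) :* s)))))
           refl q x z t s ⟩
      - (z * (t ^ 4 * s * ((1# - q * x) ^ 3 * (1# - q * x * z)))) - z * p * (t ^ 4 * ((1# - x) ^ 3 * ((x - z) * s)))
        ≈⟨ *-identityˡ _ ⟨
      1# * (- (z * (t ^ 4 * s * ((1# - q * x) ^ 3 * (1# - q * x * z)))) - z * p * (t ^ 4 * ((1# - x) ^ 3 * ((x - z) * s))))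
        ≈⟨ *-congʳ (p^k*p⁻^k≈1 k) ⟨
      x * x⁻ * (- (z * (t ^ 4 * s * ((1# - q * x) ^ 3 * (1# - q * x * z)))) - z * p * (t ^ 4 * ((1# - x) ^ 3 * ((x - z) * s))))
        ≈⟨ solve 6 (λ x x⁻ z p a b →
              x :* x⁻ :* (:- (z :* a) :- z :* p :* b) := x :* (:- (z :* x⁻ :* a) :- z :* x⁻ :* p :* b))
             refl x x⁻ z p (t ^ 4 * s * ((1# - q * x) ^ 3 * (1# - q * x * z))) (t ^ 4 * ((1# - x) ^ 3 * ((x - z) * s))) ⟩
      x * (V-certificate j k - z * x⁻ * p * (t ^ 4 * ((1# - x) ^ 3 * ((x - z) * s)))) ∎)
      where
      x = p ^ k ; x⁻ = p⁻ ^ k ; z = p ^ j ; b = ⟦4 k +1⟧ ; t = τ k ; s = S k j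
      β = 1# - p⁻ ^ k * z

    -- Four factors 1 - q p^k turn the fourth power of `τ k` into that of `τ (suc k)`. Three are in
    -- the certificate; the fourth is multiplied on both sides, returned by `S-step` and cancelled,
    -- which needs k < N.
    V-boundary : ∀ j k → k < N →
      V-certificate j k ≈ p ^ j * p⁻ ^ suc k * p * (τ (suc k) ^ 4 * ((1# - p ^ suc k) ^ 3 * ((p ^ suc k - p ^ j) * S (suc k) j)))
    V-boundary j k k<N = unit-cancelˡ (odd-unit k k<N) (begin
      a * - (z * x⁻ * (t ^ 4 * s * (a ^ 3 * (1# - q * x * z))))
        ≈⟨ solve 6 (λ a y t s u c → a :* (:- (y :* (t :^ 4 :* s :* (a :^ 3 :* c)))) := :- (y :* (s :* c :* (t :* a) :^ 4)))
             refl a (z * x⁻) t s u (1# - q * x * z) ⟩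
      - (z * x⁻ * (s * (1# - q * x * z) * (t * a) ^ 4))
        ≈⟨ -‿cong (*-congˡ (*-congˡ (^-congˡ 4 (τ-suc k k<N)))) ⟨
      - (z * x⁻ * (s * (1# - q * x * z) * (t′ * u) ^ 4))
        ≈⟨ solve 5 (λ y s c t′ px → :- (y :* (s :* c :* (t′ :* (𝟙 :- px)) :^ 4)) := y :* (t′ :^ 4 :* (𝟙 :- px) :^ 3 :* (s :* ((px :- 𝟙) :* c))))
             refl (z * x⁻) s (1# - q * x * z) t′ (p * x) ⟩
      z * x⁻ * (t′ ^ 4 * u ^ 3 * (s * ((p * x - 1#) * (1# - q * x * z))))
        ≈⟨ *-cong shift (*-congˡ (sym (S-step k j))) ⟩
      z * (p⁻ * x⁻) * p * (t′ ^ 4 * u ^ 3 * ((p * x - z) * a * S (suc k) j))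
        ≈⟨ solve 6 (λ y t′ u d a s′ → y :* (t′ :* u :* (d :* a :* s′)) := a :* (y :* (t′ :* (u :* (d :* s′)))))
             refl (z * (p⁻ * x⁻) * p) (t′ ^ 4) (u ^ 3) (p * x - z) a (S (suc k) j) ⟩
      a * (z * (p⁻ * x⁻) * p * (t′ ^ 4 * (u ^ 3 * ((p * x - z) * S (suc k) j)))) ∎)
      where
      x = p ^ k ; x⁻ = p⁻ ^ k ; z = p ^ j ; t = τ k ; t′ = τ (suc k) ; s = S k j
      a = 1# - q * p ^ k ; u = 1# - p ^ suc k
      shift : z * x⁻ ≈ z * (p⁻ * x⁻) * p
      shift = begin
        z * x⁻                   ≈⟨ *-identityʳ _ ⟨
        z * x⁻ * 1#              ≈⟨ *-congˡ pp⁻≈1 ⟨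
        z * x⁻ * (p * p⁻)        ≈⟨ solve 4 (λ z x p p⁻ → z :* x :* (p :* p⁻) := z :* (p⁻ :* x) :* p) refl z x⁻ p p⁻ ⟩
        z * (p⁻ * x⁻) * p        ∎

    V-telescope : ∀ j K → K ≤ N → (1# - q) * ∑ (suc K) (λ k → w k * S k j * V-factor j k) ≈ V-certificate j K
    V-telescope j zero _ = begin
      (1# - q) * (0# + w 0 * S 0 j * V-factor j 0)
        ≈⟨ *-congˡ (+-identityˡ _) ⟩
      (1# - q) * (w 0 * S 0 j * V-factor j 0)
        ≈⟨ V-summand j 0 ⟩
      V-certificate j 0 - p ^ j * 1# * p * (τ 0 ^ 4 * ((1# - 1#) ^ 3 * ((1# - p ^ j) * S 0 j)))
        ≈⟨ solve 4 (λ a b c d → a :- b :* (c :* ((𝟙 :- 𝟙) :^ 3 :* d)) := a) refl (V-certificate j 0) (p ^ j * 1# * p) (τ 0 ^ 4) ((1# - p ^ j) * S 0 j) ⟩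
      V-certificate j 0 ∎
    V-telescope j (suc K) K<N = begin
      (1# - q) * (∑ (suc K) (λ k → w k * S k j * V-factor j k) + w (suc K) * S (suc K) j * V-factor j (suc K))
        ≈⟨ distribˡ _ _ _ ⟩
      (1# - q) * ∑ (suc K) (λ k → w k * S k j * V-factor j k) + (1# - q) * (w (suc K) * S (suc K) j * V-factor j (suc K))
        ≈⟨ +-cong (trans (V-telescope j K (ℕ.<⇒≤ K<N)) (V-boundary j K K<N)) (V-summand j (suc K)) ⟩
      B + (V-certificate j (suc K) - B)
        ≈⟨ solve 2 (λ a b → a :+ (b :- a) := b) refl B _ ⟩
      V-certificate j (suc K) ∎
      where B = p ^ j * p⁻ ^ suc K * p * (τ (suc K) ^ 4 * ((1# - p ^ suc K) ^ 3 * ((p ^ suc K - p ^ j) * S (suc K) j)))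

    V-suc : ∀ j → V (suc j) * (1# - p ^ suc j) ≈ V j * (1# - q * p ^ j) ^ 3
    V-suc j = modulo vanishing (begin
      V (suc j) * u + 0#                    ≈⟨ +-identityʳ _ ⟩
      V (suc j) * u                         ≈⟨ *-distribʳ-∑ (suc N) u _ ⟩
      ∑ (suc N) (λ k → w k * S k (suc j) * u)
        ≈⟨ ∑-cong (suc N) (λ k _ → solve 6 (λ w s c d u a → w :* (s :* (c :* d)) :* u := w :* s :* a :+ w :* s :* (u :* (c :* d) :- a))
             refl (w k) (S k j) (1# - p⁻ ^ k * p ^ j) (1# - q * p ^ k * p ^ j) u (a ^ 3)) ⟩
      ∑ (suc N) (λ k → w k * S k j * a ^ 3 + w k * S k j * V-factor j k)
        ≈⟨ ∑-+ (suc N) _ _ ⟩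
      ∑ (suc N) (λ k → w k * S k j * a ^ 3) + ∑ (suc N) (λ k → w k * S k j * V-factor j k)
        ≈⟨ +-congʳ (*-distribʳ-∑ (suc N) (a ^ 3) _) ⟨
      V j * a ^ 3 + ∑ (suc N) (λ k → w k * S k j * V-factor j k) ∎)
      where
      u = 1# - p ^ suc j ; a = 1# - q * p ^ j
      vanishing : ∑ (suc N) (λ k → w k * S k j * V-factor j k) ≈ 0#
      vanishing = unit-cancelˡ 1-q-unit (begin
        (1# - q) * ∑ (suc N) (λ k → w k * S k j * V-factor j k)
          ≈⟨ V-telescope j N ℕ.≤-refl ⟩
        V-certificate j N
          ≈⟨ -‿cong (*-congˡ (*-congˡ (*-congʳ nilpotent))) ⟩
        - (p ^ j * p⁻ ^ N * (τ N ^ 4 * S N j * (0# * (1# - q * p ^ N * p ^ j))))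
          ≈⟨ solve 4 (λ a b c d → :- (a :* (b :* (con (+ 0) :* c))) := d :* con (+ 0)) refl (p ^ j * p⁻ ^ N) (τ N ^ 4 * S N j) (1# - q * p ^ N * p ^ j) (1# - q) ⟩
        (1# - q) * 0# ∎)

    p^[n∸i] : ∀ n i → i < n → p ^ (n ∸ suc i) ≈ p ^ n * p⁻ ^ suc i
    p^[n∸i] n i i<n = sym (begin
      p ^ n * p⁻ ^ suc i                              ≈⟨ *-congʳ (^-congʳ p (≡.sym (ℕ.m∸n+n≡m i<n))) ⟩
      p ^ ((n ∸ suc i) ℕ.+ suc i) * p⁻ ^ suc i        ≈⟨ *-congʳ (^-homo-* p (n ∸ suc i) (suc i)) ⟩
      p ^ (n ∸ suc i) * p ^ suc i * p⁻ ^ suc i        ≈⟨ *-assoc _ _ _ ⟩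
      p ^ (n ∸ suc i) * (p ^ suc i * p⁻ ^ suc i)      ≈⟨ *-congˡ (p^k*p⁻^k≈1 (suc i)) ⟩
      p ^ (n ∸ suc i) * 1#                            ≈⟨ *-identityʳ _ ⟩
      p ^ (n ∸ suc i)                                 ∎)

    y : Carrier
    y = q * p ^ N

    S-diagonal : S N N ≈ ∏ N (λ i → 1# - p⁻ ^ suc i) * ∏ N (λ i → 1# - y * p ^ i)
    S-diagonal = begin
      ∏ N (λ i → (1# - p⁻ ^ N * p ^ i) * (1# - y * p ^ i))
        ≈⟨ ∏-* N _ _ ⟩
      ∏ N (λ i → 1# - p⁻ ^ N * p ^ i) * ∏ N (λ i → 1# - y * p ^ i)
        ≈⟨ *-congʳ (∏-reverse N _) ⟩
      ∏ N (λ i → 1# - p⁻ ^ N * p ^ (N ∸ suc i)) * ∏ N (λ i → 1# - y * p ^ i)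
        ≈⟨ *-congʳ (∏-cong N λ i i<N → +-congˡ (-‿cong (begin
             p⁻ ^ N * p ^ (N ∸ suc i)             ≈⟨ *-congˡ (p^[n∸i] N i i<N) ⟩
             p⁻ ^ N * (p ^ N * p⁻ ^ suc i)        ≈⟨ solve 3 (λ a b c → a :* (b :* c) := b :* a :* c) refl _ _ _ ⟩
             p ^ N * p⁻ ^ N * p⁻ ^ suc i          ≈⟨ *-congʳ (p^k*p⁻^k≈1 N) ⟩
             1# * p⁻ ^ suc i                      ≈⟨ *-identityˡ _ ⟩
             p⁻ ^ suc i                           ∎))) ⟩
      ∏ N (λ i → 1# - p⁻ ^ suc i) * ∏ N (λ i → 1# - y * p ^ i) ∎

    -- Counted from the end, the factors of `O N` are 1 - y p^(-(i+1)). In this form they pair with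
    -- the factors 1 - y p^(i+1) in `merge`.
    O-reversed : O N ≈ ∏ N (λ i → 1# - y * p⁻ ^ suc i)
    O-reversed = trans (∏-reverse N _) (∏-cong N λ i i<N →
      +-congˡ (-‿cong (trans (*-congˡ (p^[n∸i] N i i<N)) (sym (*-assoc _ _ _)))))

    -- 1 - y p^N is the numerator of [4N+1]. Trading it for the factor at i = 0 produces the 1 - y
    -- on which `merge` depends and shifts the exponents to match the reversed `O N`.
    ∏-shift : (1# - y * p ^ N) * ∏ N (λ i → 1# - y * p ^ i) ≈ (1# - y) * ∏ N (λ i → 1# - y * p ^ suc i)
    ∏-shift = begin
      (1# - y * p ^ N) * ∏ N (λ i → 1# - y * p ^ i)          ≈⟨ *-comm _ _ ⟩
      ∏ (suc N) (λ i → 1# - y * p ^ i)                       ≈⟨ ∏-front N _ ⟩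
      (1# - y * 1#) * ∏ N (λ i → 1# - y * p ^ suc i)         ≈⟨ *-congʳ (+-congˡ (-‿cong (*-identityʳ y))) ⟩
      (1# - y) * ∏ N (λ i → 1# - y * p ^ suc i)              ∎

    -- It is applied with s = 1 - y, which is nilpotent and cannot be cancelled. Factors that agree
    -- only after multiplication by s are exchanged one at a time, and the same single s serves for
    -- all of them.
    ∏-cong-after : ∀ s n {f g} → (∀ i → s * f i ≈ s * g i) → s * ∏ n f ≈ s * ∏ n g
    ∏-cong-after s zero    sf≈sg = refl
    ∏-cong-after s (suc n) {f} {g} sf≈sg = begin
      s * (∏ n f * f n)      ≈⟨ *-assoc _ _ _ ⟨
      s * ∏ n f * f n        ≈⟨ *-congʳ (∏-cong-after s n sf≈sg) ⟩
      s * ∏ n g * f n        ≈⟨ solve 3 (λ s a b → s :* a :* b := s :* b :* a) refl s _ _ ⟩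
      s * f n * ∏ n g        ≈⟨ *-congʳ (sf≈sg n) ⟩
      s * g n * ∏ n g        ≈⟨ solve 3 (λ s a b → s :* a :* b := s :* (b :* a)) refl s _ _ ⟩
      s * (∏ n g * g n)      ∎

    -- Modulo (1 - y)³ the factors at s and s⁻¹ merge:
    -- (1 - y)(1 - y s)(1 - y s⁻¹) = (1 - y)³ - (1 - y) y s⁻¹ (1 - s)².
    merge : ∀ i → (1# - y) * ((1# - p⁻ ^ suc i) * (1# - y * p ^ suc i) * (1# - y * p⁻ ^ suc i))
                  ≈ (1# - y) * (y * (p⁻ ^ suc i * p⁻ ^ suc i) * (1# - p ^ suc i) ^ 3)
    merge i = modulo
      (+-cong (*-congˡ {1# - s⁻} nilpotent)
              (*-congˡ {(1# - y) * (y * (s * (s * s⁻ + 1#) + (1# + 1# + 1#) * s⁻ - (1# + 1# + 1#) * (s * s⁻) - 1# - 1#) + y * y * (1# - s⁻))}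
                       (p^k*p⁻^k≈1 (suc i))))
      (solve 3 (λ y s s⁻ →
         let 𝟛 = 𝟙 :+ 𝟙 :+ 𝟙
             κ = (𝟙 :- y) :* (y :* (s :* (s :* s⁻ :+ 𝟙) :+ 𝟛 :* s⁻ :- 𝟛 :* (s :* s⁻) :- 𝟙 :- 𝟙) :+ y :* y :* (𝟙 :- s⁻)) in
         (𝟙 :- y) :* ((𝟙 :- s⁻) :* (𝟙 :- y :* s) :* (𝟙 :- y :* s⁻)) :+ ((𝟙 :- s⁻) :* con (+ 0) :+ κ :* 𝟙)
         := (𝟙 :- y) :* (y :* (s⁻ :* s⁻) :* (𝟙 :- s) :^ 3) :+ ((𝟙 :- s⁻) :* (𝟙 :- y) :^ 3 :+ κ :* (s :* s⁻)))
       refl y s s⁻)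
      where s = p ^ suc i ; s⁻ = p⁻ ^ suc i

    -- The exponents 2, 4, ..., 2n add up to n² + n. For n = N the power p^(n²) is supplied by the N
    -- factors y in `∏-merged`.
    ∏-p⁻² : ∀ n → ∏ n (λ i → p⁻ ^ suc i * p⁻ ^ suc i) * p ^ (n ℕ.* n) ≈ p⁻ ^ n
    ∏-p⁻² zero = *-identityˡ 1#
    ∏-p⁻² (suc n) = begin
      Π * (s⁻ * s⁻) * p ^ (suc n ℕ.* suc n)
        ≈⟨ *-congˡ (trans (^-congʳ p exponent) (trans (^-homo-* p (n ℕ.* n) (n ℕ.+ suc n)) (*-congˡ (^-homo-* p n (suc n))))) ⟩
      Π * (s⁻ * s⁻) * (p ^ (n ℕ.* n) * (p ^ n * p ^ suc n))
        ≈⟨ solve 5 (λ a b c d e → a :* (b :* b) :* (c :* (d :* e)) := a :* c :* d :* (e :* b) :* b) refl Π s⁻ (p ^ (n ℕ.* n)) (p ^ n) (p ^ suc n) ⟩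
      Π * p ^ (n ℕ.* n) * p ^ n * (p ^ suc n * s⁻) * s⁻
        ≈⟨ *-congʳ (*-cong (*-congʳ (∏-p⁻² n)) (p^k*p⁻^k≈1 (suc n))) ⟩
      p⁻ ^ n * p ^ n * 1# * s⁻
        ≈⟨ *-congʳ (trans (*-identityʳ _) (trans (*-comm _ _) (p^k*p⁻^k≈1 n))) ⟩
      1# * s⁻
        ≈⟨ *-identityˡ _ ⟩
      s⁻ ∎
      where
      Π = ∏ n (λ i → p⁻ ^ suc i * p⁻ ^ suc i) ; s⁻ = p⁻ ^ suc n
      exponent : suc n ℕ.* suc n ≡ n ℕ.* n ℕ.+ (n ℕ.+ suc n)
      exponent = ℕS.solve 1 (λ n → (ℕS.con 1 ℕS.:+ n) ℕS.:* (ℕS.con 1 ℕS.:+ n)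
                   ℕS.:= n ℕS.:* n ℕS.:+ (n ℕS.:+ (ℕS.con 1 ℕS.:+ n))) ≡.refl n

    ∏-const : ∀ n a → ∏ n (λ _ → a) ≈ a ^ n
    ∏-const zero    a = refl
    ∏-const (suc n) a = trans (*-congʳ (∏-const n a)) (*-comm _ _)

    q^N*p⁻^N≈q⁻^N : q ^ N * p⁻ ^ N ≈ q⁻ ^ N
    q^N*p⁻^N≈q⁻^N = begin
      q ^ N * p⁻ ^ N               ≈⟨ *-congˡ (^-distrib-* q⁻ q⁻ N) ⟩
      q ^ N * (q⁻ ^ N * q⁻ ^ N)    ≈⟨ *-assoc _ _ _ ⟨
      q ^ N * q⁻ ^ N * q⁻ ^ N      ≈⟨ *-congʳ (^-inverse qq⁻≈1 N) ⟩
      1# * q⁻ ^ N                  ≈⟨ *-identityˡ _ ⟩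
      q⁻ ^ N                       ∎

    -- This is the origin of q^((1-n)/2) in the theorem: q^N p^(N²) p^(-N²-N) = q^(-N).
    ∏-merged : ∏ N (λ i → y * (p⁻ ^ suc i * p⁻ ^ suc i) * (1# - p ^ suc i) ^ 3) ≈ q⁻ ^ N * E N ^ 3
    ∏-merged = begin
      ∏ N (λ i → y * (p⁻ ^ suc i * p⁻ ^ suc i) * (1# - p ^ suc i) ^ 3)
        ≈⟨ ∏-* N _ _ ⟩
      ∏ N (λ i → y * (p⁻ ^ suc i * p⁻ ^ suc i)) * ∏ N (λ i → (1# - p ^ suc i) ^ 3)
        ≈⟨ *-cong (∏-* N _ _) (∏-cubes N) ⟩
      ∏ N (λ _ → y) * Π * E N ^ 3
        ≈⟨ *-congʳ (*-congʳ (trans (∏-const N y) (trans (^-distrib-* q (p ^ N) N) (*-congˡ (^-assocʳ p N N))))) ⟩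
      q ^ N * p ^ (N ℕ.* N) * Π * E N ^ 3
        ≈⟨ *-congʳ (trans (*-assoc _ _ _) (*-congˡ (trans (*-comm _ _) (∏-p⁻² N)))) ⟩
      q ^ N * p⁻ ^ N * E N ^ 3
        ≈⟨ *-congʳ q^N*p⁻^N≈q⁻^N ⟩
      q⁻ ^ N * E N ^ 3 ∎
      where
      Π = ∏ N (λ i → p⁻ ^ suc i * p⁻ ^ suc i)
      ∏-cubes : ∀ n → ∏ n (λ i → (1# - p ^ suc i) ^ 3) ≈ E n ^ 3
      ∏-cubes zero    = solve 0 (𝟙 := 𝟙 :^ 3) refl
      ∏-cubes (suc n) = trans (*-congʳ (∏-cubes n)) (solve 2 (λ a b → a :^ 3 :* b :^ 3 := (a :* b) :^ 3) refl _ _)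

    diagonal : ⟦4 N +1⟧ * O N * S N N ≈ ⟦n⟧ * q⁻ ^ N * E N ^ 3
    diagonal = unit-cancelˡ 1-q-unit (begin
      (1# - q) * (b * O N * S N N)
        ≈⟨ *-congˡ (*-cong (*-congˡ O-reversed) S-diagonal) ⟩
      (1# - q) * (b * C * (A * B))
        ≈⟨ solve 5 (λ a b c d e → a :* (b :* c :* (d :* e)) := b :* a :* e :* d :* c) refl (1# - q) b C A B ⟩
      b * (1# - q) * B * A * C
        ≈⟨ *-congʳ (*-congʳ (*-congʳ (trans (⟦4k+1⟧[1-q] N) (+-congˡ (-‿cong (sym (*-assoc _ _ _))))))) ⟩
      (1# - y * p ^ N) * B * A * C
        ≈⟨ *-congʳ (*-congʳ ∏-shift) ⟩
      (1# - y) * B′ * A * C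
        ≈⟨ solve 4 (λ a b c d → a :* b :* c :* d := a :* (c :* b :* d)) refl (1# - y) B′ A C ⟩
      (1# - y) * (A * B′ * C)
        ≈⟨ *-congˡ (*-congʳ (∏-* N _ _)) ⟨
      (1# - y) * (∏ N (λ i → (1# - p⁻ ^ suc i) * (1# - y * p ^ suc i)) * C)
        ≈⟨ *-congˡ (∏-* N _ _) ⟨
      (1# - y) * ∏ N (λ i → (1# - p⁻ ^ suc i) * (1# - y * p ^ suc i) * (1# - y * p⁻ ^ suc i))
        ≈⟨ ∏-cong-after (1# - y) N merge ⟩
      (1# - y) * ∏ N (λ i → y * (p⁻ ^ suc i * p⁻ ^ suc i) * (1# - p ^ suc i) ^ 3)
        ≈⟨ *-cong (sym ⟦n⟧[1-q]) ∏-merged ⟩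
      ⟦n⟧ * (1# - q) * (q⁻ ^ N * E N ^ 3)
        ≈⟨ solve 4 (λ n a b c → n :* a :* (b :* c) := a :* (n :* b :* c)) refl ⟦n⟧ (1# - q) (q⁻ ^ N) (E N ^ 3) ⟩
      (1# - q) * (⟦n⟧ * q⁻ ^ N * E N ^ 3) ∎)
      where
      b = ⟦4 N +1⟧
      A = ∏ N (λ i → 1# - p⁻ ^ suc i)
      B = ∏ N (λ i → 1# - y * p ^ i)
      B′ = ∏ N (λ i → 1# - y * p ^ suc i)
      C = ∏ N (λ i → 1# - y * p⁻ ^ suc i)

    -- `S k N` vanishes for k < N, so `V N` is its single term at k = N. With four factors `E N`
    -- every `τ N` becomes `O N`; one of these goes into `diagonal`, the other three remain.
    V-last : V N * E N ≈ ⟦n⟧ * q⁻ ^ N * O N ^ 3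
    V-last = unit-cancelˡ (unit-* E-unitᴺ (unit-* E-unitᴺ E-unitᴺ)) (begin
      E³ * ((∑ N (λ k → w k * S k N) + w N * S N N) * E N)
        ≈⟨ *-congˡ (*-congʳ (trans (+-congʳ (∑-0 N λ k k<N → trans (*-congˡ (k<j⇒S≈0 k<N)) (zeroʳ _))) (+-identityˡ _))) ⟩
      E³ * (⟦4 N +1⟧ * τ N ^ 4 * S N N * E N)
        ≈⟨ solve 4 (λ E b t s → E :* (E :* E) :* (b :* t :^ 4 :* s :* E) := b :* (t :* E) :* s :* (t :* E) :^ 3) refl (E N) ⟦4 N +1⟧ (τ N) (S N N) ⟩
      ⟦4 N +1⟧ * (τ N * E N) * S N N * (τ N * E N) ^ 3
        ≈⟨ *-cong (*-congʳ (*-congˡ (τE≈O N ℕ.≤-refl))) (^-congˡ 3 (τE≈O N ℕ.≤-refl)) ⟩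
      ⟦4 N +1⟧ * O N * S N N * O N ^ 3
        ≈⟨ *-congʳ diagonal ⟩
      ⟦n⟧ * q⁻ ^ N * E N ^ 3 * O N ^ 3
        ≈⟨ solve 3 (λ a E O → a :* E :^ 3 :* O :^ 3 := E :* (E :* E) :* (a :* O :^ 3)) refl (⟦n⟧ * q⁻ ^ N) (E N) (O N) ⟩
      E³ * (⟦n⟧ * q⁻ ^ N * O N ^ 3) ∎)
      where
      E³ = E N * (E N * E N)
      E-unitᴺ = E-unit N ℕ.≤-refl

    -- Induction on i = N - j, downwards from `V N`: the recurrence is solved for `V j`, which means
    -- division by (1 - q p^j)³ and hence j < N.
    VE≈O³ : ∀ i j → i ℕ.+ j ≡ N → V j * E j ≈ ⟦n⟧ * q⁻ ^ N * O j ^ 3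
    VE≈O³ zero j ≡.refl = V-last
    VE≈O³ (suc i) j 1+i+j≡N = unit-cancelˡ (unit-* a-unit (unit-* a-unit a-unit)) (begin
      a * (a * a) * (V j * E j)
        ≈⟨ solve 3 (λ a V E → a :* (a :* a) :* (V :* E) := V :* a :^ 3 :* E) refl a (V j) (E j) ⟩
      V j * a ^ 3 * E j
        ≈⟨ *-congʳ (V-suc j) ⟨
      V (suc j) * u * E j
        ≈⟨ solve 3 (λ V u E → V :* u :* E := V :* (E :* u)) refl (V (suc j)) u (E j) ⟩
      V (suc j) * E (suc j)
        ≈⟨ VE≈O³ i (suc j) (≡.trans (ℕ.+-suc i j) 1+i+j≡N) ⟩
      ⟦n⟧ * q⁻ ^ N * (O j * a) ^ 3
        ≈⟨ solve 3 (λ b O a → b :* (O :* a) :^ 3 := a :* (a :* a) :* (b :* O :^ 3)) refl (⟦n⟧ * q⁻ ^ N) (O j) a ⟩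
      a * (a * a) * (⟦n⟧ * q⁻ ^ N * O j ^ 3) ∎)
      where
      u = 1# - p ^ suc j ; a = 1# - q * p ^ j
      a-unit = odd-unit j (ℕ.m+n≤o⇒n≤o i (ℕ.≤-reflexive (≡.trans (ℕ.+-suc i j) 1+i+j≡N)))

    -- Of the four factors `E j`, three clear the denominator of `e j` and one that of `V j`; the
    -- four `O j` that arise are the fourth power of `τ j * E j`.
    c′V : ∀ j → j ≤ N → c′ j * V j ≈ ⟦n⟧ * q⁻ ^ N * (τ j ^ 4 * p ^ j)
    c′V j j≤N = unit-cancelˡ (unit-* E-unitʲ (unit-* E-unitʲ (unit-* E-unitʲ E-unitʲ))) (begin
      E⁴ * (p ^ j * e j * V j)
        ≈⟨ solve 4 (λ E x e V → E :* (E :* (E :* E)) :* (x :* e :* V) := x :* (e :* E :^ 3) :* (V :* E)) refl (E j) (p ^ j) (e j) (V j) ⟩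
      p ^ j * (e j * E j ^ 3) * (V j * E j)
        ≈⟨ *-cong (*-congˡ (eE³≈O j j≤N)) (VE≈O³ (N ∸ j) j (ℕ.m∸n+n≡m j≤N)) ⟩
      p ^ j * O j * (⟦n⟧ * q⁻ ^ N * O j ^ 3)
        ≈⟨ solve 3 (λ x O b → x :* O :* (b :* O :^ 3) := x :* b :* O :^ 4) refl (p ^ j) (O j) (⟦n⟧ * q⁻ ^ N) ⟩
      p ^ j * (⟦n⟧ * q⁻ ^ N) * O j ^ 4
        ≈⟨ *-congˡ (^-congˡ 4 (τE≈O j j≤N)) ⟨
      p ^ j * (⟦n⟧ * q⁻ ^ N) * (τ j * E j) ^ 4
        ≈⟨ solve 4 (λ x b t E → x :* b :* (t :* E) :^ 4 := E :* (E :* (E :* E)) :* (b :* (t :^ 4 :* x))) refl (p ^ j) (⟦n⟧ * q⁻ ^ N) (τ j) (E j) ⟩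
      E⁴ * (⟦n⟧ * q⁻ ^ N * (τ j ^ 4 * p ^ j)) ∎)
      where
      E⁴ = E j * (E j * (E j * E j))
      E-unitʲ = E-unit j j≤N

    transformation : ∑ (suc N) (λ k → ⟦4 k +1⟧ * τ k ^ 6 * q ^ k)
                     ≈ ⟦n⟧ * q⁻ ^ N * ∑ (suc N) (λ k → τ k ^ 4 * p ^ k)
    transformation = begin
      ∑ (suc N) (λ k → ⟦4 k +1⟧ * τ k ^ 6 * q ^ k)
        ≈⟨ ∑-cong (suc N) (λ k _ → solve 3 (λ b t y → b :* t :^ 6 :* y := b :* t :^ 4 :* (t :^ 2 :* y)) refl ⟦4 k +1⟧ (τ k) (q ^ k)) ⟩
      ∑ (suc N) (λ k → w k * (τ k ^ 2 * q ^ k))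
        ≈⟨ ∑-cong (suc N) (λ k k<1+N → *-congˡ (τ²-expansion k (ℕ.≤-pred k<1+N))) ⟨
      ∑ (suc N) (λ k → w k * ∑ (suc N) (λ j → c′ j * S k j))
        ≈⟨ ∑-cong (suc N) (λ k _ → *-distribˡ-∑ (suc N) (w k) _) ⟩
      ∑ (suc N) (λ k → ∑ (suc N) (λ j → w k * (c′ j * S k j)))
        ≈⟨ ∑-swap (suc N) (suc N) _ ⟩
      ∑ (suc N) (λ j → ∑ (suc N) (λ k → w k * (c′ j * S k j)))
        ≈⟨ ∑-cong (suc N) (λ j _ → ∑-cong (suc N) (λ k _ → solve 3 (λ w c s → w :* (c :* s) := c :* (w :* s)) refl (w k) (c′ j) (S k j))) ⟩
      ∑ (suc N) (λ j → ∑ (suc N) (λ k → c′ j * (w k * S k j)))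
        ≈⟨ ∑-cong (suc N) (λ j _ → *-distribˡ-∑ (suc N) (c′ j) _) ⟨
      ∑ (suc N) (λ j → c′ j * V j)
        ≈⟨ ∑-cong (suc N) (λ j j<1+N → c′V j (ℕ.≤-pred j<1+N)) ⟩
      ∑ (suc N) (λ j → ⟦n⟧ * q⁻ ^ N * (τ j ^ 4 * p ^ j))
        ≈⟨ *-distribˡ-∑ (suc N) _ _ ⟨
      ⟦n⟧ * q⁻ ^ N * ∑ (suc N) (λ k → τ k ^ 4 * p ^ k) ∎

-- The terms past the middle, and blocks of length d

module Summand {c ℓ} (R : CommutativeRing c ℓ) (q q⁻ : CommutativeRing.Carrier R)
  (qq⁻≈1 : CommutativeRing._≈_ R (CommutativeRing._*_ R q q⁻) (CommutativeRing.1# R)) where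
  open CommutativeRing R
  open import Relation.Binary.Reasoning.Setoid setoid
  open import Algebra.Properties.Semiring.Exp semiring
  open import Algebra.Properties.CommutativeSemiring.Exp commutativeSemiring using (^-distrib-*)
  open IntegerRingSolver R
  open RingExtra R
  open Kernel R q q⁻ qq⁻≈1 using (p; module Transformation)

  -- Here d = 2D + 1. The even factors are units as far as 1 - q^(4D), because τ is now followed up
  -- to the index d - 1 = 2D instead of D.
  module Blocks (D : ℕ)
    (even-unit : ∀ k → k < D ℕ.+ D → Unit (1# - p ^ suc k))
    (odd-unit : ∀ k → k < D → Unit (1# - q * p ^ k))
    (1-q-unit : Unit (1# - q))
    (nilpotent : (1# - q * p ^ D) ^ 3 ≈ 0#)
    (τ : ℕ → Carrier) (τ-zero : τ 0 ≈ 1#)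
    (τ-suc : ∀ k → τ (suc k) * (1# - p ^ suc k) ≈ τ k * (1# - q * p ^ k))
    (⟦4_+1⟧ : ℕ → Carrier) (⟦4k+1⟧[1-q] : ∀ k → ⟦4 k +1⟧ * (1# - q) ≈ 1# - q * (p ^ k * p ^ k))
    (⟦d⟧ : Carrier) (⟦d⟧[1-q] : ⟦d⟧ * (1# - q) ≈ 1# - q * p ^ D)
    where

    g : ℕ → Carrier
    g k = ⟦4 k +1⟧ * τ k ^ 6 * q ^ k

    half-sum : ∑ (suc D) g ≈ ⟦d⟧ * q⁻ ^ D * ∑ (suc D) (λ k → τ k ^ 4 * p ^ k)
    half-sum = Transformation.transformation D
      (λ k k<D → even-unit k (ℕ.<-≤-trans k<D (ℕ.m≤m+n D D))) odd-unit 1-q-unit nilpotent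
      τ τ-zero (λ k _ → τ-suc k) ⟦4_+1⟧ ⟦4k+1⟧[1-q] ⟦d⟧ ⟦d⟧[1-q]

    -- The factor 1 - q^d enters τ in the step from D to D + 1. It persists, since the denominators
    -- of the further steps up to index 2D are units.
    τ-late : ∀ i → i < D → ∃ λ t → τ (i ℕ.+ suc D) ≈ (1# - q * p ^ D) * t
    τ-late i i<D with even-unit (i ℕ.+ D) (ℕ.+-monoˡ-< D i<D)
    ... | v , uv≈1 = t , (begin
      τ (i ℕ.+ suc D)                                    ≡⟨ ≡.cong τ (ℕ.+-suc i D) ⟩
      τ (suc (i ℕ.+ D))                                  ≈⟨ *-identityʳ _ ⟨
      τ (suc (i ℕ.+ D)) * 1#                             ≈⟨ *-congˡ uv≈1 ⟨
      τ (suc (i ℕ.+ D)) * ((1# - p ^ suc (i ℕ.+ D)) * v) ≈⟨ *-assoc _ _ _ ⟨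
      τ (suc (i ℕ.+ D)) * (1# - p ^ suc (i ℕ.+ D)) * v   ≈⟨ *-congʳ (τ-suc (i ℕ.+ D)) ⟩
      τ (i ℕ.+ D) * (1# - q * p ^ (i ℕ.+ D)) * v         ≈⟨ proj₂ (step i i<D) ⟩
      (1# - q * p ^ D) * t                               ∎)
      where
      step : ∀ i → i < D → ∃ λ t → τ (i ℕ.+ D) * (1# - q * p ^ (i ℕ.+ D)) * v ≈ (1# - q * p ^ D) * t
      step zero    _   = τ D * v , solve 3 (λ t a v → t :* a :* v := a :* (t :* v)) refl _ _ _
      step (suc i) 1+i<D with τ-late i (ℕ.<⇒≤ 1+i<D)
      ... | t′ , eq = t′ * (1# - q * p ^ suc (i ℕ.+ D)) * v ,
        trans (*-congʳ (*-congʳ (trans (reflexive (≡.cong τ (≡.sym (ℕ.+-suc i D)))) eq)))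
              (solve 4 (λ y t a v → y :* t :* a :* v := y :* (t :* a :* v)) refl _ _ _ _)
      t = proj₁ (step i i<D)

    g-late : ∀ i → i < D → g (i ℕ.+ suc D) ≈ 0#
    g-late i i<D with τ-late i i<D
    ... | t , eq = begin
      b * τ (i ℕ.+ suc D) ^ 6 * y          ≈⟨ *-congʳ (*-congˡ (^-congˡ 6 eq)) ⟩
      b * ((1# - q * p ^ D) * t) ^ 6 * y   ≈⟨ solve 4 (λ b u t y → b :* (u :* t) :^ 6 :* y := u :^ 3 :* (b :* (u :^ 3 :* t :^ 6) :* y)) refl b _ t y ⟩
      (1# - q * p ^ D) ^ 3 * (b * ((1# - q * p ^ D) ^ 3 * t ^ 6) * y)  ≈⟨ *-congʳ nilpotent ⟩
      0# * (b * ((1# - q * p ^ D) ^ 3 * t ^ 6) * y)          ≈⟨ zeroˡ _ ⟩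
      0#                                   ∎
      where b = ⟦4 i ℕ.+ suc D +1⟧ ; y = q ^ (i ℕ.+ suc D)

    full-sum : ∑ (D ℕ.+ suc D) g ≈ ∑ (suc D) g
    full-sum = trans (∑-split (suc D) D g) (trans (+-congˡ (∑-0 D g-late)) (+-identityʳ _))

    module RootOfUnity (y≈1 : q * p ^ D ≈ 1#) (⟦d⟧≈0 : ⟦d⟧ ≈ 0#) where

      d : ℕ
      d = D ℕ.+ suc D

      q^d≈1 : q ^ d ≈ 1#
      q^d≈1 = begin
        q ^ (D ℕ.+ suc D)       ≈⟨ ^-homo-* q D (suc D) ⟩
        q ^ D * (q * q ^ D)     ≈⟨ solve 2 (λ a q → a :* (q :* a) := q :* (a :* a)) refl (q ^ D) q ⟩
        q * (q ^ D * q ^ D)     ≈⟨ *-congˡ (^-distrib-* q q D) ⟨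
        q * p ^ D               ≈⟨ y≈1 ⟩
        1#                      ∎

      q^ld≈1 : ∀ l → q ^ (l ℕ.* d) ≈ 1#
      q^ld≈1 zero    = refl
      q^ld≈1 (suc l) = trans (^-homo-* q d (l ℕ.* d)) (trans (*-cong q^d≈1 (q^ld≈1 l)) (*-identityˡ 1#))

      periodic : ∀ l i → q ^ (i ℕ.+ l ℕ.* d) ≈ q ^ i
      periodic l i = trans (^-homo-* q i (l ℕ.* d)) (trans (*-congˡ (q^ld≈1 l)) (*-identityʳ _))

      p-periodic : ∀ l i → p ^ (i ℕ.+ l ℕ.* d) ≈ p ^ i
      p-periodic l i = begin
        p ^ (i ℕ.+ l ℕ.* d)                               ≈⟨ ^-distrib-* q q (i ℕ.+ l ℕ.* d) ⟩
        q ^ (i ℕ.+ l ℕ.* d) * q ^ (i ℕ.+ l ℕ.* d)         ≈⟨ *-cong (periodic l i) (periodic l i) ⟩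
        q ^ i * q ^ i                                     ≈⟨ ^-distrib-* q q i ⟨
        p ^ i                                             ∎

      -- With q^d = 1 the recurrence of τ has period d, so blocks differ only in their starting
      -- values. The induction ends before i + 1 = d, where 1 - p^d = 0 could not be cancelled.
      τ-block : ∀ l i → i < d → τ (i ℕ.+ l ℕ.* d) ≈ τ i * τ (l ℕ.* d)
      τ-block l zero    _   = sym (trans (*-congʳ τ-zero) (*-identityˡ _))
      τ-block l (suc i) 1+i<d = unit-cancelˡ (even-unit i i<2D) (begin
        (1# - p ^ suc i) * τ (suc k)          ≈⟨ *-comm _ _ ⟩
        τ (suc k) * (1# - p ^ suc i)          ≈⟨ *-congˡ (+-congˡ (-‿cong (p-periodic l (suc i)))) ⟨
        τ (suc k) * (1# - p ^ suc k)          ≈⟨ τ-suc k ⟩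
        τ k * (1# - q * p ^ k)                ≈⟨ *-cong (τ-block l i (ℕ.<⇒≤ 1+i<d)) (+-congˡ (-‿cong (*-congˡ (p-periodic l i)))) ⟩
        τ i * T * (1# - q * p ^ i)            ≈⟨ solve 3 (λ t T a → t :* T :* a := t :* a :* T) refl _ _ _ ⟩
        τ i * (1# - q * p ^ i) * T            ≈⟨ *-congʳ (τ-suc i) ⟨
        τ (suc i) * (1# - p ^ suc i) * T      ≈⟨ solve 3 (λ t T u → t :* u :* T := u :* (t :* T)) refl _ _ _ ⟩
        (1# - p ^ suc i) * (τ (suc i) * T)    ∎)
        where
        k = i ℕ.+ l ℕ.* d ; T = τ (l ℕ.* d)
        i<2D : i < D ℕ.+ D
        i<2D = ℕ.≤-pred (≡.subst (suc i <_) (ℕ.+-suc D D) 1+i<d)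

      g-block : ∀ l i → i < d → g (i ℕ.+ l ℕ.* d) ≈ τ (l ℕ.* d) ^ 6 * g i
      g-block l i i<d = begin
        ⟦4 k +1⟧ * τ k ^ 6 * q ^ k                 ≈⟨ *-cong (*-cong bracket (^-congˡ 6 (τ-block l i i<d))) (periodic l i) ⟩
        ⟦4 i +1⟧ * (τ i * T) ^ 6 * q ^ i           ≈⟨ solve 4 (λ b t T y → b :* (t :* T) :^ 6 :* y := T :^ 6 :* (b :* t :^ 6 :* y)) refl _ _ _ _ ⟩
        T ^ 6 * g i                                ∎
        where
        k = i ℕ.+ l ℕ.* d ; T = τ (l ℕ.* d)
        -- The numerator 1 - q^(4k+1) has period d in k, and the denominator 1 - q is a unit.
        bracket : ⟦4 k +1⟧ ≈ ⟦4 i +1⟧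
        bracket = unit-cancelˡ 1-q-unit (trans (*-comm _ _) (trans (⟦4k+1⟧[1-q] k)
          (trans (+-congˡ (-‿cong (*-congˡ (*-cong (p-periodic l i) (p-periodic l i)))))
                 (trans (sym (⟦4k+1⟧[1-q] i)) (*-comm _ _)))))

      half-block : ∑ (suc D) g ≈ 0#
      half-block = trans half-sum (trans (*-congʳ (trans (*-congʳ ⟦d⟧≈0) (zeroˡ _))) (zeroˡ _))

      full-block : ∑ d g ≈ 0#
      full-block = trans full-sum half-block

      shifted-sum : ∀ l m → m ≤ d → ∑ m g ≈ 0# → ∑ m (λ i → g (i ℕ.+ l ℕ.* d)) ≈ 0#
      shifted-sum l m m≤d ∑g≈0 = begin
        ∑ m (λ i → g (i ℕ.+ l ℕ.* d))            ≈⟨ ∑-cong m (λ i i<m → g-block l i (ℕ.<-≤-trans i<m m≤d)) ⟩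
        ∑ m (λ i → τ (l ℕ.* d) ^ 6 * g i)        ≈⟨ *-distribˡ-∑ m _ g ⟨
        τ (l ℕ.* d) ^ 6 * ∑ m g                  ≈⟨ trans (*-congˡ ∑g≈0) (zeroʳ _) ⟩
        0#                                       ∎

      sum-full-blocks : ∀ l → ∑ (l ℕ.* d) g ≈ 0#
      sum-full-blocks zero    = refl
      sum-full-blocks (suc l) = trans (∑-split (l ℕ.* d) d g)
        (trans (+-cong (sum-full-blocks l) (shifted-sum l d ℕ.≤-refl full-block)) (+-identityˡ 0#))

      -- For n = (2l + 1) d the index (n - 1)/2 is D + l d, the middle of a block. The shorter sum
      -- of the theorem is therefore l full blocks and the first half of another.
      sum-half-blocks : ∀ l → ∑ (suc D ℕ.+ l ℕ.* d) g ≈ 0#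
      sum-half-blocks l = trans (∑-split (l ℕ.* d) (suc D) g)
        (trans (+-cong (sum-full-blocks l) (shifted-sum l (suc D) (ℕ.m≤n+m (suc D) D) half-block)) (+-identityˡ 0#))

-- Fractions with regular denominators, modulo P

module Localization {c ℓ} (R : CommutativeRing c ℓ) (P : CommutativeRing.Carrier R) where
  open CommutativeRing R
  open IntegerRingSolver R
  open import Algebra.Properties.Semiring.Divisibility semiring

  -- Fractions whose denominators are not zero divisors modulo P, up to congruence modulo P;
  -- for P = 0 in a domain this is the field of fractions.
  Regular : Carrier → Set (c ⊔ ℓ)
  Regular u = ∀ f → P ∣ u * f → P ∣ f

  ∣-sum : ∀ {a b} → P ∣ a → P ∣ b → P ∣ a + b
  ∣-sum (x , xP≈a) (y , yP≈b) = x + y , trans (distribʳ P x y) (+-cong xP≈a yP≈b)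

  ∣-multiple : ∀ {a} b → P ∣ a → P ∣ b * a
  ∣-multiple b (x , xP≈a) = b * x , trans (*-assoc b x P) (*-congˡ xP≈a)

  ∣-equal : ∀ {a b} → a ≈ b → P ∣ a - b
  ∣-equal {a} {b} a≈b = 0# , trans (zeroˡ P) (sym (trans (+-congʳ a≈b) (-‿inverseʳ b)))

  regular-resp : ∀ {u v} → u ≈ v → Regular u → Regular v
  regular-resp u≈v reg f P∣vf = reg f (∣ʳ-respʳ-≈ (*-congʳ (sym u≈v)) P∣vf)

  regular-1 : Regular 1#
  regular-1 f P∣1f = ∣ʳ-respʳ-≈ (*-identityˡ f) P∣1f

  regular-* : ∀ {u v} → Regular u → Regular v → Regular (u * v)
  regular-* reg-u reg-v f P∣uvf = reg-v f (reg-u _ (∣ʳ-respʳ-≈ (*-assoc _ _ f) P∣uvf))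

  regular-factor : ∀ {u v} → u ∣ v → Regular v → Regular u
  regular-factor {u} (w , wu≈v) reg-v f P∣uf =
    reg-v f (∣ʳ-respʳ-≈ (trans (sym (*-assoc w u f)) (*-congʳ wu≈v)) (∣-multiple w P∣uf))

  record Fraction : Set (c ⊔ ℓ) where
    constructor frac
    field
      num den     : Carrier
      den-regular : Regular den
  open Fraction public

  infix 4 _≃_
  record _≃_ (x y : Fraction) : Set (c ⊔ ℓ) where
    constructor cross
    field P∣cross : P ∣ num x * den y - num y * den x
  open _≃_ public

  ≃-equal : ∀ {x y} → num x * den y ≈ num y * den x → x ≃ y
  ≃-equal eq = cross (∣-equal eq)

  ≃-refl : ∀ {x} → x ≃ x
  ≃-refl = ≃-equal refl

  ≃-sym : ∀ {x y} → x ≃ y → y ≃ x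
  ≃-sym {x} {y} (cross x≃y) = cross (∣ʳ-respʳ-≈
    (solve 2 (λ a b → :- 𝟙 :* (a :- b) := b :- a) refl (num x * den y) (num y * den x)) (∣-multiple (- 1#) x≃y))

  -- A combination of the two cross products is the wanted one times the middle denominator b′.
  -- Regularity of b′ is exactly what removes it.
  ≃-trans : ∀ {x y z} → x ≃ y → y ≃ z → x ≃ z
  ≃-trans {frac a b _} {frac a′ b′ b′-reg} {frac a″ b″ _} (cross x≃y) (cross y≃z) =
    cross (b′-reg _ (∣ʳ-respʳ-≈
      (solve 6 (λ a b a′ b′ a″ b″ → b″ :* (a :* b′ :- a′ :* b) :+ b :* (a′ :* b″ :- a″ :* b′)
        := b′ :* (a :* b″ :- a″ :* b)) refl a b a′ b′ a″ b″)
      (∣-sum (∣-multiple b″ x≃y) (∣-multiple b y≃z))))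

  infixl 6 _⊕_
  infixl 7 _⊗_

  _⊕_ _⊗_ : Fraction → Fraction → Fraction
  frac a b b-reg ⊕ frac c d d-reg = frac (a * d + c * b) (b * d) (regular-* b-reg d-reg)
  frac a b b-reg ⊗ frac c d d-reg = frac (a * c) (b * d) (regular-* b-reg d-reg)

  ⊖_ : Fraction → Fraction
  ⊖ frac a b b-reg = frac (- a) b b-reg

  ⊕-cong : ∀ {x x′ y y′} → x ≃ x′ → y ≃ y′ → x ⊕ y ≃ x′ ⊕ y′
  ⊕-cong {frac a b _} {frac a′ b′ _} {frac c d _} {frac c′ d′ _} (cross x≃x′) (cross y≃y′) = cross (∣ʳ-respʳ-≈
    (solve 8 (λ a b c d a′ b′ c′ d′ → d :* d′ :* (a :* b′ :- a′ :* b) :+ b :* b′ :* (c :* d′ :- c′ :* d)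
      := (a :* d :+ c :* b) :* (b′ :* d′) :- (a′ :* d′ :+ c′ :* b′) :* (b :* d)) refl a b c d a′ b′ c′ d′)
    (∣-sum (∣-multiple (d * d′) x≃x′) (∣-multiple (b * b′) y≃y′)))

  ⊗-cong : ∀ {x x′ y y′} → x ≃ x′ → y ≃ y′ → x ⊗ y ≃ x′ ⊗ y′
  ⊗-cong {frac a b _} {frac a′ b′ _} {frac c d _} {frac c′ d′ _} (cross x≃x′) (cross y≃y′) = cross (∣ʳ-respʳ-≈
    (solve 8 (λ a b c d a′ b′ c′ d′ → c :* d′ :* (a :* b′ :- a′ :* b) :+ a′ :* b :* (c :* d′ :- c′ :* d)
      := (a :* c) :* (b′ :* d′) :- (a′ :* c′) :* (b :* d)) refl a b c d a′ b′ c′ d′)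
    (∣-sum (∣-multiple (c * d′) x≃x′) (∣-multiple (a′ * b) y≃y′)))

  ⊖-cong : ∀ {x x′} → x ≃ x′ → ⊖ x ≃ ⊖ x′
  ⊖-cong {frac a b _} {frac a′ b′ _} (cross x≃x′) = cross (∣ʳ-respʳ-≈
    (solve 4 (λ a b a′ b′ → :- 𝟙 :* (a :* b′ :- a′ :* b) := :- a :* b′ :- :- a′ :* b) refl a b a′ b′)
    (∣-multiple (- 1#) x≃x′))

  fractionRing : CommutativeRing (c ⊔ ℓ) (c ⊔ ℓ)
  fractionRing = record
    { Carrier = Fraction ; _≈_ = _≃_ ; _+_ = _⊕_ ; _*_ = _⊗_ ; -_ = ⊖_ ; 0# = frac 0# 1# regular-1 ; 1# = frac 1# 1# regular-1
    ; isCommutativeRing = record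
      { isRing = record
        { +-isAbelianGroup = record
          { isGroup = record
            { isMonoid = record
              { isSemigroup = record
                { isMagma = record
                  { isEquivalence = record { refl = ≃-refl ; sym = ≃-sym ; trans = ≃-trans }
                  ; ∙-cong = ⊕-cong }
                ; assoc = λ where
                    (frac a b _) (frac c d _) (frac e f _) → ≃-equal (solve 6 (λ a b c d e f →
                      ((a :* d :+ c :* b) :* f :+ e :* (b :* d)) :* (b :* (d :* f))
                      := (a :* (d :* f) :+ (c :* f :+ e :* d) :* b) :* (b :* d :* f)) refl a b c d e f) }
              ; identity =
                  (λ where (frac a b _) → ≃-equal (solve 2 (λ a b →
                             (con (+ 0) :* b :+ a :* 𝟙) :* b := a :* (𝟙 :* b)) refl a b))
                , (λ where (frac a b _) → ≃-equal (solve 2 (λ a b →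
                             (a :* 𝟙 :+ con (+ 0) :* b) :* b := a :* (b :* 𝟙)) refl a b)) }
            ; inverse =
                (λ where (frac a b _) → ≃-equal (solve 2 (λ a b →
                           (:- a :* b :+ a :* b) :* 𝟙 := con (+ 0) :* (b :* b)) refl a b))
              , (λ where (frac a b _) → ≃-equal (solve 2 (λ a b →
                           (a :* b :+ :- a :* b) :* 𝟙 := con (+ 0) :* (b :* b)) refl a b))
            ; ⁻¹-cong = ⊖-cong }
          ; comm = λ where
              (frac a b _) (frac c d _) → ≃-equal (solve 4 (λ a b c d →
                (a :* d :+ c :* b) :* (d :* b) := (c :* b :+ a :* d) :* (b :* d)) refl a b c d) }
        ; *-cong = ⊗-cong
        ; *-assoc = λ where
            (frac a b _) (frac c d _) (frac e f _) → ≃-equal (solve 6 (λ a b c d e f →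
              a :* c :* e :* (b :* (d :* f)) := a :* (c :* e) :* (b :* d :* f)) refl a b c d e f)
        ; *-identity =
            (λ where (frac a b _) → ≃-equal (solve 2 (λ a b → 𝟙 :* a :* b := a :* (𝟙 :* b)) refl a b))
          , (λ where (frac a b _) → ≃-equal (solve 2 (λ a b → a :* 𝟙 :* b := a :* (b :* 𝟙)) refl a b))
        ; distrib =
            (λ where (frac a b _) (frac c d _) (frac e f _) → ≃-equal (solve 6 (λ a b c d e f →
                       a :* (c :* f :+ e :* d) :* (b :* d :* (b :* f))
                       := (a :* c :* (b :* f) :+ a :* e :* (b :* d)) :* (b :* (d :* f))) refl a b c d e f))
          , (λ where (frac a b _) (frac c d _) (frac e f _) → ≃-equal (solve 6 (λ a b c d e f →
                       (c :* f :+ e :* d) :* a :* (d :* b :* (f :* b))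
                       := (c :* a :* (f :* b) :+ e :* a :* (d :* b)) :* (d :* f :* b)) refl a b c d e f)) }
      ; *-comm = λ where
          (frac a b _) (frac c d _) → ≃-equal (solve 4 (λ a b c d →
            a :* c :* (d :* b) := c :* a :* (b :* d)) refl a b c d) } }

  opaque
    commutativeRing : CommutativeRing (c ⊔ ℓ) (c ⊔ ℓ)
    commutativeRing = fractionRing

  private module L = CommutativeRing commutativeRing

  opaque
    unfolding commutativeRing

    fraction : (a b : Carrier) → Regular b → L.Carrier
    fraction = frac

    fraction-cong : ∀ {a b r c d s} → P ∣ a * d - c * b → fraction a b r L.≈ fraction c d s
    fraction-cong {a} {b} {r} {c} {d} {s} P∣ = cross {frac a b r} {frac c d s} P∣

    fraction-injective : ∀ {a b r c d s} → fraction a b r L.≈ fraction c d s → P ∣ a * d - c * b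
    fraction-injective {a} {b} {r} {c} {d} {s} eq = P∣cross {frac a b r} {frac c d s} eq

    fraction-+ : ∀ a b r c d s → fraction a b r L.+ fraction c d s L.≈ fraction (a * d + c * b) (b * d) (regular-* r s)
    fraction-+ a b r c d s = ≃-refl {frac a b r ⊕ frac c d s}

    fraction-* : ∀ a b r c d s → fraction a b r L.* fraction c d s L.≈ fraction (a * c) (b * d) (regular-* r s)
    fraction-* a b r c d s = ≃-refl {frac a b r ⊗ frac c d s}

    fraction-neg : ∀ a b r → L.- fraction a b r L.≈ fraction (- a) b r
    fraction-neg a b r = ≃-refl {⊖ frac a b r}

    fraction-0 : fraction 0# 1# regular-1 L.≈ L.0#
    fraction-0 = ≃-refl {frac 0# 1# regular-1}

    fraction-1 : fraction 1# 1# regular-1 L.≈ L.1#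
    fraction-1 = ≃-refl {frac 1# 1# regular-1}

-- The ring ℤ[q] of coefficient lists

infix 4 _≋_
-- A record, so that f and g can be inferred from the type of a proof; `_≈ₚ_` unfolds to equations
-- between coefficients, which do not determine the lists.
record _≋_ (f g : Poly) : Set where
  constructor coeffwise
  field coeffs : f ≈ₚ g
open _≋_ public

coeff-+ : ∀ f g i → coeff (f +ₚ g) i ≡ coeff f i ℤ.+ coeff g i
coeff-+ []      g       i       = ≡.sym (ℤ.+-identityˡ _)
coeff-+ (a ∷ f) []      i       = ≡.sym (ℤ.+-identityʳ _)
coeff-+ (a ∷ f) (b ∷ g) zero    = ≡.refl
coeff-+ (a ∷ f) (b ∷ g) (suc i) = coeff-+ f g i

coeff-· : ∀ c f i → coeff (c ·ₚ f) i ≡ c ℤ.* coeff f i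
coeff-· c []      i       = ≡.sym (ℤ.*-zeroʳ c)
coeff-· c (a ∷ f) zero    = ≡.refl
coeff-· c (a ∷ f) (suc i) = coeff-· c f i

coeff-neg : ∀ f i → coeff (-ₚ f) i ≡ ℤ.- coeff f i
coeff-neg f i = ≡.trans (coeff-· -1ℤ f i) (ℤ.-1*i≡-i _)

coeff-*-zero : ∀ a f g → coeff ((a ∷ f) *ₚ g) 0 ≡ a ℤ.* coeff g 0
coeff-*-zero a f g = ≡.trans (coeff-+ (a ·ₚ g) _ 0) (≡.trans (ℤ.+-identityʳ _) (coeff-· a g 0))

coeff-*-suc : ∀ a f g i → coeff ((a ∷ f) *ₚ g) (suc i) ≡ a ℤ.* coeff g (suc i) ℤ.+ coeff (f *ₚ g) i
coeff-*-suc a f g i = ≡.trans (coeff-+ (a ·ₚ g) _ (suc i)) (≡.cong (ℤ._+ _) (coeff-· a g (suc i)))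

≋-refl : ∀ {f} → f ≋ f
≋-refl = coeffwise λ _ → ≡.refl

≋-sym : ∀ {f g} → f ≋ g → g ≋ f
≋-sym (coeffwise eq) = coeffwise λ i → ≡.sym (eq i)

≋-trans : ∀ {f g h} → f ≋ g → g ≋ h → f ≋ h
≋-trans (coeffwise eq₁) (coeffwise eq₂) = coeffwise λ i → ≡.trans (eq₁ i) (eq₂ i)

≋-setoid : Setoid _ _
≋-setoid = record { Carrier = Poly ; _≈_ = _≋_ ; isEquivalence = record { refl = ≋-refl ; sym = ≋-sym ; trans = ≋-trans } }

∷-cong : ∀ {a b f g} → a ≡ b → f ≋ g → a ∷ f ≋ b ∷ g
∷-cong a≡b (coeffwise eq) = coeffwise λ { zero → a≡b ; (suc i) → eq i }

+ₚ-cong : ∀ {f f′ g g′} → f ≋ f′ → g ≋ g′ → f +ₚ g ≋ f′ +ₚ g′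
+ₚ-cong {f} {f′} {g} {g′} (coeffwise p) (coeffwise q) = coeffwise λ i →
  ≡.trans (coeff-+ f g i) (≡.trans (≡.cong₂ ℤ._+_ (p i) (q i)) (≡.sym (coeff-+ f′ g′ i)))

*ₚ-congˡ : ∀ f {g h} → g ≋ h → f *ₚ g ≋ f *ₚ h
*ₚ-congˡ [] _ = ≋-refl
*ₚ-congˡ (a ∷ f) {g} {h} g≋h@(coeffwise eq) = coeffwise λ where
  zero    → ≡.trans (coeff-*-zero a f g) (≡.trans (≡.cong (a ℤ.*_) (eq 0)) (≡.sym (coeff-*-zero a f h)))
  (suc i) → ≡.trans (coeff-*-suc a f g i)
    (≡.trans (≡.cong₂ (λ x y → a ℤ.* x ℤ.+ y) (eq (suc i)) (coeffs (*ₚ-congˡ f g≋h) i)) (≡.sym (coeff-*-suc a f h i)))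

*ₚ-zeroʳ : ∀ f → f *ₚ [] ≋ []
*ₚ-zeroʳ []      = ≋-refl
*ₚ-zeroʳ (a ∷ f) = coeffwise λ { zero → ≡.refl ; (suc i) → coeffs (*ₚ-zeroʳ f) i }

-- This mirrors the defining recursion in the right factor. Commutativity follows by induction, and
-- the remaining one-sided laws are carried over to the other side by it.
*ₚ-∷ʳ : ∀ f b g → f *ₚ (b ∷ g) ≋ (b ·ₚ f) +ₚ (0ℤ ∷ (f *ₚ g))
*ₚ-∷ʳ [] b g = coeffwise λ { zero → ≡.refl ; (suc i) → ≡.refl }
*ₚ-∷ʳ (a ∷ f) b g = coeffwise λ where
  zero → ≡.trans (coeff-*-zero a f (b ∷ g)) (≡.trans (ℤ.*-comm a b) (≡.sym (ℤ.+-identityʳ _)))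
  (suc i) → begin
    coeff ((a ∷ f) *ₚ (b ∷ g)) (suc i)                       ≡⟨ coeff-*-suc a f (b ∷ g) i ⟩
    a ℤ.* coeff g i ℤ.+ coeff (f *ₚ (b ∷ g)) i               ≡⟨ ≡.cong (ℤ._+_ (a ℤ.* coeff g i)) (coeffs (*ₚ-∷ʳ f b g) i) ⟩
    a ℤ.* coeff g i ℤ.+ coeff ((b ·ₚ f) +ₚ (0ℤ ∷ (f *ₚ g))) i
      ≡⟨ ≡.cong (ℤ._+_ (a ℤ.* coeff g i)) (≡.trans (coeff-+ (b ·ₚ f) _ i) (≡.cong (ℤ._+ _) (coeff-· b f i))) ⟩
    a ℤ.* coeff g i ℤ.+ (b ℤ.* coeff f i ℤ.+ coeff (0ℤ ∷ (f *ₚ g)) i)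
      ≡⟨ rearrange (a ℤ.* coeff g i) (b ℤ.* coeff f i) _ ⟩
    b ℤ.* coeff f i ℤ.+ (a ℤ.* coeff g i ℤ.+ coeff (0ℤ ∷ (f *ₚ g)) i)
      ≡⟨ ≡.cong₂ ℤ._+_ (coeff-· b f i) (≡.trans (coeff-+ (a ·ₚ g) _ i) (≡.cong (ℤ._+ _) (coeff-· a g i))) ⟨
    coeff (b ·ₚ f) i ℤ.+ coeff ((a ∷ f) *ₚ g) i              ≡⟨ coeff-+ (b ·ₚ f) _ i ⟨
    coeff ((b ·ₚ f) +ₚ ((a ∷ f) *ₚ g)) i                     ∎
 where
  open ≡.≡-Reasoning
  rearrange : ∀ x y z → x ℤ.+ (y ℤ.+ z) ≡ y ℤ.+ (x ℤ.+ z)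
  rearrange = solve-∀

*ₚ-comm : ∀ f g → f *ₚ g ≋ g *ₚ f
*ₚ-comm []      g = ≋-sym (*ₚ-zeroʳ g)
*ₚ-comm (a ∷ f) g = ≋-trans (+ₚ-cong {a ·ₚ g} ≋-refl (∷-cong ≡.refl (*ₚ-comm f g))) (≋-sym (*ₚ-∷ʳ g a f))

*ₚ-cong : ∀ {f f′ g g′} → f ≋ f′ → g ≋ g′ → f *ₚ g ≋ f′ *ₚ g′
*ₚ-cong {f} {f′} {g} {g′} f≋f′ g≋g′ = ≋-trans (*ₚ-congˡ f g≋g′)
  (≋-trans (*ₚ-comm f g′) (≋-trans (*ₚ-congˡ g′ f≋f′) (*ₚ-comm g′ f′)))

*ₚ-distribˡ : ∀ f g h → f *ₚ (g +ₚ h) ≋ f *ₚ g +ₚ f *ₚ h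
*ₚ-distribˡ [] g h = ≋-refl
*ₚ-distribˡ (a ∷ f) g h = coeffwise λ where
  zero → begin
    coeff ((a ∷ f) *ₚ (g +ₚ h)) 0                               ≡⟨ coeff-*-zero a f (g +ₚ h) ⟩
    a ℤ.* coeff (g +ₚ h) 0                                      ≡⟨ ≡.cong (a ℤ.*_) (coeff-+ g h 0) ⟩
    a ℤ.* (coeff g 0 ℤ.+ coeff h 0)                             ≡⟨ ℤ.*-distribˡ-+ a _ _ ⟩
    a ℤ.* coeff g 0 ℤ.+ a ℤ.* coeff h 0                         ≡⟨ ≡.cong₂ ℤ._+_ (coeff-*-zero a f g) (coeff-*-zero a f h) ⟨
    coeff ((a ∷ f) *ₚ g) 0 ℤ.+ coeff ((a ∷ f) *ₚ h) 0           ≡⟨ coeff-+ ((a ∷ f) *ₚ g) _ 0 ⟨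
    coeff ((a ∷ f) *ₚ g +ₚ (a ∷ f) *ₚ h) 0                      ∎
  (suc i) → begin
    coeff ((a ∷ f) *ₚ (g +ₚ h)) (suc i)                         ≡⟨ coeff-*-suc a f (g +ₚ h) i ⟩
    a ℤ.* coeff (g +ₚ h) (suc i) ℤ.+ coeff (f *ₚ (g +ₚ h)) i
      ≡⟨ ≡.cong₂ (λ x y → a ℤ.* x ℤ.+ y) (coeff-+ g h (suc i)) (≡.trans (coeffs (*ₚ-distribˡ f g h) i) (coeff-+ (f *ₚ g) _ i)) ⟩
    a ℤ.* (coeff g (suc i) ℤ.+ coeff h (suc i)) ℤ.+ (coeff (f *ₚ g) i ℤ.+ coeff (f *ₚ h) i)
      ≡⟨ rearrange a (coeff g (suc i)) (coeff h (suc i)) _ _ ⟩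
    (a ℤ.* coeff g (suc i) ℤ.+ coeff (f *ₚ g) i) ℤ.+ (a ℤ.* coeff h (suc i) ℤ.+ coeff (f *ₚ h) i)
      ≡⟨ ≡.cong₂ ℤ._+_ (coeff-*-suc a f g i) (coeff-*-suc a f h i) ⟨
    coeff ((a ∷ f) *ₚ g) (suc i) ℤ.+ coeff ((a ∷ f) *ₚ h) (suc i) ≡⟨ coeff-+ ((a ∷ f) *ₚ g) _ (suc i) ⟨
    coeff ((a ∷ f) *ₚ g +ₚ (a ∷ f) *ₚ h) (suc i)                ∎
 where
  open ≡.≡-Reasoning
  rearrange : ∀ a x y z w → a ℤ.* (x ℤ.+ y) ℤ.+ (z ℤ.+ w) ≡ (a ℤ.* x ℤ.+ z) ℤ.+ (a ℤ.* y ℤ.+ w)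
  rearrange = solve-∀

*ₚ-distribʳ : ∀ f g h → (g +ₚ h) *ₚ f ≋ g *ₚ f +ₚ h *ₚ f
*ₚ-distribʳ f g h = ≋-trans (*ₚ-comm (g +ₚ h) f)
  (≋-trans (*ₚ-distribˡ f g h) (+ₚ-cong (*ₚ-comm f g) (*ₚ-comm f h)))

·ₚ-*ₚ : ∀ a f g → (a ·ₚ f) *ₚ g ≋ a ·ₚ (f *ₚ g)
·ₚ-*ₚ a [] g = ≋-refl
·ₚ-*ₚ a (b ∷ f) g = coeffwise λ where
  zero → begin
    coeff ((a ·ₚ (b ∷ f)) *ₚ g) 0          ≡⟨ coeff-*-zero (a ℤ.* b) (a ·ₚ f) g ⟩
    a ℤ.* b ℤ.* coeff g 0                  ≡⟨ ℤ.*-assoc a b _ ⟩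
    a ℤ.* (b ℤ.* coeff g 0)                ≡⟨ ≡.cong (a ℤ.*_) (coeff-*-zero b f g) ⟨
    a ℤ.* coeff ((b ∷ f) *ₚ g) 0           ≡⟨ coeff-· a ((b ∷ f) *ₚ g) 0 ⟨
    coeff (a ·ₚ ((b ∷ f) *ₚ g)) 0          ∎
  (suc i) → begin
    coeff ((a ·ₚ (b ∷ f)) *ₚ g) (suc i)                          ≡⟨ coeff-*-suc (a ℤ.* b) (a ·ₚ f) g i ⟩
    a ℤ.* b ℤ.* coeff g (suc i) ℤ.+ coeff ((a ·ₚ f) *ₚ g) i
      ≡⟨ ≡.cong (ℤ._+_ (a ℤ.* b ℤ.* coeff g (suc i))) (≡.trans (coeffs (·ₚ-*ₚ a f g) i) (coeff-· a (f *ₚ g) i)) ⟩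
    a ℤ.* b ℤ.* coeff g (suc i) ℤ.+ a ℤ.* coeff (f *ₚ g) i       ≡⟨ rearrange a b _ _ ⟩
    a ℤ.* (b ℤ.* coeff g (suc i) ℤ.+ coeff (f *ₚ g) i)           ≡⟨ ≡.cong (a ℤ.*_) (coeff-*-suc b f g i) ⟨
    a ℤ.* coeff ((b ∷ f) *ₚ g) (suc i)                           ≡⟨ coeff-· a ((b ∷ f) *ₚ g) (suc i) ⟨
    coeff (a ·ₚ ((b ∷ f) *ₚ g)) (suc i)                          ∎
 where
  open ≡.≡-Reasoning
  rearrange : ∀ a b x y → a ℤ.* b ℤ.* x ℤ.+ a ℤ.* y ≡ a ℤ.* (b ℤ.* x ℤ.+ y)
  rearrange = solve-∀

shift-*ₚ : ∀ f g → (0ℤ ∷ f) *ₚ g ≋ 0ℤ ∷ (f *ₚ g)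
shift-*ₚ f g = coeffwise λ where
  zero    → ≡.trans (coeff-*-zero 0ℤ f g) (ℤ.*-zeroˡ (coeff g 0))
  (suc i) → ≡.trans (coeff-*-suc 0ℤ f g i) (≡.trans (≡.cong (ℤ._+ coeff (f *ₚ g) i) (ℤ.*-zeroˡ (coeff g (suc i)))) (ℤ.+-identityˡ _))

*ₚ-assoc : ∀ f g h → (f *ₚ g) *ₚ h ≋ f *ₚ (g *ₚ h)
*ₚ-assoc [] g h = ≋-refl
*ₚ-assoc (a ∷ f) g h = ≋-trans (*ₚ-distribʳ h (a ·ₚ g) (0ℤ ∷ (f *ₚ g)))
  (+ₚ-cong (·ₚ-*ₚ a g h) (≋-trans (shift-*ₚ (f *ₚ g) h) (∷-cong ≡.refl (*ₚ-assoc f g h))))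

*ₚ-identityˡ : ∀ f → 1ₚ *ₚ f ≋ f
*ₚ-identityˡ f = coeffwise λ where
  zero    → ≡.trans (coeff-*-zero 1ℤ [] f) (ℤ.*-identityˡ _)
  (suc i) → ≡.trans (coeff-*-suc 1ℤ [] f i) (≡.trans (ℤ.+-identityʳ _) (ℤ.*-identityˡ _))

ℤ[q] : CommutativeRing 0ℓ 0ℓ
ℤ[q] = record
  { Carrier = Poly ; _≈_ = _≋_ ; _+_ = _+ₚ_ ; _*_ = _*ₚ_ ; -_ = -ₚ_ ; 0# = 0ₚ ; 1# = 1ₚ
  ; isCommutativeRing = record
    { isRing = record
      { +-isAbelianGroup = record
        { isGroup = record
          { isMonoid = record
            { isSemigroup = record
              { isMagma = record { isEquivalence = Setoid.isEquivalence ≋-setoid ; ∙-cong = +ₚ-cong }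
              ; assoc = λ f g h → coeffwise λ i → ≡.trans (coeff-+ (f +ₚ g) h i)
                  (≡.trans (≡.cong (ℤ._+ coeff h i) (coeff-+ f g i)) (≡.trans (ℤ.+-assoc (coeff f i) _ _)
                  (≡.sym (≡.trans (coeff-+ f (g +ₚ h) i) (≡.cong (ℤ._+_ (coeff f i)) (coeff-+ g h i)))))) }
            ; identity = (λ _ → ≋-refl) , λ f → coeffwise λ i → ≡.trans (coeff-+ f [] i) (ℤ.+-identityʳ _) }
          ; inverse =
              (λ f → coeffwise λ i → ≡.trans (coeff-+ (-ₚ f) f i) (≡.trans (≡.cong (ℤ._+ coeff f i) (coeff-neg f i)) (ℤ.+-inverseˡ (coeff f i))))
            , (λ f → coeffwise λ i → ≡.trans (coeff-+ f (-ₚ f) i) (≡.trans (≡.cong (ℤ._+_ (coeff f i)) (coeff-neg f i)) (ℤ.+-inverseʳ (coeff f i))))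
          ; ⁻¹-cong = λ {f} {g} (coeffwise eq) → coeffwise λ i →
              ≡.trans (coeff-neg f i) (≡.trans (≡.cong ℤ.-_ (eq i)) (≡.sym (coeff-neg g i))) }
        ; comm = λ f g → coeffwise λ i → ≡.trans (coeff-+ f g i) (≡.trans (ℤ.+-comm (coeff f i) _) (≡.sym (coeff-+ g f i))) }
      ; *-cong = *ₚ-cong
      ; *-assoc = *ₚ-assoc
      ; *-identity = *ₚ-identityˡ , λ f → ≋-trans (*ₚ-comm f 1ₚ) (*ₚ-identityˡ f)
      ; distrib = *ₚ-distribˡ , *ₚ-distribʳ }
    ; *-comm = *ₚ-comm } }

-- Gaussian binomial coefficients

module QBinomial {c ℓ} (R : CommutativeRing c ℓ) (q : CommutativeRing.Carrier R) where
  open CommutativeRing R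
  open import Relation.Binary.Reasoning.Setoid setoid
  open import Algebra.Properties.Semiring.Exp semiring
  open import Algebra.Properties.CommutativeSemiring.Exp commutativeSemiring using (^-distrib-*)
  open IntegerRingSolver R
  open RingExtra R

  p : Carrier
  p = q * q

  qq-poch : ℕ → Carrier
  qq-poch k = ∏ k λ i → 1# - q ^ suc i

  even-poch odd-poch plus-poch : ℕ → Carrier
  even-poch k = ∏ k λ i → 1# - p ^ suc i
  odd-poch  k = ∏ k λ i → 1# - q * p ^ i
  plus-poch k = ∏ k λ i → 1# + q ^ suc i

  -- The Gaussian binomial coefficient [a + b choose a].
  binomial : ℕ → ℕ → Carrier
  binomial zero    b       = 1#
  binomial (suc a) zero    = 1#
  binomial (suc a) (suc b) = binomial a (suc b) + q ^ suc a * binomial (suc a) b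

  -- Pascal's rule reduces it to (1 - x) + x (1 - y) = 1 - x y with x = q^(a+1) and y = q^(b+1).
  binomial-poch : ∀ a b → binomial a b * (qq-poch a * qq-poch b) ≈ qq-poch (a ℕ.+ b)
  binomial-poch zero    b    = trans (*-identityˡ _) (*-identityˡ _)
  binomial-poch (suc a) zero = trans (*-identityˡ _) (trans (*-identityʳ _) (reflexive (≡.cong (qq-poch ∘ suc) (≡.sym (ℕ.+-identityʳ a)))))
  binomial-poch (suc a) (suc b) = begin
    (B₁ + x * B₂) * (A * (1# - x) * (B * (1# - y)))
      ≈⟨ solve 6 (λ B₁ B₂ A B x y → (B₁ :+ x :* B₂) :* (A :* (𝟙 :- x) :* (B :* (𝟙 :- y)))
           := B₁ :* (A :* (B :* (𝟙 :- y))) :* (𝟙 :- x) :+ B₂ :* (A :* (𝟙 :- x) :* B) :* (x :* (𝟙 :- y))) refl B₁ B₂ A B x y ⟩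
    B₁ * (A * (B * (1# - y))) * (1# - x) + B₂ * (A * (1# - x) * B) * (x * (1# - y))
      ≈⟨ +-cong (*-congʳ (binomial-poch a (suc b)))
                (*-congʳ (trans (binomial-poch (suc a) b) (reflexive (≡.cong qq-poch (≡.sym (ℕ.+-suc a b)))))) ⟩
    Q * (1# - x) + Q * (x * (1# - y))
      ≈⟨ solve 3 (λ Q x y → Q :* (𝟙 :- x) :+ Q :* (x :* (𝟙 :- y)) := Q :* (𝟙 :- x :* y)) refl Q x y ⟩
    Q * (1# - x * y)
      ≈⟨ *-congˡ (+-congˡ (-‿cong (^-homo-* q (suc a) (suc b)))) ⟨
    qq-poch (suc a ℕ.+ suc b) ∎
    where
    B₁ = binomial a (suc b) ; B₂ = binomial (suc a) b
    A = qq-poch a ; B = qq-poch b ; x = q ^ suc a ; y = q ^ suc b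
    Q = qq-poch (a ℕ.+ suc b)

  p^k≈q^k*q^k : ∀ k → p ^ k ≈ q ^ k * q ^ k
  p^k≈q^k*q^k k = ^-distrib-* q q k

  qq-poch-double : ∀ k → qq-poch (k ℕ.+ k) ≈ odd-poch k * even-poch k
  qq-poch-double zero = sym (*-identityˡ 1#)
  qq-poch-double (suc k) = begin
    qq-poch (suc k ℕ.+ suc k)
      ≡⟨ ≡.cong (qq-poch ∘ suc) (ℕ.+-suc k k) ⟩
    qq-poch (k ℕ.+ k) * (1# - q * q ^ (k ℕ.+ k)) * (1# - q * (q * q ^ (k ℕ.+ k)))
      ≈⟨ *-cong (*-cong (qq-poch-double k) (+-congˡ (-‿cong (*-congˡ q^2k))))
                (+-congˡ (-‿cong (trans (*-congˡ (*-congˡ q^2k)) (sym (*-assoc _ _ _))))) ⟩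
    odd-poch k * even-poch k * (1# - q * p ^ k) * (1# - p * p ^ k)
      ≈⟨ solve 4 (λ a b c d → a :* b :* c :* d := a :* c :* (b :* d)) refl _ _ _ _ ⟩
    odd-poch (suc k) * even-poch (suc k) ∎
    where
    q^2k : q ^ (k ℕ.+ k) ≈ p ^ k
    q^2k = trans (^-homo-* q k k) (sym (p^k≈q^k*q^k k))

  even-poch-split : ∀ k → even-poch k ≈ qq-poch k * plus-poch k
  even-poch-split zero = sym (*-identityˡ 1#)
  even-poch-split (suc k) = begin
    even-poch k * (1# - p ^ suc k)
      ≈⟨ *-cong (even-poch-split k) (+-congˡ (-‿cong (p^k≈q^k*q^k (suc k)))) ⟩
    qq-poch k * plus-poch k * (1# - x * x)
      ≈⟨ solve 3 (λ a b x → a :* b :* (𝟙 :- x :* x) := a :* (𝟙 :- x) :* (b :* (𝟙 :+ x))) refl (qq-poch k) (plus-poch k) x ⟩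
    qq-poch (suc k) * plus-poch (suc k) ∎
    where x = q ^ suc k

  -- From (q;q)₂ₖ = (q;q²)ₖ (q²;q²)ₖ and (q²;q²)ₖ = (q;q)ₖ (-q;q)ₖ. The common factor `even-poch k`
  -- remains, as an arbitrary ring offers no cancellation; it is removed in ℤ[q].
  central-binomial : ∀ k → even-poch k * (binomial k k * even-poch k) ≈ even-poch k * (odd-poch k * (plus-poch k * plus-poch k))
  central-binomial k = begin
    E * (B * E)                              ≈⟨ *-cong (even-poch-split k) (*-congˡ (even-poch-split k)) ⟩
    Q * S * (B * (Q * S))                    ≈⟨ solve 3 (λ B Q S → Q :* S :* (B :* (Q :* S)) := B :* (Q :* Q) :* (S :* S)) refl B Q S ⟩
    B * (Q * Q) * (S * S)                    ≈⟨ *-congʳ (binomial-poch k k) ⟩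
    qq-poch (k ℕ.+ k) * (S * S)              ≈⟨ *-congʳ (qq-poch-double k) ⟩
    odd-poch k * E * (S * S)                 ≈⟨ solve 3 (λ a b c → a :* b :* c := b :* (a :* c)) refl _ _ _ ⟩
    E * (odd-poch k * (S * S))               ∎
    where B = binomial k k ; E = even-poch k ; Q = qq-poch k ; S = plus-poch k

module _ where
  open CommutativeRing ℤ[q] using (_+_; _*_; -_; _-_; 0#; 1#; refl; sym; trans; reflexive; setoid; +-cong; +-congˡ; +-congʳ; +-identityˡ; +-identityʳ; -‿cong; -‿inverseʳ; *-cong; *-congˡ; *-congʳ; *-assoc; *-comm; *-identityˡ; *-identityʳ; distribˡ; zeroˡ; zeroʳ)
  open import Algebra.Properties.Semiring.Divisibility (CommutativeRing.semiring ℤ[q]) using (_∣_; _,_; ∣ʳ-respʳ-≈; ∣ʳ-respˡ-≈; ∣-trans; ∣-refl)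
  open import Algebra.Properties.Semiring.Exp (CommutativeRing.semiring ℤ[q])
  open import Relation.Binary.Reasoning.Setoid setoid
  open IntegerRingSolver ℤ[q]
  open RingExtra ℤ[q]
  open Localization ℤ[q] using (Regular; regular-1; regular-*; regular-factor; regular-resp; ∣-sum; ∣-multiple)

  -- Degree bounds, monic polynomials and Gauss' lemma

  Below : Poly → ℕ → Set
  Below f n = ∀ i → n ≤ i → coeff f i ≡ 0ℤ

  Below-0 : ∀ {f} → Below f 0 → f ≋ 0#
  Below-0 f<0 = coeffwise λ i → f<0 i z≤n

  Below-* : ∀ f g {d e} → Below f (suc d) → Below g (suc e) → Below (f * g) (suc (d ℕ.+ e))
  Below-* [] g _ _ _ _ = ≡.refl
  Below-* (a ∷ f) g {zero} {e} f<1 g<e (suc i) (s≤s e≤i) = ≡.trans (coeff-*-suc a f g i)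
    (≡.cong₂ ℤ._+_ (≡.trans (≡.cong (a ℤ.*_) (g<e (suc i) (s≤s e≤i))) (ℤ.*-zeroʳ a))
                   (coeffs (trans (*-congʳ {g} (Below-0 {f} λ i _ → f<1 (suc i) (s≤s z≤n))) (zeroˡ g)) i))
  Below-* (a ∷ f) g {suc d} {e} f<d g<e (suc i) (s≤s d+e<i) = ≡.trans (coeff-*-suc a f g i)
    (≡.cong₂ ℤ._+_
      (≡.trans (≡.cong (a ℤ.*_) (g<e (suc i) (s≤s (ℕ.≤-trans (ℕ.m≤n+m e (suc d)) d+e<i)))) (ℤ.*-zeroʳ a))
      (Below-* f g {d} (λ j d<j → f<d (suc j) (s≤s d<j)) g<e i d+e<i))

  coeff-*-top : ∀ f g {d e} → Below f (suc d) → Below g (suc e) → coeff (f * g) (d ℕ.+ e) ≡ coeff f d ℤ.* coeff g e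
  coeff-*-top [] g {e = e} _ _ = ≡.sym (ℤ.*-zeroˡ (coeff g e))
  coeff-*-top (a ∷ f) g {zero} {zero} f<1 g<e = coeff-*-zero a f g
  coeff-*-top (a ∷ f) g {zero} {suc e} f<1 g<e = ≡.trans (coeff-*-suc a f g e)
    (≡.trans (≡.cong (ℤ._+_ (a ℤ.* coeff g (suc e)))
               (coeffs (trans (*-congʳ {g} (Below-0 {f} λ i _ → f<1 (suc i) (s≤s z≤n))) (zeroˡ g)) e))
             (ℤ.+-identityʳ _))
  coeff-*-top (a ∷ f) g {suc d} {e} f<d g<e = ≡.trans (coeff-*-suc a f g (d ℕ.+ e))
    (≡.trans (≡.cong₂ ℤ._+_
               (≡.trans (≡.cong (a ℤ.*_) (g<e (suc (d ℕ.+ e)) (s≤s (ℕ.m≤n+m e d)))) (ℤ.*-zeroʳ a))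
               (coeff-*-top f g {d} (λ j d<j → f<d (suc j) (s≤s d<j)) g<e))
             (ℤ.+-identityˡ _))

  record Monic (f : Poly) (d : ℕ) : Set where
    field
      below : Below f (suc d)
      top   : coeff f d ≡ 1ℤ
  open Monic

  monic-resp : ∀ {f g d} → f ≋ g → Monic f d → Monic g d
  monic-resp (coeffwise eq) m = record
    { below = λ i d<i → ≡.trans (≡.sym (eq i)) (below m i d<i) ; top = ≡.trans (≡.sym (eq _)) (top m) }

  monic-1 : Monic 1# 0
  monic-1 = record { below = λ { (suc i) _ → ≡.refl } ; top = ≡.refl }

  monic-* : ∀ {f g d e} → Monic f d → Monic g e → Monic (f * g) (d ℕ.+ e)
  monic-* {f} {g} mf mg = record
    { below = Below-* f g (below mf) (below mg)
    ; top = ≡.trans (coeff-*-top f g (below mf) (below mg)) (≡.cong₂ ℤ._*_ (top mf) (top mg)) }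

  const : ℤ → Poly
  const c = c ∷ []

  monomial : ℤ → ℕ → Poly
  monomial a n = a ·ₚ qpow n

  coeff-qpow-top : ∀ n → coeff (qpow n) n ≡ 1ℤ
  coeff-qpow-top zero    = ≡.refl
  coeff-qpow-top (suc n) = coeff-qpow-top n

  qpow-below : ∀ n → Below (qpow n) (suc n)
  qpow-below zero    (suc i) _ = ≡.refl
  qpow-below (suc n) (suc i) (s≤s n<i) = qpow-below n i n<i

  monic-qpow : ∀ n → Monic (qpow n) n
  monic-qpow n = record { below = qpow-below n ; top = coeff-qpow-top n }

  monomial-top : ∀ a n → coeff (monomial a n) n ≡ a
  monomial-top a n = ≡.trans (coeff-· a (qpow n) n) (≡.trans (≡.cong (a ℤ.*_) (coeff-qpow-top n)) (ℤ.*-identityʳ a))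

  monomial-below : ∀ a n → Below (monomial a n) (suc n)
  monomial-below a n i n<i = ≡.trans (coeff-· a (qpow n) i) (≡.trans (≡.cong (a ℤ.*_) (qpow-below n i n<i)) (ℤ.*-zeroʳ a))

  ·ₚ≋const* : ∀ a f → a ·ₚ f ≋ const a * f
  ·ₚ≋const* a f = coeffwise λ where
    zero    → ≡.trans (coeff-· a f 0) (≡.sym (coeff-*-zero a [] f))
    (suc i) → ≡.trans (coeff-· a f (suc i)) (≡.sym (≡.trans (coeff-*-suc a [] f i) (ℤ.+-identityʳ _)))

  const∣ : ∀ {c f} → const c ∣ f → ∀ i → ∃ λ t → coeff f i ≡ t ℤ.* c
  const∣ {c} {f} (h , hc≋f) i = coeff h i , ≡.trans (≡.sym (coeffs (trans (·ₚ≋const* c h) (trans (*-comm _ h) hc≋f)) i))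
    (≡.trans (coeff-· c h i) (ℤ.*-comm c _))

  below-minus-top : ∀ f e → Below f (suc e) → Below (f - monomial (coeff f e) e) e
  below-minus-top f e f<e i e≤i = ≡.trans (coeff-+ f _ i)
    (≡.trans (≡.cong (ℤ._+_ (coeff f i)) (coeff-neg (monomial (coeff f e) e) i)) (cases (ℕ.m≤n⇒m<n∨m≡n e≤i)))
    where
    cases : e < i ⊎ e ≡ i → coeff f i ℤ.- coeff (monomial (coeff f e) e) i ≡ 0ℤ
    cases (inj₁ e<i) = ≡.cong₂ ℤ._-_ (f<e i e<i) (monomial-below (coeff f e) e i e<i)
    cases (inj₂ ≡.refl) = ≡.trans (≡.cong (ℤ._-_ (coeff f e)) (monomial-top (coeff f e) e)) (ℤ.+-inverseʳ (coeff f e))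

  -- Gauss' lemma for a monic factor; c = 0 says that a monic polynomial is not a zero divisor.
  monic-primitive : ∀ {P d} → Monic P d → ∀ c n g → Below g n → const c ∣ P * g → const c ∣ g
  monic-primitive {P} mP c zero g g<0 _ = 0# , trans (zeroˡ (const c)) (sym (Below-0 g<0))
  monic-primitive {P} {d} mP c (suc e) g g<e c∣Pg with const∣ c∣Pg (d ℕ.+ e)
  ... | t , eq = ∣ʳ-respʳ-≈ (solve 2 (λ g m → (g :- m) :+ m := g) refl g m)
      (∣-sum (const c) (monic-primitive mP c e (g - m) (below-minus-top g e g<e) c∣P[g-m]) c∣m)
    where
    m = monomial (coeff g e) e
    top≡ : coeff g e ≡ t ℤ.* c
    top≡ = ≡.trans (≡.sym (≡.trans (coeff-*-top P g (below mP) g<e) (≡.trans (≡.cong (ℤ._* coeff g e) (top mP)) (ℤ.*-identityˡ _)))) eq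
    c∣m : const c ∣ m
    c∣m = monomial t e , coeffwise λ i → ≡.trans (coeffs (trans (*-comm (monomial t e) (const c)) (sym (·ₚ≋const* c (monomial t e)))) i)
       (≡.trans (coeff-· c (monomial t e) i) (≡.trans (≡.cong (c ℤ.*_) (coeff-· t (qpow e) i))
       (≡.trans (≡.sym (ℤ.*-assoc c t _)) (≡.trans (≡.cong (ℤ._* coeff (qpow e) i) (≡.trans (ℤ.*-comm c t) (≡.sym top≡))) (≡.sym (coeff-· (coeff g e) (qpow e) i))))))
    c∣P[g-m] : const c ∣ P * (g - m)
    c∣P[g-m] = ∣ʳ-respʳ-≈ (solve 3 (λ P g m → P :* g :+ :- P :* m := P :* (g :- m)) refl P g m)
      (∣-sum (const c) c∣Pg (∣-multiple (const c) (- P) c∣m))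

  Below-length : ∀ f → Below f (length f)
  Below-length []      i       _         = ≡.refl
  Below-length (a ∷ f) (suc i) (s≤s n≤i) = Below-length f i n≤i

  const-0 : const 0ℤ ≋ 0#
  const-0 = coeffwise λ { zero → ≡.refl ; (suc i) → ≡.refl }

  monic-cancel-0 : ∀ {P d} → Monic P d → ∀ f → P * f ≋ 0# → f ≋ 0#
  monic-cancel-0 {P} mP f Pf≋0 with monic-primitive mP 0ℤ (length f) f (Below-length f) (0# , trans (zeroˡ (const 0ℤ)) (sym Pf≋0))
  ... | h , h0≋f = trans (sym h0≋f) (trans (*-congˡ {h} const-0) (zeroʳ h))

  cancel-by-0 : ∀ u → (∀ f → u * f ≋ 0# → f ≋ 0#) → ∀ {f g} → u * f ≋ u * g → f ≋ g
  cancel-by-0 u inj {f} {g} uf≋ug = trans (solve 2 (λ f g → f := (f :- g) :+ g) refl f g) (trans (+-congʳ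
      (inj (f - g) (trans (solve 3 (λ u f g → u :* (f :- g) := u :* f :- u :* g) refl u f g) (trans (+-congʳ uf≋ug) (-‿inverseʳ (u * g))))))
     (+-identityˡ g))

  monic-cancelˡ : ∀ {P d} → Monic P d → ∀ {f g} → P * f ≋ P * g → f ≋ g
  monic-cancelˡ {P} mP = cancel-by-0 P (monic-cancel-0 mP)

  const-cancelˡ : ∀ c → c ≢ 0ℤ → ∀ {f g} → const c * f ≋ const c * g → f ≋ g
  const-cancelˡ c c≢0 {f} {g} cf≋cg = coeffwise λ i → ℤ.*-cancelˡ-≡ c _ _ {{ℤ.≢-nonZero c≢0}}
    (≡.trans (≡.sym (coeff-· c f i)) (≡.trans (coeffs (trans (·ₚ≋const* c f) (trans cf≋cg (sym (·ₚ≋const* c g)))) i) (coeff-· c g i)))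

  -- If g P = c f, then c divides P g and hence g by Gauss' lemma; writing g = h c and cancelling c
  -- leaves h P = f.
  const-regular : ∀ {P d} → Monic P d → ∀ c → c ≢ 0ℤ → Regular P (const c)
  const-regular {P} mP c c≢0 f (g , gP≋cf)
    with monic-primitive mP c (length g) g (Below-length g) (f , trans (*-comm f _) (trans (sym gP≋cf) (*-comm g P)))
  ... | h , hc≋g = h , const-cancelˡ c c≢0 (begin
    const c * (h * P)    ≈⟨ solve 3 (λ c h P → c :* (h :* P) := h :* c :* P) refl (const c) h P ⟩
    h * const c * P      ≈⟨ *-congʳ hc≋g ⟩
    g * P                ≈⟨ gP≋cf ⟩
    const c * f          ∎)

  -- Exactness of the division by monic polynomials

  normalize-∷ʳ0 : ∀ f → normalize (f ∷ʳ 0ℤ) ≡ normalize f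
  normalize-∷ʳ0 f rewrite List.reverse-++ f (0ℤ ∷ []) = ≡.refl

  normalize-∷ʳ≢0 : ∀ f a → a ≢ 0ℤ → normalize (f ∷ʳ a) ≡ f ∷ʳ a
  normalize-∷ʳ≢0 f (+ zero) a≢0 = ⊥-elim (a≢0 ≡.refl)
  normalize-∷ʳ≢0 f a@(+[1+ _ ]) a≢0 rewrite List.reverse-++ f (a ∷ []) =
    ≡.trans (List.unfold-reverse a (reverse f)) (≡.cong (_∷ʳ a) (List.reverse-involutive f))
  normalize-∷ʳ≢0 f a@(-[1+ _ ]) a≢0 rewrite List.reverse-++ f (a ∷ []) =
    ≡.trans (List.unfold-reverse a (reverse f)) (≡.cong (_∷ʳ a) (List.reverse-involutive f))

  data NormalForm (f : Poly) : Set where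
    null    : normalize f ≡ [] → NormalForm f
    nonnull : ∀ g a → a ≢ 0ℤ → normalize f ≡ g ∷ʳ a → NormalForm f

  ∷ʳ0≋ : ∀ f → f ∷ʳ 0ℤ ≋ f
  ∷ʳ0≋ []      = const-0
  ∷ʳ0≋ (a ∷ f) = ∷-cong ≡.refl (∷ʳ0≋ f)

  normalForm : ∀ f → NormalForm f × normalize f ≋ f
  normalForm f = ≡.subst (λ f → NormalForm f × normalize f ≋ f) (List.reverse-involutive f) (go (reverse f))
    where
    snoc : ∀ f a → NormalForm f × normalize f ≋ f → NormalForm (f ∷ʳ a) × normalize (f ∷ʳ a) ≋ f ∷ʳ a
    snoc f a ih with a ℤ.≟ 0ℤ
    ... | no a≢0 = nonnull f a a≢0 (normalize-∷ʳ≢0 f a a≢0) , reflexive (normalize-∷ʳ≢0 f a a≢0)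
    snoc f a (null eq , norm≋) | yes ≡.refl =
      null (≡.trans (normalize-∷ʳ0 f) eq) , trans (reflexive (normalize-∷ʳ0 f)) (trans norm≋ (sym (∷ʳ0≋ f)))
    snoc f a (nonnull g b b≢0 eq , norm≋) | yes ≡.refl =
      nonnull g b b≢0 (≡.trans (normalize-∷ʳ0 f) eq) , trans (reflexive (normalize-∷ʳ0 f)) (trans norm≋ (sym (∷ʳ0≋ f)))
    go : ∀ xs → NormalForm (reverse xs) × normalize (reverse xs) ≋ reverse xs
    go []       = null ≡.refl , refl
    go (a ∷ xs) = ≡.subst (λ f → NormalForm f × normalize f ≋ f) (≡.sym (List.unfold-reverse a xs)) (snoc (reverse xs) a (go xs))

  1≢0 : 1ℤ ≢ 0ℤ
  1≢0 ()

  record Leading (f : Poly) (d : ℕ) (a : ℤ) : Set where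
    field
      nonzero : a ≢ 0ℤ
      below   : Below f (suc d)
      top     : coeff f d ≡ a

  coeff-∷ʳ : ∀ g a → coeff (g ∷ʳ a) (length g) ≡ a
  coeff-∷ʳ []      a = ≡.refl
  coeff-∷ʳ (_ ∷ g) a = coeff-∷ʳ g a

  data Size (f : Poly) : Set where
    zero-poly    : f ≋ 0# → length (normalize f) ≡ 0 → Size f
    nonzero-poly : ∀ d a → Leading f d a → length (normalize f) ≡ suc d → leadCoeff f ≡ a → Size f

  size : ∀ f → Size f
  size f with normalForm f
  ... | null eq , norm≋ = zero-poly (trans (sym norm≋) (reflexive eq)) (≡.cong length eq)
  ... | nonnull g a a≢0 eq , norm≋ = nonzero-poly (length g) a
      record { nonzero = a≢0
             ; below = λ i g<i → ≡.trans (coeffs f≋ i) (Below-length (g ∷ʳ a) i (ℕ.≤-trans (ℕ.≤-reflexive length-∷ʳ) g<i))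
             ; top = ≡.trans (coeffs f≋ (length g)) (coeff-∷ʳ g a) }
      (≡.trans (≡.cong length eq) length-∷ʳ) leading
    where
    f≋ : f ≋ g ∷ʳ a
    f≋ = trans (sym norm≋) (reflexive eq)
    length-∷ʳ : length (g ∷ʳ a) ≡ suc (length g)
    length-∷ʳ = ≡.trans (List.length-++ g) (ℕ.+-comm (length g) 1)
    leading : leadCoeff f ≡ a
    leading rewrite eq | List.reverse-++ g (a ∷ []) = ≡.refl

  length-normalize : ∀ f {n} → Below f n → length (normalize f) ≤ n
  length-normalize f {n} f<n with size f
  ... | zero-poly _ eq rewrite eq = z≤n
  ... | nonzero-poly d a lead eq _ rewrite eq with suc d ℕ.≤? n
  ...   | yes d<n = d<n
  ...   | no  d≮n = ⊥-elim (L.nonzero (≡.trans (≡.sym L.top) (f<n d (ℕ.≤-pred (ℕ.≰⇒> d≮n)))))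
    where module L = Leading lead

  length-normalize-monic : ∀ {P d} → Monic P d → length (normalize P) ≡ suc d
  length-normalize-monic {P} {d} mP with size P
  ... | zero-poly P≋0 _ = ⊥-elim (1≢0 (≡.trans (≡.sym (top mP)) (coeffs P≋0 d)))
  ... | nonzero-poly e a lead eq _ with ℕ.<-cmp d e
  ...   | tri< d<e _ _ = ⊥-elim (L.nonzero (≡.trans (≡.sym L.top) (below mP e d<e)))
    where module L = Leading lead
  ...   | tri≈ _ ≡.refl _ = eq
  ...   | tri> _ _ e<d = ⊥-elim (1≢0 (≡.trans (≡.sym (top mP)) (L.below d e<d)))
    where module L = Leading lead

  -- As P is monic, the top coefficient of g is also that of P g, in degree at least d. The bound n
  -- on g is lowered by one coefficient at a time.
  below-quotient : ∀ {P d} → Monic P d → ∀ n g → Below g n → Below (P * g) d → g ≋ 0#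
  below-quotient mP zero    g g<0 _ = Below-0 g<0
  below-quotient {P} {d} mP (suc e) g g<e Pg<d = below-quotient mP e g (λ i e≤i → cases i (ℕ.m≤n⇒m<n∨m≡n e≤i)) Pg<d
    where
    cases : ∀ i → e < i ⊎ e ≡ i → coeff g i ≡ 0ℤ
    cases i (inj₁ e<i)    = g<e i e<i
    cases i (inj₂ ≡.refl) = ≡.trans (≡.sym (≡.trans (coeff-*-top P g (below mP) g<e)
      (≡.trans (≡.cong (ℤ._* coeff g e) (top mP)) (ℤ.*-identityˡ _)))) (Pg<d (d ℕ.+ e) (ℕ.m≤m+n d e))

  -- A round that adds t to the quotient replaces g by g - t, so f = P g is an invariant. The
  -- leading terms of f and t P cancel, hence the normalized length of f drops and stays below the
  -- fuel.
  divMonicFuel-exact : ∀ {P d} → Monic P d → ∀ fuel f g → f ≋ P * g → length (normalize f) < fuel → divMonicFuel fuel f P ≋ g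
  divMonicFuel-exact {P} {d} mP (suc fuel) f g f≋Pg (s≤s len≤fuel)
    with length (normalize f) ℕ.<? length (normalize P)
  -- Here P g has smaller degree than P, so g = 0, in agreement with the empty quotient returned.
  ... | yes len<len = sym (below-quotient mP (length g) g (Below-length g) λ i d≤i →
          ≡.trans (≡.sym (coeffs (trans (proj₂ (normalForm f)) f≋Pg) i))
            (Below-length (normalize f) i (ℕ.≤-trans (ℕ.≤-pred (≡.subst (_ <_) (length-normalize-monic mP) len<len)) d≤i)))
  ... | no len≮len with size f
  ...   | zero-poly _ eq = ⊥-elim (len≮len (≡.subst₂ _<_ (≡.sym eq) (≡.sym (length-normalize-monic mP)) (s≤s z≤n)))
  ...   | nonzero-poly e a lead eq leading = begin
      monomial (leadCoeff f) s +ₚ divMonicFuel fuel (normalize (f -ₚ monomial (leadCoeff f) s *ₚ P)) P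
        ≈⟨ +-congˡ {monomial (leadCoeff f) s} (divMonicFuel-exact mP fuel _ (g - monomial (leadCoeff f) s) remainder≋ shorter) ⟩
      monomial (leadCoeff f) s +ₚ (g - monomial (leadCoeff f) s)
        ≈⟨ solve 2 (λ t g → t :+ (g :- t) := g) refl (monomial (leadCoeff f) s) g ⟩
      g ∎
    where
    module L = Leading lead
    s = length (normalize f) ∸ length (normalize P)
    t = monomial (leadCoeff f) s
    d≤e : d ≤ e
    d≤e = ℕ.≤-pred (≡.subst₂ _≤_ (length-normalize-monic mP) eq (ℕ.≮⇒≥ len≮len))
    s+d≡e : s ℕ.+ d ≡ e
    s+d≡e = ≡.trans (≡.cong (ℕ._+ d) (≡.cong₂ _∸_ eq (length-normalize-monic mP))) (ℕ.m∸n+n≡m d≤e)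
    remainder≋ : normalize (f -ₚ t *ₚ P) ≋ P * (g - t)
    remainder≋ = trans (proj₂ (normalForm (f - t * P))) (trans (+-congʳ { - (t * P)} f≋Pg)
      (solve 3 (λ P g t → P :* g :- t :* P := P :* (g :- t)) refl P g t))
    tP-below : Below (t * P) (suc e)
    tP-below = ≡.subst (λ e → Below (t * P) (suc e)) s+d≡e (Below-* t P (monomial-below (leadCoeff f) s) (below mP))
    tP-top : coeff (t * P) e ≡ a
    tP-top = ≡.trans (≡.cong (coeff (t * P)) (≡.sym s+d≡e)) (≡.trans (coeff-*-top t P (monomial-below (leadCoeff f) s) (below mP))
      (≡.trans (≡.cong₂ ℤ._*_ (≡.trans (monomial-top (leadCoeff f) s) leading) (top mP)) (ℤ.*-identityʳ a)))
    remainder-below : Below (normalize (f -ₚ t *ₚ P)) e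
    remainder-below i e≤i = ≡.trans (coeffs (proj₂ (normalForm (f - t * P))) i)
      (≡.trans (coeff-+ f _ i) (≡.trans (≡.cong (ℤ._+_ (coeff f i)) (coeff-neg (t * P) i)) (cases (ℕ.m≤n⇒m<n∨m≡n e≤i))))
      where
      cases : e < i ⊎ e ≡ i → coeff f i ℤ.- coeff (t * P) i ≡ 0ℤ
      cases (inj₁ e<i)    = ≡.cong₂ ℤ._-_ (L.below i e<i) (tP-below i e<i)
      cases (inj₂ ≡.refl) = ≡.trans (≡.cong₂ ℤ._-_ L.top tP-top) (ℤ.+-inverseʳ a)
    shorter : length (normalize (normalize (f -ₚ t *ₚ P))) < fuel
    shorter = ℕ.<-≤-trans (s≤s (length-normalize (normalize (f -ₚ t *ₚ P)) remainder-below)) (≡.subst (_≤ fuel) eq len≤fuel)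

  divMonic-exact : ∀ {P d} → Monic P d → ∀ {f g} → f ≋ P * g → divMonic f P ≋ g
  divMonic-exact mP {f} {g} f≋Pg = divMonicFuel-exact mP _ f g f≋Pg (s≤s (length-normalize f (Below-length f)))

  monic-quotient : ∀ {P d f n} → Monic P d → Monic f n → ∀ g → f ≋ P * g → ∃ (Monic g)
  monic-quotient {P} {d} {f} {n} mP mf g f≋Pg with size g
  ... | zero-poly g≋0 _ = ⊥-elim (1≢0 (≡.trans (≡.sym (top mf)) (coeffs (trans f≋Pg (trans (*-congˡ {P} g≋0) (zeroʳ P))) n)))
  ... | nonzero-poly e a lead _ _ = e , record { below = L.below ; top = ≡.trans L.top a≡1 }
    where
    module L = Leading lead
    f-below : Below f (suc (d ℕ.+ e))
    f-below i p = ≡.trans (coeffs f≋Pg i) (Below-* P g (below mP) L.below i p)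
    f-top : coeff f (d ℕ.+ e) ≡ a
    f-top = ≡.trans (coeffs f≋Pg _) (≡.trans (coeff-*-top P g (below mP) L.below) (≡.trans (≡.cong₂ ℤ._*_ (top mP) L.top) (ℤ.*-identityˡ a)))
    a≡1 : a ≡ 1ℤ
    a≡1 with ℕ.<-cmp n (d ℕ.+ e)
    ... | tri< n<d+e _ _    = ⊥-elim (L.nonzero (≡.trans (≡.sym f-top) (below mf _ n<d+e)))
    ... | tri≈ _ ≡.refl _   = ≡.trans (≡.sym f-top) (top mf)
    ... | tri> _ _ d+e<n    = ⊥-elim (1≢0 (≡.trans (≡.sym (top mf)) (f-below n d+e<n)))

  -- Powers of q, geometric sums and products of coprime factors

  opaque
    q : Poly
    q = qpow 1

    q*≋shift : ∀ f → q * f ≋ 0ℤ ∷ f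
    q*≋shift f = trans (shift-*ₚ 1ₚ f) (∷-cong ≡.refl (*ₚ-identityˡ f))

  qpow≋q^ : ∀ n → qpow n ≋ q ^ n
  qpow≋q^ zero    = refl
  qpow≋q^ (suc n) = trans (sym (q*≋shift (qpow n))) (*-congˡ {q} (qpow≋q^ n))

  monic-q^ : ∀ n → Monic (q ^ n) n
  monic-q^ n = monic-resp (qpow≋q^ n) (monic-qpow n)

  monic-+ : ∀ {f d} g → Monic f d → Below g d → Monic (f + g) d
  monic-+ {f} {d} g mf g<d = record
    { below = λ i d<i → ≡.trans (coeff-+ f g i) (≡.cong₂ ℤ._+_ (Monic.below mf i d<i) (g<d i (ℕ.<⇒≤ d<i)))
    ; top = ≡.trans (coeff-+ f g d) (≡.cong₂ ℤ._+_ (Monic.top mf) (g<d d ℕ.≤-refl)) }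

  monic-q^-1 : ∀ n → Monic (q ^ suc n - 1#) (suc n)
  monic-q^-1 n = monic-+ (- 1#) (monic-q^ (suc n)) λ { (suc i) _ → ≡.refl }

  monic-∏ : ∀ n f → (∀ i → i < n → ∃ (Monic (f i))) → ∃ (Monic (∏ n f))
  monic-∏ zero    f mf = 0 , monic-1
  monic-∏ (suc n) f mf = _ , monic-* (proj₂ (monic-∏ n f λ i i<n → mf i (ℕ.m<n⇒m<1+n i<n))) (proj₂ (mf n ℕ.≤-refl))

  q^m-1∣q^km-1 : ∀ m k → q ^ m - 1# ∣ q ^ (k ℕ.* m) - 1#
  q^m-1∣q^km-1 m zero = 0# , trans (zeroˡ (q ^ m - 1#)) (sym (-‿inverseʳ 1#))
  q^m-1∣q^km-1 m (suc k) = ∣ʳ-respʳ-≈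
    (trans (solve 2 (λ a b → b :* (a :- 𝟙) :+ 𝟙 :* (b :- 𝟙) := a :* b :- 𝟙) refl (q ^ m) (q ^ (k ℕ.* m))) (+-congʳ { - 1#} (sym (^-homo-* q m (k ℕ.* m)))))
    (∣-sum (q ^ m - 1#) (∣-multiple (q ^ m - 1#) (q ^ (k ℕ.* m)) ∣-refl) (∣-multiple (q ^ m - 1#) 1# (q^m-1∣q^km-1 m k)))

  -- Each power of x is 1 modulo x - 1, so m of them add up to the integer m. Integers are what
  -- Gauss' lemma can cancel modulo a monic polynomial.
  geometric : ∀ x m → ∃ λ y → ∑ m (x ^_) ≋ const (+ m) + (x - 1#) * y
  geometric x zero = 0# , sym (trans (+-congˡ {const 0ℤ} (zeroʳ (x - 1#))) (trans (+-identityʳ (const 0ℤ)) const-0))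
  geometric x (suc m) with geometric x m | powers m
    where
    powers : ∀ m → ∃ λ y → x ^ m ≋ 1# + (x - 1#) * y
    powers zero = 0# , sym (trans (+-congˡ {1#} (zeroʳ (x - 1#))) (+-identityʳ 1#))
    powers (suc m) with powers m
    ... | y , eq = 1# + x * y , trans (*-congˡ {x} eq) (solve 2 (λ x y → x :* (𝟙 :+ (x :- 𝟙) :* y) := 𝟙 :+ (x :- 𝟙) :* (𝟙 :+ x :* y)) refl x y)
  ... | y , eq | z , eq′ = y + z , (begin
    ∑ m (x ^_) + x ^ m                                         ≈⟨ +-cong eq eq′ ⟩
    const (+ m) + (x - 1#) * y + (1# + (x - 1#) * z)           ≈⟨ solve 4 (λ c u y z → c :+ u :* y :+ (𝟙 :+ u :* z) := 𝟙 :+ c :+ u :* (y :+ z)) refl (const (+ m)) (x - 1#) y z ⟩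
    1# + const (+ m) + (x - 1#) * (y + z)                      ∎)

  geometric-sum : ∀ x m → (x - 1#) * ∑ m (x ^_) ≋ x ^ m - 1#
  geometric-sum x zero = trans (zeroʳ (x - 1#)) (sym (-‿inverseʳ 1#))
  geometric-sum x (suc m) = begin
    (x - 1#) * (∑ m (x ^_) + x ^ m)              ≈⟨ distribˡ (x - 1#) (∑ m (x ^_)) (x ^ m) ⟩
    (x - 1#) * ∑ m (x ^_) + (x - 1#) * x ^ m     ≈⟨ +-congʳ {(x - 1#) * x ^ m} (geometric-sum x m) ⟩
    x ^ m - 1# + (x - 1#) * x ^ m                ≈⟨ solve 2 (λ x y → y :- 𝟙 :+ (x :- 𝟙) :* y := x :* y :- 𝟙) refl x (x ^ m) ⟩
    x * x ^ m - 1#                               ∎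

  -- First P divides f, say f = f′ P; after P is cancelled, Q divides u f′ and so f′. This lifts
  -- regularity from Φ to Φ³.
  regular-mod-* : ∀ {P Q u} → (∀ {f g} → P * f ≋ P * g → f ≋ g) → Regular P u → Regular Q u → Regular (P * Q) u
  regular-mod-* {P} {Q} {u} cancel reg-P reg-Q f (h , hPQ≋uf) = step₁ (reg-P f P∣uf)
    where
    P∣uf : P ∣ u * f
    P∣uf = h * Q , trans (solve 3 (λ h P Q → h :* Q :* P := h :* (P :* Q)) refl h P Q) hPQ≋uf
    step₂ : ∀ f′ → f′ * P ≋ f → Q ∣ f′ → P * Q ∣ f
    step₂ f′ f′P≋f (k , kQ≋f′) = k , (begin
      k * (P * Q)    ≈⟨ solve 3 (λ h P Q → h :* (P :* Q) := h :* Q :* P) refl k P Q ⟩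
      k * Q * P      ≈⟨ *-congʳ {P} kQ≋f′ ⟩
      f′ * P         ≈⟨ f′P≋f ⟩
      f              ∎)
    step₁ : P ∣ f → P * Q ∣ f
    step₁ (f′ , f′P≋f) = step₂ f′ f′P≋f (reg-Q f′ (h , cancel (begin
      P * (h * Q)       ≈⟨ solve 3 (λ h P Q → P :* (h :* Q) := h :* (P :* Q)) refl h P Q ⟩
      h * (P * Q)       ≈⟨ hPQ≋uf ⟩
      u * f             ≈⟨ *-congˡ {u} f′P≋f ⟨
      u * (f′ * P)      ≈⟨ solve 3 (λ u f P → u :* (f :* P) := P :* (u :* f)) refl u f′ P ⟩
      P * (u * f′)      ∎)))

  -- With X = f A, B divides A f, and regularity of A modulo B yields B ∣ f. Here regularity takes
  -- the place of a Bézout identity.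
  coprime-product-divides : ∀ {A B X} → Regular B A → A ∣ X → B ∣ X → A * B ∣ X
  coprime-product-divides {A} {B} {X} reg (f , fA≋X) B∣X with reg f (∣ʳ-respʳ-≈ (trans (sym fA≋X) (*-comm f A)) B∣X)
  ... | g , gB≋f = g , trans (solve 3 (λ g A B → g :* (A :* B) := g :* B :* A) refl g A B) (trans (*-congʳ {A} gB≋f) fA≋X)

  regular-∏ : ∀ {P} n f → (∀ i → i < n → Regular P (f i)) → Regular P (∏ n f)
  regular-∏ {P} zero    f reg = regular-1 P
  regular-∏ {P} (suc n) f reg = regular-* P {∏ n f} {f n} (regular-∏ n f λ i i<n → reg i (ℕ.m<n⇒m<1+n i<n)) (reg n ℕ.≤-refl)

  ∏-divides : ∀ {X} n f → (∀ i → i < n → f i ∣ X) → (∀ i j → i < j → j < n → Regular (f j) (f i)) → ∏ n f ∣ X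
  ∏-divides {X} zero    f _   _   = X , *-identityʳ X
  ∏-divides {X} (suc n) f div reg = coprime-product-divides
    (regular-∏ n f λ i i<n → reg i n i<n ℕ.≤-refl)
    (∏-divides n f (λ i i<n → div i (ℕ.m<n⇒m<1+n i<n)) (λ i j i<j j<n → reg i j i<j (ℕ.m<n⇒m<1+n j<n)))
    (div n ℕ.≤-refl)

  ∏-∣-∏ : ∀ n f g → (∀ i → i < n → f i ∣ g i) → ∏ n f ∣ ∏ n g
  ∏-∣-∏ zero    f g _   = ∣-refl
  ∏-∣-∏ (suc n) f g div with ∏-∣-∏ n f g (λ i i<n → div i (ℕ.m<n⇒m<1+n i<n)) | div n ℕ.≤-refl
  ... | a , eq | b , eq′ = a * b , trans (solve 4 (λ a b x y → a :* b :* (x :* y) := a :* x :* (b :* y)) refl a b (∏ n f) (f n)) (*-cong eq eq′)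

  -- Cyclotomic polynomials: product formula and coprimality

  pick : ℕ → ℕ → Poly → Poly
  pick n d f = if does (d ℕ.∣? n) then f else 1ₚ

  -- The local function of prodDivs cannot be named; unification recovers it from one unfolding.
  mutual
    prodDivsFrom : ℕ → List Poly → ℕ → List Poly → Poly
    prodDivsFrom = _

    prodDivs-∷ : ∀ N f fs → prodDivs N (f ∷ fs) ≡ pick N 1 f * prodDivsFrom N (f ∷ fs) 2 fs
    prodDivs-∷ N f fs with f ∷ fs | 2
    ... | _ | _ = ≡.refl

  prodDivsFrom-∏ : ∀ N t d n f → prodDivsFrom N t d (applyUpTo f n) ≋ ∏ n (λ i → pick N (d ℕ.+ i) (f i))
  prodDivsFrom-∏ N t d zero    f = refl
  prodDivsFrom-∏ N t d (suc n) f = begin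
    pick N d (f 0) * prodDivsFrom N t (suc d) (applyUpTo (f ∘ suc) n)
      ≈⟨ *-congˡ {pick N d (f 0)} (prodDivsFrom-∏ N t (suc d) n (f ∘ suc)) ⟩
    pick N d (f 0) * ∏ n (λ i → pick N (suc d ℕ.+ i) (f (suc i)))
      ≈⟨ *-cong (reflexive (≡.cong (λ k → pick N k (f 0)) (ℕ.+-identityʳ d)))
                (∏-cong n λ i _ → reflexive (≡.cong (λ k → pick N k (f (suc i))) (ℕ.+-suc d i))) ⟨
    pick N (d ℕ.+ 0) (f 0) * ∏ n (λ i → pick N (d ℕ.+ suc i) (f (suc i)))
      ≈⟨ ∏-front n (λ i → pick N (d ℕ.+ i) (f i)) ⟨
    ∏ (suc n) (λ i → pick N (d ℕ.+ i) (f i)) ∎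

  cyclo-suc : ∀ n → cyclo (suc n) ≡ divMonic (qpow (suc n) -ₚ 1ₚ) (prodDivs (suc n) (cycTable n))
  cyclo-suc n rewrite List.reverse-++ (cycTable n) (divMonic (qpow (suc n) -ₚ 1ₚ) (prodDivs (suc n) (cycTable n)) ∷ []) = ≡.refl

  cycTable≡ : ∀ n → cycTable n ≡ applyUpTo (cyclo ∘ suc) n
  cycTable≡ zero    = ≡.refl
  cycTable≡ (suc n) = ≡.trans (≡.cong₂ _∷ʳ_ (cycTable≡ n) (≡.sym (cyclo-suc n))) (List.applyUpTo-∷ʳ (cyclo ∘ suc) n)

  opaque
    Φ : ℕ → Poly
    Φ = cyclo

    Φ≡cyclo : ∀ n → Φ n ≡ cyclo n
    Φ≡cyclo n = ≡.refl

    -- The factor of index i belongs to the divisor i + 1.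
    factor : ℕ → ℕ → Poly
    factor n i = pick n (suc i) (Φ (suc i))

    prodDivs-∏ : ∀ n m → prodDivs n (cycTable m) ≋ ∏ m (factor n)
    prodDivs-∏ n m = trans (reflexive (≡.cong (prodDivs n) (cycTable≡ m))) (prodDivsFrom-∏ n (applyUpTo (cyclo ∘ suc) m) 1 m (cyclo ∘ suc))

    factor-cases : ∀ {ℓ} (C : Poly → Set ℓ) n i → (suc i ℕ.∣ n → C (Φ (suc i))) → (¬ suc i ℕ.∣ n → C 1ₚ) → C (factor n i)
    factor-cases C n i = cases (suc i ℕ.∣? n)
      where
      cases : ∀ {a} {A : Set a} (A? : Dec A) → (A → C (Φ (suc i))) → (¬ A → C 1ₚ) → C (if does A? then Φ (suc i) else 1ₚ)
      cases (yes a) c _ = c a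
      cases (no ¬a) _ c = c ¬a

  factor-divisor : ∀ n i → suc i ℕ.∣ n → factor n i ≡ Φ (suc i)
  factor-divisor n i d∣n = factor-cases (_≡ Φ (suc i)) n i (λ _ → ≡.refl) (λ d∤n → ⊥-elim (d∤n d∣n))

  -- The statement for the index n = m + 1; the factors with i < m belong to the proper divisors of
  -- n. Monicity is carried along because the division for larger indices is by a product of these
  -- polynomials.
  record Cyclotomic (m : ℕ) : Set where
    field
      monic   : ∃ (Monic (Φ (suc m)))
      product : ∏ m (factor (suc m)) * Φ (suc m) ≋ q ^ suc m - 1#

    full-product : ∏ (suc m) (factor (suc m)) ≋ q ^ suc m - 1#
    full-product = trans (*-congˡ {∏ m (factor (suc m))} (reflexive (factor-divisor (suc m) m ℕ.∣-refl))) product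

    divides-q^n-1 : Φ (suc m) ∣ q ^ suc m - 1#
    divides-q^n-1 = ∏ m (factor (suc m)) , product

  module _ (m : ℕ) (smaller : ∀ {i} → i < m → Cyclotomic i) (cyc : Cyclotomic m) where
    private
      n = suc m
      Φₙ = Φ n
      module C = Cyclotomic cyc

    -- The product formula for g writes q^g - 1 as the product of Φ_d over d ∣ g. Each such d is a
    -- proper divisor of n, so its factor occurs again among the first g factors for n.
    q^g-1∣proper : ∀ i → i < m → suc i ℕ.∣ n → q ^ suc i - 1# ∣ ∏ m (factor n)
    q^g-1∣proper i i<m g∣n = ∣-trans
      (∣ʳ-respˡ-≈ (Cyclotomic.full-product (smaller i<m)) (∏-∣-∏ (suc i) (factor (suc i)) (factor n) factor∣factor))
      (∣ʳ-respʳ-≈ (≡.subst (λ k → ∏ (m ∸ suc i) (λ j → factor n (j ℕ.+ suc i)) * ∏ (suc i) (factor n) ≋ ∏ k (factor n)) (ℕ.m∸n+n≡m i<m)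
          (trans (*-comm (∏ (m ∸ suc i) (λ j → factor n (j ℕ.+ suc i))) (∏ (suc i) (factor n))) (sym (∏-split (suc i) (m ∸ suc i) (factor n)))))
        (∏ (m ∸ suc i) (λ j → factor n (j ℕ.+ suc i)) , refl))
      where
      factor∣factor : ∀ j → j < suc i → factor (suc i) j ∣ factor n j
      factor∣factor j _ = factor-cases (_∣ factor n j) (suc i) j
        (λ d∣g → 1# , trans (*-identityˡ (Φ (suc j))) (reflexive (≡.sym (factor-divisor n j (ℕ.∣-trans d∣g g∣n)))))
        (λ _ → factor n j , *-identityʳ (factor n j))

    -- For a proper divisor g of n, Φₙ divides (q ^ n - 1) / (q ^ g - 1), which is n / g modulo q ^ g - 1.
    q^g-1-regular : ∀ i → i < m → suc i ℕ.∣ n → Regular Φₙ (q ^ suc i - 1#)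
    q^g-1-regular i i<m (divides zero ())
    q^g-1-regular i i<m g∣n@(divides k@(suc k′) n≡kg) f Φ∣[q^g-1]f = conclude (q^g-1∣proper i i<m g∣n) (geometric (q ^ suc i) k)
      where
      x = q ^ suc i
      G = ∑ k (x ^_)
      wΦ≋G : ∀ w → w * (x - 1#) ≋ ∏ m (factor n) → w * Φₙ ≋ G
      wΦ≋G w w[q^g-1]≋Π = monic-cancelˡ (monic-q^-1 i) (begin
        (x - 1#) * (w * Φₙ)         ≈⟨ solve 3 (λ u w Φ → u :* (w :* Φ) := w :* u :* Φ) refl (x - 1#) w Φₙ ⟩
        w * (x - 1#) * Φₙ           ≈⟨ *-congʳ {Φₙ} w[q^g-1]≋Π ⟩
        ∏ m (factor n) * Φₙ         ≈⟨ C.product ⟩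
        q ^ n - 1#                  ≡⟨ ≡.cong (λ l → q ^ l - 1#) (≡.trans n≡kg (ℕ.*-comm k (suc i))) ⟩
        q ^ (suc i ℕ.* k) - 1#      ≈⟨ +-congʳ { - 1#} (^-assocʳ q (suc i) k) ⟨
        x ^ k - 1#                  ≈⟨ geometric-sum x k ⟨
        (x - 1#) * G                ∎)
      conclude : q ^ suc i - 1# ∣ ∏ m (factor n) → (∃ λ y → G ≋ const (+ k) + (x - 1#) * y) → Φₙ ∣ f
      conclude (w , w[q^g-1]≋Π) (y , G≋k+[q^g-1]y) = const-regular (proj₂ C.monic) (+ k) (λ ()) f (∣ʳ-respʳ-≈ (begin
          f * w * Φₙ + - y * ((x - 1#) * f)
            ≈⟨ solve 5 (λ f w Φ y u → f :* w :* Φ :+ :- y :* (u :* f) := (w :* Φ :- u :* y) :* f) refl f w Φₙ y (x - 1#) ⟩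
          (w * Φₙ - (x - 1#) * y) * f
            ≈⟨ *-congʳ {f} (+-congʳ { - ((x - 1#) * y)} (trans (wΦ≋G w w[q^g-1]≋Π) G≋k+[q^g-1]y)) ⟩
          (const (+ k) + (x - 1#) * y - (x - 1#) * y) * f
            ≈⟨ *-congʳ {f} (solve 2 (λ a b → a :+ b :- b := a) refl (const (+ k)) ((x - 1#) * y)) ⟩
          const (+ k) * f ∎)
        (∣-sum Φₙ (f * w , refl) (∣-multiple Φₙ (- y) Φ∣[q^g-1]f)))

    Φ∣q^kn-1 : ∀ k → Φₙ ∣ q ^ (k ℕ.* n) - 1#
    Φ∣q^kn-1 k = ∣-trans C.divides-q^n-1 (q^m-1∣q^km-1 n k)

    -- Euclid's algorithm in the exponents: for fixed f, the e with Φₙ ∣ (q^e - 1) f include the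
    -- multiples of n and of j and are closed under differences, so they include the gcd of n and j.
    -- As n does not divide j, this is a proper divisor of n, where `q^g-1-regular` applies.
    q^j-1-regular : ∀ j → ¬ n ℕ.∣ j → Regular Φₙ (q ^ j - 1#)
    q^j-1-regular j n∤j f Φ∣[q^j-1]f = by-gcd (gcd n j) ≡.refl
      where
      Kills : ℕ → Set
      Kills e = Φₙ ∣ (q ^ e - 1#) * f

      kills-j* : ∀ y → Kills (y ℕ.* j)
      kills-j* y with q^m-1∣q^km-1 j y
      ... | w , eq = ∣ʳ-respʳ-≈ (trans (sym (*-assoc w (q ^ j - 1#) f)) (*-congʳ {f} eq)) (∣-multiple Φₙ w Φ∣[q^j-1]f)

      kills-n* : ∀ x → Kills (x ℕ.* n)
      kills-n* x = ∣ʳ-respʳ-≈ (*-comm f (q ^ (x ℕ.* n) - 1#)) (∣-multiple Φₙ f (Φ∣q^kn-1 x))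

      difference : ∀ g u v → g ℕ.+ u ≡ v → Kills u → Kills v → Kills g
      difference g u .(g ℕ.+ u) ≡.refl ku kv = ∣ʳ-respʳ-≈ (begin
          (q ^ (g ℕ.+ u) - 1#) * f + - (q ^ g) * ((q ^ u - 1#) * f)
            ≈⟨ +-congʳ { - (q ^ g) * ((q ^ u - 1#) * f)} (*-congʳ {f} (+-congʳ { - 1#} (^-homo-* q g u))) ⟩
          (q ^ g * q ^ u - 1#) * f + - (q ^ g) * ((q ^ u - 1#) * f)
            ≈⟨ solve 3 (λ a b f → (a :* b :- 𝟙) :* f :+ :- a :* ((b :- 𝟙) :* f) := (a :- 𝟙) :* f) refl (q ^ g) (q ^ u) f ⟩
          (q ^ g - 1#) * f ∎)
        (∣-sum Φₙ kv (∣-multiple Φₙ (- (q ^ g)) ku))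

      kills-gcd : Kills (gcd n j)
      kills-gcd with Bézout.identity (ℕ.gcd-GCD n j)
      ... | Bézout.+- x y eq = difference (gcd n j) (y ℕ.* j) (x ℕ.* n) eq (kills-j* y) (kills-n* x)
      ... | Bézout.-+ x y eq = difference (gcd n j) (x ℕ.* n) (y ℕ.* j) eq (kills-n* x) (kills-j* y)

      by-gcd : ∀ g → gcd n j ≡ g → Φₙ ∣ f
      by-gcd zero    eq with ℕ.gcd[m,n]∣m n j
      ... | d rewrite eq with ℕ.0∣⇒≡0 d
      ...   | ()
      by-gcd (suc i) eq = q^g-1-regular i i<m g∣n f (≡.subst Kills eq kills-gcd)
        where
        g∣n : suc i ℕ.∣ n
        g∣n = ≡.subst (ℕ._∣ n) eq (ℕ.gcd[m,n]∣m n j)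
        i<m : i < m
        i<m = ℕ.≤∧≢⇒< (ℕ.≤-pred (ℕ.∣⇒≤ g∣n)) λ i≡m → n∤j
          (≡.subst (ℕ._∣ j) (≡.trans eq (≡.cong suc i≡m)) (ℕ.gcd[m,n]∣n n j))

    Φ-regular : ∀ i → i < m → Regular Φₙ (Φ (suc i))
    Φ-regular i i<m = regular-factor Φₙ (Cyclotomic.divides-q^n-1 (smaller i<m))
      (q^j-1-regular (suc i) λ n∣1+i → ℕ.<⇒≱ (s≤s i<m) (ℕ.∣⇒≤ n∣1+i))

  factor∣q^n-1 : ∀ n i → Cyclotomic i → factor n i ∣ q ^ n - 1#
  factor∣q^n-1 n i cyc = factor-cases (_∣ q ^ n - 1#) n i
    (λ { (divides k ≡.refl) → ∣-trans (Cyclotomic.divides-q^n-1 cyc) (q^m-1∣q^km-1 (suc i) k) })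
    (λ _ → q ^ n - 1# , *-identityʳ (q ^ n - 1#))

  factor-regular : ∀ {P} n i → Regular P (Φ (suc i)) → Regular P (factor n i)
  factor-regular {P} n i reg = factor-cases (Regular P) n i (λ _ → reg) (λ _ → regular-1 P)

  factors-regular : ∀ n i j → (∀ {k} → k < suc j → Cyclotomic k) → i < j → Regular (factor n j) (factor n i)
  factors-regular n i j cyc i<j = factor-cases (λ P → Regular P (factor n i)) n j
    (λ _ → factor-regular n i (Φ-regular j (λ k<j → cyc (ℕ.m<n⇒m<1+n k<j)) (cyc ℕ.≤-refl) i i<j))
    (λ _ f _ → f , *-identityʳ f)

  factor-monic : ∀ n i → Cyclotomic i → ∃ (Monic (factor n i))
  factor-monic n i cyc = factor-cases (λ P → ∃ (Monic P)) n i (λ _ → Cyclotomic.monic cyc) (λ _ → 0 , monic-1)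

  -- The output of `divMonic` is the quotient once the division is known to be exact. The earlier
  -- factors divide q^n - 1 one by one and are pairwise regular, so their product divides it.
  cyclotomic : ∀ m → Cyclotomic m
  cyclotomic = <-rec Cyclotomic step
    where
    step : ∀ m → (∀ {i} → i < m → Cyclotomic i) → Cyclotomic m
    step m smaller with ∏-divides m (factor (suc m)) (λ i i<m → factor∣q^n-1 (suc m) i (smaller i<m))
                          (λ i j i<j j<m → factors-regular (suc m) i j (λ k≤j → smaller (ℕ.<-≤-trans k≤j j<m)) i<j)
    ... | c , cΠ≋q^n-1 = record
      { monic   = monic-quotient (proj₂ monic-Π) (monic-q^-1 m) (Φ (suc m)) (sym Π*Φ≋q^n-1)
      ; product = Π*Φ≋q^n-1 }
      where
      Π = ∏ m (factor (suc m))
      monic-Π : ∃ (Monic Π)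
      monic-Π = monic-∏ m (factor (suc m)) (λ i i<m → factor-monic (suc m) i (smaller i<m))
      prodDivs≋Π = prodDivs-∏ (suc m) m
      Φ≋c : Φ (suc m) ≋ c
      Φ≋c = trans (reflexive (≡.trans (Φ≡cyclo (suc m)) (cyclo-suc m))) (divMonic-exact (monic-resp (sym prodDivs≋Π) (proj₂ monic-Π)) (begin
        qpow (suc m) - 1#                           ≈⟨ +-congʳ { - 1#} (qpow≋q^ (suc m)) ⟩
        q ^ suc m - 1#                              ≈⟨ cΠ≋q^n-1 ⟨
        c * Π                                       ≈⟨ *-comm c Π ⟩
        Π * c                                       ≈⟨ *-congʳ {c} prodDivs≋Π ⟨
        prodDivs (suc m) (cycTable m) * c           ∎))
      Π*Φ≋q^n-1 : Π * Φ (suc m) ≋ q ^ suc m - 1#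
      Π*Φ≋q^n-1 = trans (*-congˡ {Π} Φ≋c) (trans (*-comm Π c) cΠ≋q^n-1)

  -- The recurrence of τ with regular denominators

  open QBinomial ℤ[q] q

  monic-regular-0 : ∀ {f d} → Monic f d → Regular 0# f
  monic-regular-0 mf g (h , h0≋fg) = 0# , trans (zeroʳ 0#) (sym (monic-cancel-0 mf g (trans (sym h0≋fg) (zeroʳ h))))

  regular-0-cancel : ∀ {u} → Regular 0# u → ∀ {f g} → u * f ≋ u * g → f ≋ g
  regular-0-cancel {u} reg = cancel-by-0 u inj
    where
    inj : ∀ f → u * f ≋ 0# → f ≋ 0#
    inj f uf≋0 with reg f (0# , trans (zeroʳ 0#) (sym uf≋0))
    ... | h , h0≋f = trans (sym h0≋f) (zeroʳ h)

  negate-regular : ∀ {P f} → Regular P (f - 1#) → Regular P (1# - f)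
  negate-regular {P} {f} = regular-factor P {1# - f} (- 1# , solve 1 (λ f → :- 𝟙 :* (𝟙 :- f) := f :- 𝟙) refl f)

  1-p^k≋1-q^2k : ∀ k → 1# - q ^ (2 ℕ.* k) ≋ 1# - p ^ k
  1-p^k≋1-q^2k k = +-congˡ {1#} (-‿cong (trans (sym (^-assocʳ q 2 k)) (^-congˡ k (*-congˡ {q} (*-identityʳ q)))))

  p^k≋q^2k : ∀ k → p ^ k ≋ q ^ (2 ℕ.* k)
  p^k≋q^2k k = trans (^-congˡ k (*-congˡ {q} (sym (*-identityʳ q)))) (^-assocʳ q 2 k)

  even-poch-regular-0 : ∀ k → Regular 0# (even-poch k)
  even-poch-regular-0 k = regular-∏ k (λ i → 1# - p ^ suc i) λ i _ →
    regular-resp 0# (1-p^k≋1-q^2k (suc i)) (negate-regular {0#} {q ^ (2 ℕ.* suc i)} (monic-regular-0 (monic-q^-1 (i ℕ.+ 1 ℕ.* suc i))))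

  central : ℕ → Poly
  central k = binomial k k

  central-even : ∀ k → central k * even-poch k ≋ odd-poch k * (plus-poch k * plus-poch k)
  central-even k = regular-0-cancel {even-poch k} (even-poch-regular-0 k) (central-binomial k)

  -- The recurrence of τ after multiplication by the squares of (-q;q). The factor `even-poch k`,
  -- which may be divisible by Φ_d, is cancelled already in ℤ[q], so the recurrence is available
  -- modulo every P.
  central-suc : ∀ k → central (suc k) * (1# - p ^ suc k) * (plus-poch k * plus-poch k)
                      ≋ central k * (1# - q * p ^ k) * (plus-poch (suc k) * plus-poch (suc k))
  central-suc k = regular-0-cancel {even-poch k} (even-poch-regular-0 k) (begin
    E * (central (suc k) * u * (S * S))
      ≈⟨ solve 4 (λ E c u S → E :* (c :* u :* (S :* S)) := c :* (E :* u) :* (S :* S)) refl E (central (suc k)) u S ⟩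
    central (suc k) * even-poch (suc k) * (S * S)
      ≈⟨ *-congʳ {S * S} (central-even (suc k)) ⟩
    O * a * (S′ * S′) * (S * S)
      ≈⟨ solve 4 (λ O a S′ S → O :* a :* (S′ :* S′) :* (S :* S) := O :* (S :* S) :* (a :* (S′ :* S′))) refl O a S′ S ⟩
    O * (S * S) * (a * (S′ * S′))
      ≈⟨ *-congʳ {a * (S′ * S′)} (central-even k) ⟨
    central k * E * (a * (S′ * S′))
      ≈⟨ solve 4 (λ c E a S′ → c :* E :* (a :* (S′ :* S′)) := E :* (c :* a :* (S′ :* S′))) refl (central k) E a S′ ⟩
    E * (central k * a * (S′ * S′)) ∎)
    where
    E = even-poch k ; O = odd-poch k ; S = plus-poch k ; S′ = plus-poch (suc k)
    u = 1# - p ^ suc k ; a = 1# - q * p ^ k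

  qint-suc : ∀ m → qint (suc m) ≋ 1# + q * qint m
  qint-suc m = trans (coeffwise λ { zero → ≡.refl ; (suc i) → ≡.refl }) (+-congˡ {1#} (sym (q*≋shift (qint m))))

  qint[1-q] : ∀ m → qint m * (1# - q) ≋ 1# - q ^ m
  qint[1-q] zero = sym (-‿inverseʳ 1#)
  qint[1-q] (suc m) = begin
    qint (suc m) * (1# - q)                ≈⟨ *-congʳ {1# - q} (qint-suc m) ⟩
    (1# + q * qint m) * (1# - q)           ≈⟨ solve 2 (λ q X → (𝟙 :+ q :* X) :* (𝟙 :- q) := 𝟙 :- q :+ q :* (X :* (𝟙 :- q))) refl q (qint m) ⟩
    1# - q + q * (qint m * (1# - q))       ≈⟨ +-congˡ {1# - q} (*-congˡ {q} (qint[1-q] m)) ⟩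
    1# - q + q * (1# - q ^ m)              ≈⟨ solve 2 (λ q X → 𝟙 :- q :+ q :* (𝟙 :- X) := 𝟙 :- q :* X) refl q (q ^ m) ⟩
    1# - q * q ^ m                         ∎

  ^ₚ≡^ : ∀ f k → f ^ₚ k ≡ f ^ k
  ^ₚ≡^ f zero    = ≡.refl
  ^ₚ≡^ f (suc k) = ≡.cong (f *ₚ_) (^ₚ≡^ f k)

  qpoch-odd : ∀ k → qpoch 1 2 k ≋ odd-poch k
  qpoch-odd zero    = refl
  qpoch-odd (suc k) = *-cong (qpoch-odd k) (+-congˡ {1#} (-‿cong
    (trans (qpow≋q^ (1 ℕ.+ 2 ℕ.* k)) (*-congˡ {q} (sym (p^k≋q^2k k))))))

  qpoch-even : ∀ k → qpoch 2 2 k ≋ even-poch k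
  qpoch-even zero    = refl
  qpoch-even (suc k) = *-cong (qpoch-even k) (+-congˡ {1#} (-‿cong
    (trans (qpow≋q^ (2 ℕ.+ 2 ℕ.* k)) (trans (reflexive (≡.cong (q ^_) (≡.sym (ℕ.*-suc 2 k)))) (sym (p^k≋q^2k (suc k)))))))

  regular-^ : ∀ {P} u → Regular P u → ∀ k → Regular P (u ^ k)
  regular-^ {P} u reg zero    = regular-1 P
  regular-^ {P} u reg (suc k) = regular-* P {u} {u ^ k} reg (regular-^ u reg k)

  -- The summands of both sides, with (q;q²)ₖ / (q²;q²)ₖ written as [2k choose k] / (-q;q)ₖ²: unlike the former,
  -- these denominators are regular modulo every cyclotomic polynomial of odd index.
  reduced reduced′ : ℕ → Frac
  reduced  k = qint (4 ℕ.* k ℕ.+ 1) * central k ^ 6 * q ^ k , (plus-poch k * plus-poch k) ^ 6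
  reduced′ k = central k ^ 4 * p ^ k , (plus-poch k * plus-poch k) ^ 4

  -- From pairs of polynomials to classes in the localization

  module Represent (P : Poly) where
    open Localization ℤ[q] P public
      using (commutativeRing; fraction; fraction-cong; fraction-injective; fraction-+; fraction-*; fraction-neg; fraction-0; fraction-1; ∣-equal)
    module L = CommutativeRing commutativeRing
    open import Algebra.Properties.Semiring.Exp L.semiring public using () renaming (_^_ to _^ᴸ_; ^-congˡ to ^ᴸ-congˡ)
    open import Algebra.Properties.Ring L.ring using (-1*x≈-x)
    module LX = RingExtra commutativeRing

    ι : Poly → L.Carrier
    ι f = fraction f 1# (regular-1 P)

    fraction-≈ : ∀ {a b r c d s} → a * d ≋ c * b → fraction a b r L.≈ fraction c d s
    fraction-≈ eq = fraction-cong (∣-equal eq)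

    ι-cong : ∀ {f g} → f ≋ g → ι f L.≈ ι g
    ι-cong f≋g = fraction-≈ (*-congʳ {1#} f≋g)

    ι-* : ∀ f g → ι f L.* ι g L.≈ ι (f * g)
    ι-* f g = L.trans (fraction-* f 1# (regular-1 P) g 1# (regular-1 P))
      (fraction-≈ (solve 1 (λ a → a :* 𝟙 := a :* (𝟙 :* 𝟙)) refl (f * g)))

    ι-minus : ∀ f g → ι f L.- ι g L.≈ ι (f - g)
    ι-minus f g = L.trans (L.+-congˡ (fraction-neg g 1# (regular-1 P)))
      (L.trans (fraction-+ f 1# (regular-1 P) (- g) 1# (regular-1 P))
        (fraction-≈ (solve 2 (λ f g → (f :* 𝟙 :+ :- g :* 𝟙) :* 𝟙 := (f :- g) :* (𝟙 :* 𝟙)) refl f g)))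

    ι-^ : ∀ f k → ι f ^ᴸ k L.≈ ι (f ^ k)
    ι-^ f zero    = L.sym fraction-1
    ι-^ f (suc k) = L.trans (L.*-congˡ (ι-^ f k)) (ι-* f (f ^ k))

    fraction-^ : ∀ a b r k → fraction a b r ^ᴸ k L.≈ fraction (a ^ k) (b ^ k) (regular-^ b r k)
    fraction-^ a b r zero    = L.sym fraction-1
    fraction-^ a b r (suc k) = L.trans (L.*-congˡ (fraction-^ a b r k)) (fraction-* a b r (a ^ k) (b ^ k) (regular-^ b r k))

    ι-unit : ∀ {f} → Regular P f → LX.Unit (ι f)
    ι-unit {f} reg = fraction 1# f reg , L.trans (fraction-* f 1# (regular-1 P) 1# f reg)
      (L.trans (fraction-≈ (solve 1 (λ f → f :* 𝟙 :* 𝟙 := 𝟙 :* (𝟙 :* f)) refl f)) fraction-1)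

    ι-≈0 : ∀ {f} → P ∣ f → ι f L.≈ L.0#
    ι-≈0 {f} P∣f = L.trans (fraction-cong (∣ʳ-respʳ-≈ (solve 1 (λ f → f := f :* 𝟙 :- con (+ 0) :* 𝟙) refl f) P∣f)) fraction-0

    -- A ⇝ x: the fraction A has a denominator regular modulo P, and x is its class.
    infix 4 _⇝_
    _⇝_ : Frac → L.Carrier → Set
    (a , b) ⇝ x = Σ (Regular P b) λ reg → fraction a b reg L.≈ x

    ⇝-+ : ∀ {A B x y} → A ⇝ x → B ⇝ y → A +f B ⇝ x L.+ y
    ⇝-+ {a , b} {c , d} (r , A≈x) (s , B≈y) = regular-* P {b} {d} r s , L.trans (L.sym (fraction-+ a b r c d s)) (L.+-cong A≈x B≈y)

    ⇝-* : ∀ {A B x y} → A ⇝ x → B ⇝ y → A *f B ⇝ x L.* y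
    ⇝-* {a , b} {c , d} (r , A≈x) (s , B≈y) = regular-* P {b} {d} r s , L.trans (L.sym (fraction-* a b r c d s)) (L.*-cong A≈x B≈y)

    ⇝-resp : ∀ {A x y} → x L.≈ y → A ⇝ x → A ⇝ y
    ⇝-resp x≈y (reg , A≈x) = reg , L.trans A≈x x≈y

    ⇝-poly : ∀ f → poly f ⇝ ι f
    ⇝-poly f = regular-1 P , L.refl

    ⇝-minus : ∀ {A B x y} → A ⇝ x → B ⇝ y → A -f B ⇝ x L.- y
    ⇝-minus {A} {B} {x} {y} A⇝x B⇝y = ⇝-resp {A -f B} (L.+-congˡ (L.trans (L.*-congʳ ι-1) (-1*x≈-x y)))
        (⇝-+ {A} {poly (- 1#) *f B} A⇝x (⇝-* {poly (- 1#)} {B} (⇝-poly (- 1#)) B⇝y))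
      where
      ι-1 : ι (- 1#) L.≈ L.- L.1#
      ι-1 = L.trans (L.sym (fraction-neg 1# 1# (regular-1 P))) (L.-‿cong fraction-1)

    ⇝-sum : ∀ m (F : ℕ → Frac) f → (∀ k → F k ⇝ f k) → sumF m F ⇝ LX.∑ m f
    ⇝-sum m F f F⇝f = go m (λ k → k)
      where
      -- The sum is folded from the front, and splitting off its first term replaces g by `g ∘ suc`;
      -- hence the generalization of `upTo` to `applyUpTo g`.
      go : ∀ m g → foldr (λ k acc → F k +f acc) 0f (applyUpTo g m) ⇝ LX.∑ m (f ∘ g)
      go zero    g = ⇝-resp {0f} fraction-0 (⇝-poly 0ₚ)
      go (suc m) g = ⇝-resp {F (g 0) +f rest} (L.sym (LX.∑-front m (f ∘ g)))
          (⇝-+ {F (g 0)} {rest} (F⇝f (g 0)) (go m (g ∘ suc)))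
        where rest = foldr (λ k acc → F k +f acc) 0f (applyUpTo (g ∘ suc) m)

    ⇝-unique : ∀ {A B x} → A ⇝ x → B ⇝ x → P ∣ proj₁ A * proj₂ B - proj₁ B * proj₂ A
    ⇝-unique (_ , A≈x) (_ , B≈x) = fraction-injective (L.trans A≈x (L.sym B≈x))

    ⇝0 : ∀ {A} → A ⇝ L.0# → P ∣ proj₁ A
    ⇝0 {a , b} (r , A≈0) = ∣ʳ-respʳ-≈ (solve 2 (λ a b → a :* 𝟙 :- con (+ 0) :* b := a) refl a b)
      (fraction-injective {a} {b} {r} (L.trans A≈0 (L.sym fraction-0)))

  module At (P : Poly) (q-regular : Regular P q) (1+q^-regular : ∀ i → Regular P (1# + q ^ suc i)) where
    open Represent P

    plus-regular : ∀ k → Regular P (plus-poch k * plus-poch k)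
    plus-regular k = regular-* P {plus-poch k} {plus-poch k} reg reg
      where reg = regular-∏ k (λ i → 1# + q ^ suc i) λ i _ → 1+q^-regular i

    qᴸ qᴸ⁻ pᴸ : L.Carrier
    qᴸ  = ι q
    qᴸ⁻ = fraction 1# q q-regular
    pᴸ  = qᴸ L.* qᴸ

    τ : ℕ → L.Carrier
    τ k = fraction (central k) (plus-poch k * plus-poch k) (plus-regular k)

    qq⁻≈1 : qᴸ L.* qᴸ⁻ L.≈ L.1#
    qq⁻≈1 = proj₂ (ι-unit q-regular)

    pᴸ^ : ∀ k → pᴸ ^ᴸ k L.≈ ι (p ^ k)
    pᴸ^ k = L.trans (^ᴸ-congˡ k (ι-* q q)) (ι-^ p k)

    1-ι : ∀ f {x} → x L.≈ ι f → L.1# L.- x L.≈ ι (1# - f)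
    1-ι f x≈ιf = L.trans (L.+-cong (L.sym fraction-1) (L.-‿cong x≈ιf)) (ι-minus 1# f)

    qp^≈ : ∀ k → qᴸ L.* pᴸ ^ᴸ k L.≈ ι (q * p ^ k)
    qp^≈ k = L.trans (L.*-congˡ (pᴸ^ k)) (ι-* q (p ^ k))

    τ-zero : τ 0 L.≈ L.1#
    τ-zero = L.trans (fraction-≈ (solve 0 (𝟙 :* 𝟙 := 𝟙 :* (𝟙 :* 𝟙)) refl)) fraction-1

    fraction-*ι : ∀ a b r f → fraction a b r L.* ι f L.≈ fraction (a * f) b r
    fraction-*ι a b r f = L.trans (fraction-* a b r f 1# (regular-1 P))
      (fraction-≈ (solve 3 (λ a b f → a :* f :* b := a :* f :* (b :* 𝟙)) refl a b f))

    τ-suc : ∀ k → τ (suc k) L.* (L.1# L.- pᴸ ^ᴸ suc k) L.≈ τ k L.* (L.1# L.- qᴸ L.* pᴸ ^ᴸ k)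
    τ-suc k = L.trans (L.*-congˡ (1-ι (p ^ suc k) (pᴸ^ (suc k))))
      (L.trans (fraction-*ι _ _ (plus-regular (suc k)) (1# - p ^ suc k))
      (L.trans (fraction-≈ (central-suc k))
      (L.sym (L.trans (L.*-congˡ (1-ι (q * p ^ k) (qp^≈ k))) (fraction-*ι _ _ (plus-regular k) (1# - q * p ^ k))))))

    ⟦4_+1⟧ : ℕ → L.Carrier
    ⟦4 k +1⟧ = ι (qint (4 ℕ.* k ℕ.+ 1))

    ι-qint : ∀ m → ι (qint m) L.* (L.1# L.- qᴸ) L.≈ ι (1# - q ^ m)
    ι-qint m = L.trans (L.*-congˡ (1-ι q L.refl)) (L.trans (ι-* (qint m) (1# - q)) (ι-cong (qint[1-q] m)))

    ⟦4k+1⟧[1-q] : ∀ k → ⟦4 k +1⟧ L.* (L.1# L.- qᴸ) L.≈ L.1# L.- qᴸ L.* (pᴸ ^ᴸ k L.* pᴸ ^ᴸ k)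
    ⟦4k+1⟧[1-q] k = L.trans (ι-qint (4 ℕ.* k ℕ.+ 1)) (L.sym (1-ι (q ^ (4 ℕ.* k ℕ.+ 1))
      (L.trans (L.*-congˡ (L.trans (L.*-cong (pᴸ^ k) (pᴸ^ k)) (ι-* (p ^ k) (p ^ k))))
      (L.trans (ι-* q (p ^ k * p ^ k)) (ι-cong (sym exponent))))))
      where
      exponent : q ^ (4 ℕ.* k ℕ.+ 1) ≋ q * (p ^ k * p ^ k)
      exponent = begin
        q ^ (4 ℕ.* k ℕ.+ 1)              ≡⟨ ≡.cong (q ^_) (≡.trans (ℕ.+-comm (4 ℕ.* k) 1) (≡.cong suc (ℕ.*-distribʳ-+ k 2 2))) ⟩
        q * q ^ (2 ℕ.* k ℕ.+ 2 ℕ.* k)    ≈⟨ *-congˡ {q} (^-homo-* q (2 ℕ.* k) (2 ℕ.* k)) ⟩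
        q * (q ^ (2 ℕ.* k) * q ^ (2 ℕ.* k)) ≈⟨ *-congˡ {q} (*-cong (p^k≋q^2k k) (p^k≋q^2k k)) ⟨
        q * (p ^ k * p ^ k)              ∎

    summand summand′ : ℕ → L.Carrier
    summand  k = ⟦4 k +1⟧ L.* τ k ^ᴸ 6 L.* qᴸ ^ᴸ k
    summand′ k = τ k ^ᴸ 4 L.* pᴸ ^ᴸ k

    reduced⇝ : ∀ k → reduced k ⇝ summand k
    reduced⇝ k = regular-^ (plus-poch k * plus-poch k) (plus-regular k) 6 , L.sym (L.trans
      (L.*-cong (L.*-congˡ (fraction-^ _ _ (plus-regular k) 6)) (ι-^ q k))
      (L.trans (L.*-congʳ (fraction-* _ _ (regular-1 P) _ _ (regular-^ (plus-poch k * plus-poch k) (plus-regular k) 6)))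
      (L.trans (fraction-*ι _ _ _ (q ^ k))
      (fraction-≈ (solve 2 (λ n s → n :* s := n :* (𝟙 :* s)) refl
         (qint (4 ℕ.* k ℕ.+ 1) * central k ^ 6 * q ^ k) ((plus-poch k * plus-poch k) ^ 6))))))

    reduced′⇝ : ∀ k → reduced′ k ⇝ summand′ k
    reduced′⇝ k = regular-^ (plus-poch k * plus-poch k) (plus-regular k) 4 , L.sym (L.trans
      (L.*-cong (fraction-^ _ _ (plus-regular k) 4) (pᴸ^ k))
      (fraction-*ι _ _ (regular-^ (plus-poch k * plus-poch k) (plus-regular k) 4) (p ^ k)))

    power⇝ : ∀ N → (1ₚ , qpow N) ⇝ qᴸ⁻ ^ᴸ N
    power⇝ N = regular-resp P (sym (qpow≋q^ N)) (regular-^ q q-regular N) , L.trans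
      (fraction-≈ (*-cong (sym (1^ N)) (sym (qpow≋q^ N)))) (L.sym (fraction-^ 1# q q-regular N))
      where
      1^ : ∀ N → 1# ^ N ≋ 1#
      1^ zero    = refl
      1^ (suc N) = trans (*-identityˡ (1# ^ N)) (1^ N)

  side : ℕ → ℕ → (ℕ → Frac) → Frac
  side n N F = poly (qint n) *f (1ₚ , qpow N) *f sumF (suc N) F

  term term′ : ℕ → Frac
  term  k = qint (4 ℕ.* k ℕ.+ 1) *ₚ (qpoch 1 2 k ^ₚ 6) *ₚ qpow k , qpoch 2 2 k ^ₚ 6
  term′ k = (qpoch 1 2 k ^ₚ 4) *ₚ qpow (2 ℕ.* k) , qpoch 2 2 k ^ₚ 4

  module Difference (P : Poly) (q-regular : Regular P q) (1+q^-regular : ∀ i → Regular P (1# + q ^ suc i)) where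
    open Represent P
    open At P q-regular 1+q^-regular

    sideᴸ : ℕ → ℕ → L.Carrier
    sideᴸ n N = ι (qint n) L.* qᴸ⁻ ^ᴸ N L.* LX.∑ (suc N) summand′

    difference⇝ : ∀ (F F′ : ℕ → Frac) → (∀ k → F k ⇝ summand k) → (∀ k → F′ k ⇝ summand′ k) →
      ∀ M n N → sumF M F -f side n N F′ ⇝ LX.∑ M summand L.- sideᴸ n N
    difference⇝ F F′ F⇝ F′⇝ M n N = ⇝-minus {sumF M F} {side n N F′} (⇝-sum M F summand F⇝)
      (⇝-* {poly (qint n) *f (1ₚ , qpow N)} {sumF (suc N) F′}
        (⇝-* {poly (qint n)} {1ₚ , qpow N} (⇝-poly (qint n)) (power⇝ N)) (⇝-sum (suc N) F′ summand′ F′⇝))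

    vanishing : ∀ M n N → LX.∑ M summand L.≈ sideᴸ n N → sumF M reduced -f side n N reduced′ ⇝ L.0#
    vanishing M n N eq = ⇝-resp {sumF M reduced -f side n N reduced′} (L.trans (L.+-congʳ eq) (L.-‿inverseʳ _))
      (difference⇝ reduced reduced′ reduced⇝ reduced′⇝ M n N)

  1+q^-monic : ∀ i → Monic (1# + q ^ suc i) (suc i)
  1+q^-monic i = monic-resp (CommutativeRing.+-comm ℤ[q] (q ^ suc i) 1#) (monic-+ 1# (monic-q^ (suc i)) λ { (suc _) _ → ≡.refl })

  q-monic : Monic q 1
  q-monic = monic-resp (*-identityʳ q) (monic-q^ 1)

  -- Comparison with the fractions of the theorem in the case P = 0

  module Rational where
    open Represent 0#
    open At 0# (monic-regular-0 q-monic) (λ i → monic-regular-0 (1+q^-monic i))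
    open Difference 0# (monic-regular-0 q-monic) (λ i → monic-regular-0 (1+q^-monic i))

    qpoch-regular : ∀ k j → Regular 0# (qpoch 2 2 k ^ₚ j)
    qpoch-regular k j = ≡.subst (Regular 0#) (≡.sym (^ₚ≡^ (qpoch 2 2 k) j))
      (regular-^ (qpoch 2 2 k) (regular-resp 0# (sym (qpoch-even k)) (even-poch-regular-0 k)) j)

    cross-powers : ∀ k j → qpoch 1 2 k ^ₚ j * (plus-poch k * plus-poch k) ^ j ≋ central k ^ j * qpoch 2 2 k ^ₚ j
    cross-powers k j = begin
      qpoch 1 2 k ^ₚ j * S ^ j         ≈⟨ *-congʳ {S ^ j} (trans (reflexive (^ₚ≡^ (qpoch 1 2 k) j)) (^-congˡ j (qpoch-odd k))) ⟩
      odd-poch k ^ j * S ^ j           ≈⟨ ^-distrib-* (odd-poch k) S j ⟨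
      (odd-poch k * S) ^ j             ≈⟨ ^-congˡ j (central-even k) ⟨
      (central k * even-poch k) ^ j    ≈⟨ ^-distrib-* (central k) (even-poch k) j ⟩
      central k ^ j * even-poch k ^ j  ≈⟨ *-congˡ {central k ^ j} (trans (reflexive (^ₚ≡^ (qpoch 2 2 k) j)) (^-congˡ j (qpoch-even k))) ⟨
      central k ^ j * qpoch 2 2 k ^ₚ j ∎
      where
      S = plus-poch k * plus-poch k
      open import Algebra.Properties.CommutativeSemiring.Exp (CommutativeRing.commutativeSemiring ℤ[q]) using (^-distrib-*)

    term⇝ : ∀ k → term k ⇝ summand k
    term⇝ k = qpoch-regular k 6 , L.trans (fraction-≈ (begin
        b * O⁶ * qpow k * S⁶            ≈⟨ solve 4 (λ b O x S → b :* O :* x :* S := O :* S :* (b :* x)) refl b O⁶ (qpow k) S⁶ ⟩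
        O⁶ * S⁶ * (b * qpow k)          ≈⟨ *-cong (cross-powers k 6) (*-congˡ {b} (qpow≋q^ k)) ⟩
        C⁶ * E⁶ * (b * q ^ k)           ≈⟨ solve 4 (λ C E b x → C :* E :* (b :* x) := b :* C :* x :* E) refl C⁶ E⁶ b (q ^ k) ⟩
        b * C⁶ * q ^ k * E⁶             ∎))
      (proj₂ (reduced⇝ k))
      where
      b = qint (4 ℕ.* k ℕ.+ 1) ; O⁶ = qpoch 1 2 k ^ₚ 6 ; E⁶ = qpoch 2 2 k ^ₚ 6
      S⁶ = (plus-poch k * plus-poch k) ^ 6 ; C⁶ = central k ^ 6

    term′⇝ : ∀ k → term′ k ⇝ summand′ k
    term′⇝ k = qpoch-regular k 4 , L.trans (fraction-≈ (begin
        O⁴ * qpow (2 ℕ.* k) * S⁴        ≈⟨ solve 3 (λ O x S → O :* x :* S := O :* S :* x) refl O⁴ (qpow (2 ℕ.* k)) S⁴ ⟩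
        O⁴ * S⁴ * qpow (2 ℕ.* k)        ≈⟨ *-cong (cross-powers k 4) (trans (qpow≋q^ (2 ℕ.* k)) (sym (p^k≋q^2k k))) ⟩
        C⁴ * E⁴ * p ^ k                 ≈⟨ solve 3 (λ C E x → C :* E :* x := C :* x :* E) refl C⁴ E⁴ (p ^ k) ⟩
        C⁴ * p ^ k * E⁴                 ∎))
      (proj₂ (reduced′⇝ k))
      where
      O⁴ = qpoch 1 2 k ^ₚ 4 ; E⁴ = qpoch 2 2 k ^ₚ 4
      S⁴ = (plus-poch k * plus-poch k) ^ 4 ; C⁴ = central k ^ 4

    0∣⇒≋0 : ∀ {f} → 0# ∣ f → f ≋ 0#
    0∣⇒≋0 (h , h0≋f) = trans (sym h0≋f) (zeroʳ h)

    -- The stated difference a / b and the rewritten a′ / b′ are the same rational function, so a b′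
    -- = a′ b. With a Y = X b this gives Y a′ = b′ X; thus P ∣ a′ implies P ∣ b′ X, and b′ is
    -- regular. The detour is made because b itself may fail to be regular modulo P.
    numerator-divisible : ∀ M n N {P} → P ∣ proj₁ (sumF M reduced -f side n N reduced′) →
      Regular P (proj₂ (sumF M reduced -f side n N reduced′)) →
      ∀ X Y → ReducedFormOf X Y (sumF M term -f side n N term′) → P ∣ X
    numerator-divisible M n N {P} P∣a′ reg X Y (_ , _ , aY≈Xb) = reg X (∣ʳ-respʳ-≈ Ya′≋b′X (∣-multiple P Y P∣a′))
      where
      A  = sumF M term -f side n N term′
      A′ = sumF M reduced -f side n N reduced′
      a = proj₁ A ; b = proj₂ A ; a′ = proj₁ A′ ; b′ = proj₂ A′
      A⇝ : A ⇝ LX.∑ M summand L.- sideᴸ n N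
      A⇝ = difference⇝ term term′ term⇝ term′⇝ M n N
      A′⇝ : A′ ⇝ LX.∑ M summand L.- sideᴸ n N
      A′⇝ = difference⇝ reduced reduced′ reduced⇝ reduced′⇝ M n N
      ab′≋a′b : a * b′ ≋ a′ * b
      ab′≋a′b = trans (solve 2 (λ x y → x := (x :- y) :+ y) refl (a * b′) (a′ * b))
        (trans (+-congʳ {a′ * b} (0∣⇒≋0 (⇝-unique {A} {A′} A⇝ A′⇝))) (+-identityˡ (a′ * b)))
      aY≋Xb : a * Y ≋ X * b
      aY≋Xb = coeffwise aY≈Xb
      Ya′≋b′X : Y * a′ ≋ b′ * X
      Ya′≋b′X = regular-0-cancel {b} (proj₁ A⇝) (begin
        b * (Y * a′)      ≈⟨ solve 3 (λ b Y a′ → b :* (Y :* a′) := a′ :* b :* Y) refl b Y a′ ⟩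
        a′ * b * Y        ≈⟨ *-congʳ {Y} ab′≋a′b ⟨
        a * b′ * Y        ≈⟨ solve 3 (λ a b Y → a :* b :* Y := a :* Y :* b) refl a b′ Y ⟩
        a * Y * b′        ≈⟨ *-congʳ {b′} aY≋Xb ⟩
        X * b * b′        ≈⟨ solve 3 (λ X b b′ → X :* b :* b′ := b :* (b′ :* X)) refl X b b′ ⟩
        b * (b′ * X)      ∎)

  -- Regularity modulo Φ_d for odd d

  1+x∣1+x^odd : ∀ x D → 1# + x ∣ 1# + x ^ (D ℕ.+ suc D)
  1+x∣1+x^odd x zero = 1# , solve 1 (λ x → 𝟙 :* (𝟙 :+ x) := 𝟙 :+ x :* 𝟙) refl x
  1+x∣1+x^odd x (suc D) = ∣ʳ-respʳ-≈
      (trans (solve 2 (λ x y → x :* x :* (𝟙 :+ y) :+ (𝟙 :- x) :* (𝟙 :+ x) := 𝟙 :+ x :* (x :* y)) refl x (x ^ (D ℕ.+ suc D)))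
        (+-congˡ {1#} (reflexive (≡.cong (λ k → x * x ^ k) (≡.sym (ℕ.+-suc D (suc D)))))))
      (∣-sum (1# + x) (∣-multiple (1# + x) (x * x) (1+x∣1+x^odd x D)) (1# - x , refl))

  module OddDivisor (D : ℕ) (0<D : 0 < D) where
    d : ℕ
    d = suc (D ℕ.+ D)

    d≡ : d ≡ D ℕ.+ suc D
    d≡ = ≡.sym (ℕ.+-suc D D)

    φ : Poly
    φ = Φ d

    φ∣q^d-1 : φ ∣ q ^ d - 1#
    φ∣q^d-1 = Cyclotomic.divides-q^n-1 (cyclotomic (D ℕ.+ D))

    φ-monic : ∃ (Monic φ)
    φ-monic = Cyclotomic.monic (cyclotomic (D ℕ.+ D))

    φ-cancelˡ : ∀ {f g} → φ * f ≋ φ * g → f ≋ g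
    φ-cancelˡ = monic-cancelˡ (proj₂ φ-monic)

    1-q^j-regular : ∀ j → ¬ d ℕ.∣ j → Regular φ (1# - q ^ j)
    1-q^j-regular j d∤j = negate-regular {φ} {q ^ j}
      (q^j-1-regular (D ℕ.+ D) (λ {i} _ → cyclotomic i) (cyclotomic (D ℕ.+ D)) j d∤j)

    <d⇒∤ : ∀ j → suc j < d → ¬ d ℕ.∣ suc j
    <d⇒∤ j j<d d∣j = ℕ.<⇒≱ j<d (ℕ.∣⇒≤ d∣j)

    -- Since (D + 1) · 2j = d j + j, d ∣ 2j would force d ∣ j, which is impossible for 0 < j < d.
    even-regular : ∀ k → k < D ℕ.+ D → Regular φ (1# - p ^ suc k)
    even-regular k k<2D = regular-resp φ (1-p^k≋1-q^2k (suc k)) (1-q^j-regular (2 ℕ.* suc k) λ d∣2j →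
      <d⇒∤ k (s≤s k<2D) (ℕ.∣m+n∣m⇒∣n (≡.subst (d ℕ.∣_) rearrange (ℕ.∣n⇒∣m*n (suc D) d∣2j)) (ℕ.m∣m*n (suc k))))
      where
      rearrange : suc D ℕ.* (2 ℕ.* suc k) ≡ d ℕ.* suc k ℕ.+ suc k
      rearrange = ℕS.solve 2 (λ D j → (ℕS.con 1 ℕS.:+ D) ℕS.:* (ℕS.con 2 ℕS.:* j) ℕS.:= (ℕS.con 1 ℕS.:+ (D ℕS.:+ D)) ℕS.:* j ℕS.:+ j) ≡.refl D (suc k)

    odd-regular : ∀ k → k < D → Regular φ (1# - q * p ^ k)
    odd-regular k k<D = regular-resp φ (+-congˡ {1#} (-‿cong (*-congˡ {q} (sym (p^k≋q^2k k)))))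
      (1-q^j-regular (suc (2 ℕ.* k)) (<d⇒∤ (2 ℕ.* k) (s≤s
        (≡.subst (_< D ℕ.+ D) (≡.cong (k ℕ.+_) (≡.sym (ℕ.+-identityʳ k))) (ℕ.+-mono-< k<D k<D)))))

    1-q-regular : Regular φ (1# - q)
    1-q-regular = regular-resp φ (+-congˡ {1#} (-‿cong (*-identityʳ q))) (1-q^j-regular 1 (<d⇒∤ 0 (s≤s (ℕ.≤-trans 0<D (ℕ.m≤m+n D D)))))

    -- q^(d-1) is an inverse of q modulo Φ_d.
    q-regular : Regular φ q
    q-regular f φ∣qf = ∣ʳ-respʳ-≈
      (solve 3 (λ x q f → x :* (q :* f) :+ :- f :* (q :* x :- 𝟙) := f) refl (q ^ (D ℕ.+ D)) q f)
      (∣-sum φ (∣-multiple φ (q ^ (D ℕ.+ D)) φ∣qf) (∣-multiple φ (- f) φ∣q^d-1))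

    -- 1 + q ^ j divides 1 + q ^ (j d), which is 2 modulo φ because d is odd.
    1+q^-regular : ∀ i → Regular φ (1# + q ^ suc i)
    1+q^-regular i = regular-factor φ 1+x∣1+x^d λ f φ∣[1+x^d]f →
      const-regular (proj₂ φ-monic) (+ 2) (λ ()) f (∣ʳ-respʳ-≈
        (trans (solve 2 (λ y f → (𝟙 :+ y) :* f :+ :- f :* (y :- 𝟙) := (𝟙 :+ 𝟙) :* f) refl (x ^ d) f) (*-congʳ {f} 2≋))
        (∣-sum φ φ∣[1+x^d]f (∣-multiple φ (- f) φ∣x^d-1)))
      where
      x = q ^ suc i
      2≋ : 1# + 1# ≋ const (+ 2)
      2≋ = refl
      1+x∣1+x^d : 1# + x ∣ 1# + x ^ d
      1+x∣1+x^d = ≡.subst (λ k → 1# + x ∣ 1# + x ^ k) (≡.sym d≡) (1+x∣1+x^odd x D)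
      φ∣x^d-1 : φ ∣ x ^ d - 1#
      φ∣x^d-1 = ∣ʳ-respʳ-≈ (+-congʳ { - 1#} (sym (^-assocʳ q (suc i) d)))
        (∣-trans φ∣q^d-1 (q^m-1∣q^km-1 d (suc i)))

    q*p^D≋q^d : q * p ^ D ≋ q ^ d
    q*p^D≋q^d = *-congˡ {q} (trans (p^k≋q^2k D) (reflexive (≡.cong (λ k → q ^ (D ℕ.+ k)) (ℕ.+-identityʳ D))))

    φ∣1-qp^D : φ ∣ 1# - q * p ^ D
    φ∣1-qp^D = ∣ʳ-respʳ-≈ (solve 1 (λ y → :- 𝟙 :* (y :- 𝟙) := 𝟙 :- y) refl (q * p ^ D))
      (∣-multiple φ (- 1#) (∣ʳ-respʳ-≈ (+-congʳ { - 1#} (sym q*p^D≋q^d)) φ∣q^d-1))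

    φ∣qint : ∀ k → φ ∣ qint (k ℕ.* d)
    φ∣qint k = 1-q-regular (qint (k ℕ.* d)) (∣ʳ-respʳ-≈
      (trans (trans (solve 1 (λ y → :- 𝟙 :* (y :- 𝟙) := 𝟙 :- y) refl (q ^ (k ℕ.* d))) (sym (qint[1-q] (k ℕ.* d)))) (*-comm (qint (k ℕ.* d)) (1# - q)))
      (∣-multiple φ (- 1#) (∣-trans φ∣q^d-1 (q^m-1∣q^km-1 d k))))

    -- P will be Φ_d³ or Φ_d; `lift` carries the regularity statements, all proved modulo Φ_d, to
    -- either.
    module Modulo (P : Poly) (lift : ∀ u → Regular φ u → Regular P u) (P∣cube : P ∣ (1# - q * p ^ D) ^ 3) where
      private
        q-reg : Regular P q
        q-reg = lift q q-regular
        1+q^-reg : ∀ i → Regular P (1# + q ^ suc i)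
        1+q^-reg i = lift (1# + q ^ suc i) (1+q^-regular i)
      open Represent P public
      open At P q-reg 1+q^-reg public
      open Difference P q-reg 1+q^-reg public

      nilpotent : (L.1# L.- qᴸ L.* pᴸ ^ᴸ D) ^ᴸ 3 L.≈ L.0#
      nilpotent = L.trans (^ᴸ-congˡ 3 (1-ι (q * p ^ D) (qp^≈ D))) (L.trans (ι-^ (1# - q * p ^ D) 3) (ι-≈0 P∣cube))

      module B = Summand.Blocks commutativeRing qᴸ qᴸ⁻ qq⁻≈1 D
        (λ k k<2D → LX.unit-resp (L.sym (1-ι (p ^ suc k) (pᴸ^ (suc k)))) (ι-unit (lift (1# - p ^ suc k) (even-regular k k<2D))))
        (λ k k<D → LX.unit-resp (L.sym (1-ι (q * p ^ k) (qp^≈ k))) (ι-unit (lift (1# - q * p ^ k) (odd-regular k k<D))))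
        (LX.unit-resp (L.sym (1-ι q L.refl)) (ι-unit (lift (1# - q) 1-q-regular)))
        nilpotent τ τ-zero τ-suc ⟦4_+1⟧ ⟦4k+1⟧[1-q] (ι (qint d))
        (L.trans (ι-qint d) (L.sym (1-ι (q ^ d) (L.trans (qp^≈ D) (ι-cong q*p^D≋q^d)))))

      half : LX.∑ (suc D) summand L.≈ sideᴸ d D
      half = B.half-sum

      full : LX.∑ d summand L.≈ sideᴸ d D
      full = ≡.subst (λ k → LX.∑ k summand L.≈ sideᴸ d D) (≡.sym d≡) (L.trans B.full-sum half)

    module Cube where
      φ²-lift : ∀ u → Regular φ u → Regular (φ * (φ * 1#)) u
      φ²-lift u reg = regular-mod-* {φ} {φ * 1#} {u} φ-cancelˡ reg
        (regular-mod-* {φ} {1#} {u} φ-cancelˡ reg (λ f _ → f , *-identityʳ f))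

      φ³-lift : ∀ u → Regular φ u → Regular (φ ^ 3) u
      φ³-lift u reg = regular-mod-* {φ} {φ * (φ * 1#)} {u} φ-cancelˡ reg (φ²-lift u reg)

      φ³∣cube : φ ∣ 1# - q * p ^ D → φ ^ 3 ∣ (1# - q * p ^ D) ^ 3
      φ³∣cube (h , hφ≋y) = h ^ 3 , trans (solve 2 (λ h φ → h :^ 3 :* φ :^ 3 := (h :* φ) :^ 3) refl h φ) (^-congˡ 3 hφ≋y)

      open Modulo (φ ^ 3) φ³-lift (φ³∣cube φ∣1-qp^D) public

    module Simple where
      φ∣cube : φ ∣ (1# - q * p ^ D) ^ 3
      φ∣cube = ∣ʳ-respʳ-≈ (solve 1 (λ y → y :* (y :* 𝟙) :* y := y :^ 3) refl y) (∣-multiple φ (y * (y * 1#)) φ∣1-qp^D)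
        where y = 1# - q * p ^ D

      open Modulo φ (λ _ reg → reg) φ∣cube public

      qp^D≈1 : qᴸ L.* pᴸ ^ᴸ D L.≈ L.1#
      qp^D≈1 = L.trans (qp^≈ D) (L.trans (fraction-cong (∣ʳ-respʳ-≈
          (solve 1 (λ y → :- 𝟙 :* (𝟙 :- y) := y :* 𝟙 :- 𝟙 :* 𝟙) refl (q * p ^ D)) (∣-multiple φ (- 1#) φ∣1-qp^D))) fraction-1)

      qint≈0 : ∀ k → ι (qint (k ℕ.* d)) L.≈ L.0#
      qint≈0 k = ι-≈0 (φ∣qint k)

      module RU = B.RootOfUnity qp^D≈1 (≡.subst (λ k → ι (qint k) L.≈ L.0#) (ℕ.*-identityˡ d) (qint≈0 1))

      side≈0 : ∀ k N → sideᴸ (k ℕ.* d) N L.≈ L.0#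
      side≈0 k N = L.trans (L.*-congʳ (L.trans (L.*-congʳ (qint≈0 k)) (L.zeroˡ _))) (L.zeroˡ _)

      full-blocks : ∀ n k N → n ≡ k ℕ.* d → LX.∑ n summand L.≈ sideᴸ n N
      full-blocks .(k ℕ.* d) k N ≡.refl =
        L.trans (≡.subst (λ d → LX.∑ (k ℕ.* d) summand L.≈ L.0#) (≡.sym d≡) (RU.sum-full-blocks k)) (L.sym (side≈0 k N))

      half-blocks : ∀ M l n k N → M ≡ suc D ℕ.+ l ℕ.* d → n ≡ k ℕ.* d → LX.∑ M summand L.≈ sideᴸ n N
      half-blocks M l .(k ℕ.* d) k N M≡ ≡.refl =
        L.trans (≡.subst (λ M → LX.∑ M summand L.≈ L.0#) (≡.trans (≡.cong (λ d → suc D ℕ.+ l ℕ.* d) (≡.sym d≡)) (≡.sym M≡)) (RU.sum-half-blocks l))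
                (L.sym (side≈0 k N))

  -- Index arithmetic and assembly of the moduli

  parity : ∀ d → (∃ λ D → d ≡ D ℕ.+ D) ⊎ (∃ λ D → d ≡ suc (D ℕ.+ D))
  parity zero = inj₁ (0 , ≡.refl)
  parity (suc d) with parity d
  ... | inj₁ (D , eq) = inj₂ (D , ≡.cong suc eq)
  ... | inj₂ (D , eq) = inj₁ (suc D , ≡.trans (≡.cong suc eq) (≡.cong suc (≡.sym (ℕ.+-suc D D))))

  odd-factor : ∀ k d N → suc (N ℕ.+ N) ≡ k ℕ.* d → ∃ λ D → d ≡ suc (D ℕ.+ D)
  odd-factor k d N eq with parity d
  ... | inj₂ odd = odd
  ... | inj₁ (D , ≡.refl) = ⊥-elim (ℕ.even≢odd (k ℕ.* D) N (≡.trans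
      (ℕS.solve 2 (λ k D → ℕS.con 2 ℕS.:* (k ℕS.:* D) ℕS.:= k ℕS.:* (D ℕS.:+ D)) ≡.refl k D)
      (≡.trans (≡.sym eq) (≡.cong (λ x → suc (N ℕ.+ x)) (≡.sym (ℕ.+-identityʳ N))))))

  half-index : ∀ l D N → suc (N ℕ.+ N) ≡ suc (l ℕ.+ l) ℕ.* suc (D ℕ.+ D) → N ≡ D ℕ.+ l ℕ.* suc (D ℕ.+ D)
  half-index l D N eq = ≡.trans (ℕ.n≡⌊n+n/2⌋ N) (≡.trans (≡.cong ℕ.⌊_/2⌋ doubled) (≡.sym (ℕ.n≡⌊n+n/2⌋ M)))
    where
    M = D ℕ.+ l ℕ.* suc (D ℕ.+ D)
    doubled : N ℕ.+ N ≡ M ℕ.+ M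
    doubled = ℕ.suc-injective (≡.trans eq (ℕS.solve 2 (λ l D → let d = ℕS.con 1 ℕS.:+ (D ℕS.:+ D) in
      (ℕS.con 1 ℕS.:+ (l ℕS.:+ l)) ℕS.:* d ℕS.:= ℕS.con 1 ℕS.:+ ((D ℕS.:+ l ℕS.:* d) ℕS.:+ (D ℕS.:+ l ℕS.:* d))) ≡.refl l D))

  -- Dividing the product formula for q^n - 1 by q - 1 = Φ₁ leaves [n]. Φ₁ is the factor of index 0,
  -- which the composition with `suc` drops.
  qint-factors : ∀ m → qint (suc (suc m)) ≋ ∏ m (factor (suc (suc m)) ∘ suc) * Φ (suc (suc m))
  qint-factors m = monic-cancelˡ (monic-resp (+-congʳ { - 1#} (*-identityʳ q)) (monic-q^-1 0)) (begin
    (q - 1#) * qint n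
      ≈⟨ solve 2 (λ q x → (q :- 𝟙) :* x := :- (x :* (𝟙 :- q))) refl q (qint n) ⟩
    - (qint n * (1# - q))
      ≈⟨ -‿cong (qint[1-q] n) ⟩
    - (1# - q ^ n)
      ≈⟨ solve 1 (λ x → :- (𝟙 :- x) := x :- 𝟙) refl (q ^ n) ⟩
    q ^ n - 1#
      ≈⟨ Cyclotomic.product (cyclotomic (suc m)) ⟨
    ∏ (suc m) (factor n) * Φ n
      ≈⟨ *-congʳ {Φ n} (∏-front m (factor n)) ⟩
    factor n 0 * ∏ m (factor n ∘ suc) * Φ n
      ≈⟨ *-congʳ {Φ n} (*-congʳ {∏ m (factor n ∘ suc)} Φ₁) ⟩
    (q - 1#) * ∏ m (factor n ∘ suc) * Φ n
      ≈⟨ *-assoc (q - 1#) (∏ m (factor n ∘ suc)) (Φ n) ⟩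
    (q - 1#) * (∏ m (factor n ∘ suc) * Φ n) ∎)
    where
    n = suc (suc m)
    Φ₁ : factor n 0 ≋ q - 1#
    Φ₁ = trans (reflexive (factor-divisor n 0 (ℕ.1∣ n))) (trans (sym (*-identityˡ (Φ 1)))
      (trans (Cyclotomic.product (cyclotomic 0)) (+-congʳ { - 1#} (*-identityʳ q))))

  infix 4 _≡ᴺ_[mod_]
  _≡ᴺ_[mod_] : Frac → Frac → Poly → Set
  A ≡ᴺ B [mod P ] = ∀ X Y → ReducedFormOf X Y (A -f B) → P ∣ X

  -- Both sides consist of the term k = 0 and equal [1], so the difference is 0 as a rational
  -- function and X = 0.
  modulo-1 : ∀ P → sumF 1 term ≡ᴺ side 1 0 term′ [mod P ]
  modulo-1 P X Y reduced-form = 0# , trans (zeroˡ P) (sym (0∣⇒≋0 (numerator-divisible 1 1 0 (⇝0 {A′} A′⇝0) (proj₁ A′⇝0) X Y reduced-form)))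
    where
    open Rational
    open Represent 0#
    open At 0# (monic-regular-0 q-monic) (λ i → monic-regular-0 (1+q^-monic i))
    open Difference 0# (monic-regular-0 q-monic) (λ i → monic-regular-0 (1+q^-monic i))
    open IntegerRingSolver commutativeRing using () renaming (solve to solveᴸ; _:*_ to _⊗_; _:+_ to _⊕_; _:^_ to _⊛_; _:=_ to _⊜_; con to conᴸ; 𝟙 to 𝟙ᴸ)
    A′ = sumF 1 reduced -f side 1 0 reduced′
    A′⇝0 : A′ ⇝ L.0#
    A′⇝0 = vanishing 1 1 0 (L.trans
      (L.+-congˡ (L.*-congʳ (L.*-congˡ (^ᴸ-congˡ 6 τ-zero))))
      (L.trans (solveᴸ 1 (λ b → conᴸ (+ 0) ⊕ b ⊗ 𝟙ᴸ ⊛ 6 ⊗ 𝟙ᴸ ⊜ b ⊗ 𝟙ᴸ ⊗ (conᴸ (+ 0) ⊕ 𝟙ᴸ ⊛ 4 ⊗ 𝟙ᴸ)) L.refl (ι (qint 1)))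
      (L.*-congˡ (L.+-congˡ (L.*-congʳ (^ᴸ-congˡ 4 (L.sym τ-zero)))))))

  -- M counts the terms of the left side, so the sum up to N has M = N + 1.
  Endpoint : ℕ → ℕ → ℕ → Set
  Endpoint n N M = M ≡ n ⊎ M ≡ suc N

  modulo-cube : ∀ N → 0 < N → ∀ n → n ≡ suc (N ℕ.+ N) → ∀ {M} → Endpoint n N M →
    sumF M term ≡ᴺ side n N term′ [mod Φ (suc (N ℕ.+ N)) ^ 3 ]
  modulo-cube N 0<N n n≡ {M} range X Y = Rational.numerator-divisible M n N (⇝0 {A′} A′⇝0) (proj₁ A′⇝0) X Y
    where
    open OddDivisor.Cube N 0<N
    A′ = sumF M reduced -f side n N reduced′
    equal : Endpoint n N M → LX.∑ M summand L.≈ sideᴸ n N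
    equal (inj₁ M≡n)   = ≡.subst₂ (λ M n → LX.∑ M summand L.≈ sideᴸ n N) (≡.sym (≡.trans M≡n n≡)) (≡.sym n≡) full
    equal (inj₂ M≡1+N) = ≡.subst₂ (λ M n → LX.∑ M summand L.≈ sideᴸ n N) (≡.sym M≡1+N) (≡.sym n≡) half
    A′⇝0 : A′ ⇝ L.0#
    A′⇝0 = vanishing M n N (equal range)

  -- Both d and k = n / d are odd: the first makes the denominators (-q;q)ₖ² regular modulo Φ_d, the
  -- second puts (n - 1)/2 in the middle of a block.
  modulo-divisor : ∀ N d n → n ≡ suc (N ℕ.+ N) → 1 < d → d ℕ.∣ n → ∀ {M} → Endpoint n N M →
    sumF M term ≡ᴺ side n N term′ [mod Φ d ]
  modulo-divisor N d n n≡ 1<d (divides k n≡kd) {M} range =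
    go (odd-factor k d N n≡kd′) (odd-factor d k N (≡.trans n≡kd′ (ℕ.*-comm k d)))
    where
    n≡kd′ : suc (N ℕ.+ N) ≡ k ℕ.* d
    n≡kd′ = ≡.trans (≡.sym n≡) n≡kd
    go : (∃ λ D → d ≡ suc (D ℕ.+ D)) → (∃ λ l → k ≡ suc (l ℕ.+ l)) → sumF M term ≡ᴺ side n N term′ [mod Φ d ]
    go (zero , d≡1) _ = ⊥-elim (ℕ.<-irrefl (≡.sym d≡1) 1<d)
    go (D@(suc _) , d≡) (l , k≡) = ≡.subst (λ d → sumF M term ≡ᴺ side n N term′ [mod Φ d ]) (≡.sym d≡) conclusion
      where
      open OddDivisor.Simple D (s≤s z≤n)
      A′ = sumF M reduced -f side n N reduced′
      equal : Endpoint n N M → LX.∑ M summand L.≈ sideᴸ n N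
      equal (inj₁ M≡n) = ≡.subst (λ M → LX.∑ M summand L.≈ sideᴸ n N) (≡.sym M≡n)
        (full-blocks n k N (≡.trans n≡kd (≡.cong (k ℕ.*_) d≡)))
      equal (inj₂ M≡1+N) = half-blocks M l n k N
        (≡.trans M≡1+N (≡.cong suc (half-index l D N (≡.trans n≡kd′ (≡.cong₂ ℕ._*_ k≡ d≡)))))
        (≡.trans n≡kd (≡.cong (k ℕ.*_) d≡))
      A′⇝0 : A′ ⇝ L.0#
      A′⇝0 = vanishing M n N (equal range)
      conclusion : sumF M term ≡ᴺ side n N term′ [mod Φ (suc (D ℕ.+ D)) ]
      conclusion = Rational.numerator-divisible M n N (⇝0 {A′} A′⇝0) (proj₁ A′⇝0)

  modulus : ℕ → Poly
  modulus n = qint n *ₚ (cyclo n ^ₚ 2)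

  modulus-factors : ∀ m → modulus (suc (suc m)) ≋ ∏ m (factor (suc (suc m)) ∘ suc) * Φ (suc (suc m)) ^ 3
  modulus-factors m = begin
    qint n * (cyclo n ^ₚ 2)       ≈⟨ *-cong (qint-factors m) (trans (reflexive (^ₚ≡^ (cyclo n) 2)) (^-congˡ 2 (reflexive (≡.sym (Φ≡cyclo n))))) ⟩
    Π * Φ n * Φ n ^ 2             ≈⟨ *-assoc Π (Φ n) (Φ n ^ 2) ⟩
    Π * (Φ n * Φ n ^ 2)           ∎
    where n = suc (suc m) ; Π = ∏ m (factor n ∘ suc)

  modulo-modulus : ∀ N n → n ≡ suc (N ℕ.+ N) → ∀ {M} → Endpoint n N M → sumF M term ≡ᴺ side n N term′ [mod modulus n ]
  modulo-modulus zero n ≡.refl (inj₁ ≡.refl) = modulo-1 (modulus 1)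
  modulo-modulus zero n ≡.refl (inj₂ ≡.refl) = modulo-1 (modulus 1)
  modulo-modulus N@(suc N′) n n≡ {M} range X Y reduced-form =
    ≡.subst (λ n → modulus n ∣ X) (≡.sym n≡2+m) (∣ʳ-respˡ-≈ (sym (modulus-factors m))
      (coprime-product-divides {Π} {Φ (suc (suc m)) ^ 3} Π-regular Π∣X Φ³∣X))
    where
    -- With N = N′ + 1, the number 2N + 1 computes to m + 2, the shape in which [n] is factored.
    m = N′ ℕ.+ suc N′
    n≡2+m : n ≡ suc (suc m)
    n≡2+m = n≡
    Π = ∏ m (factor (suc (suc m)) ∘ suc)
    Π-regular : Regular (Φ (suc (suc m)) ^ 3) Π
    Π-regular = OddDivisor.Cube.φ³-lift N (s≤s z≤n) Π (regular-∏ m (factor (suc (suc m)) ∘ suc) λ i i<m →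
      factor-regular (suc (suc m)) (suc i) (Φ-regular (suc m) (λ {k} _ → cyclotomic k) (cyclotomic (suc m)) (suc i) (s≤s i<m)))
    Φ³∣X : Φ (suc (suc m)) ^ 3 ∣ X
    Φ³∣X = modulo-cube N (s≤s z≤n) n n≡ range X Y reduced-form
    Π∣X : Π ∣ X
    Π∣X = ∏-divides m (factor (suc (suc m)) ∘ suc)
      (λ i i<m → factor-cases (_∣ X) (suc (suc m)) (suc i)
        (λ d∣n → modulo-divisor N (suc (suc i)) n n≡ (s≤s (s≤s z≤n)) (≡.subst (suc (suc i) ℕ.∣_) (≡.sym n≡2+m) d∣n) range X Y reduced-form)
        (λ _ → X , *-identityʳ X))
      (λ i j i<j _ → factors-regular (suc (suc m)) (suc i) (suc j) (λ {k} _ → cyclotomic k) (s≤s i<j))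

  congruence : ∀ n N → n ≡ suc (N ℕ.+ N) → ∀ {M} → Endpoint n N M → sumF M term ≡ side n N term′ [mod modulus n ]
  congruence n N n≡ range X Y reduced-form = convert (modulo-modulus N n n≡ range X Y reduced-form)
    where
    convert : modulus n ∣ X → modulus n ∣ₚ X
    -- The cofactor stands on the left in `_∣_` and on the right in `_∣ₚ_`.
    convert (c , c*modulus≋X) = c , coeffs (trans (sym c*modulus≋X) (*-comm c (modulus n)))

  half≡ : ∀ n → n ℕ.% 2 ≡ 1 → n ≡ suc ((n ∸ 1) ℕ./ 2 ℕ.+ (n ∸ 1) ℕ./ 2)
  half≡ n n-odd = ≡.trans n≡ (≡.cong suc (≡.trans (double h) (≡.cong (λ k → k ℕ.+ k) (≡.sym [n-1]/2≡h))))
    where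
    h = n ℕ./ 2
    double : ∀ h → h ℕ.* 2 ≡ h ℕ.+ h
    double h = ≡.trans (ℕ.*-comm h 2) (≡.cong (h ℕ.+_) (ℕ.+-identityʳ h))
    n≡ : n ≡ suc (h ℕ.* 2)
    n≡ = ≡.trans (ℕ.m≡m%n+[m/n]*n n 2) (≡.cong (ℕ._+ h ℕ.* 2) n-odd)
    [n-1]/2≡h : (n ∸ 1) ℕ./ 2 ≡ h
    [n-1]/2≡h = ≡.trans (≡.cong (λ k → (k ∸ 1) ℕ./ 2) n≡) (ℕ.m*n/n≡m h 2)

open import Data.Nat using (ℕ; _+_; _*_; _∸_; _/_; _%_; suc)
open import Data.Product using (_×_; _,_)
open import Relation.Binary.PropositionalEquality using (_≡_)

theorem2p1 : (n : ℕ) → n % 2 ≡ 1 →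
    let term6 = λ (k : ℕ) →
          (qint (4 * k + 1) *ₚ (qpoch 1 2 k ^ₚ 6) *ₚ qpow k , qpoch 2 2 k ^ₚ 6)
        rhs = poly (qint n) *f (1ₚ , qpow ((n ∸ 1) / 2))
          *f sumF (suc ((n ∸ 1) / 2))
               (λ k → ((qpoch 1 2 k ^ₚ 4) *ₚ qpow (2 * k) , qpoch 2 2 k ^ₚ 4))
        modulus = qint n *ₚ (cyclo n ^ₚ 2)
    in (sumF n term6 ≡ rhs [mod modulus ])
       × (sumF (suc ((n ∸ 1) / 2)) term6 ≡ rhs [mod modulus ])
theorem2p1 n n-odd =
  congruence n ((n ∸ 1) / 2) (half≡ n n-odd) (inj₁ ≡.refl) , congruence n ((n ∸ 1) / 2) (half≡ n n-odd) (inj₂ ≡.refl)
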